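{- Let $d$ and $k$ be given positive integers. Then there exist constants $A_{d,k}$ and $B_{d,k}$ such that, as $n\to\infty$, $$\mathbb{E}[X_{n,dn+1}^k]=A_{d,k}\,n^{2k}+O(n^{2k-1}),\qquad \mathbb{E}[X_{n,dn-1}^k]=B_{d,k}\,n^{2k}+O(n^{2k-1}).$$
   Context: A partition $\lambda=(\lambda_1\ge\dots\ge\lambda_\ell)$ has size $|\lambda|=\sum_i\lambda_i$. The hook length of a box of its Young diagram is the number of boxes directly to its right, directly below it, plus the box itself. For a positive integer $t$, $\lambda$ is a $t$-core if none of its hook lengths is divisible by $t$; an $(s,t)$-core is both an $s$-core and a $t$-core. For coprime $s,t$, $X_{s,t}$ denotes the size of a partition chosen uniformly at random from the finite set of $(s,t)$-core partitions with distinct parts. -}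

module Defs where

open import Data.Nat as ℕ using (ℕ; zero; suc; _∸_; _^_; _≤ᵇ_)
import Data.Nat.Properties as ℕP
open import Data.Nat.Divisibility using (_∣_)
open import Data.Integer using (+_)
open import Data.Rational using (ℚ; _/_; _+_; _-_; _*_; ∣_∣; _≤_)
open import Data.Nat.ListAction using (sum)
open import Data.List using (List; []; _∷_; length; filter; map; concat; upTo; applyUpTo)
open import Data.List.Relation.Unary.All using (All)
open import Data.List.Relation.Unary.Linked using (Linked)
open import Data.List.Relation.Unary.Unique.Propositional using (Unique)
open import Data.List.Membership.Propositional using (_∈_)
open import Data.Product using (Σ; _×_)
open import Function.Bundles using (_⇔_)
open import Relation.Nullary using (¬_)

ℕ→ℚ : ℕ → ℚ
ℕ→ℚ m = (+ m) / 1

DistinctPartition : List ℕ → Set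
DistinctPartition λs = Linked ℕ._>_ λs × All (0 ℕ.<_) λs

size : List ℕ → ℕ
size = sum

conj : List ℕ → ℕ → ℕ
conj λs j = length (filter (λ r → j ℕ.≤? r) λs)

-- hook lengths of all boxes; row i (0-based), column j (1-based, 1 ≤ j ≤ λ_i):
-- hook = (λ_i - j) + (λ'_j - (i+1)) + 1
hooks : List ℕ → List ℕ
hooks λs = go 0 λs
  where
  go : ℕ → List ℕ → List ℕ
  go i [] = []
  go i (r ∷ rs) =
    applyUpTo (λ j₀ → (r ∸ suc j₀) ℕ.+ (conj λs (suc j₀) ∸ suc i) ℕ.+ 1) r
    Data.List.++ go (suc i) rs

IsCore : ℕ → List ℕ → Set
IsCore t λs = All (λ h → ¬ (t ∣ h)) (hooks λs)

DistinctCore : ℕ → ℕ → List ℕ → Set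
DistinctCore s t λs = DistinctPartition λs × IsCore s λs × IsCore t λs

-- enum n is a duplicate-free list of exactly the (s n, t n)-cores with distinct parts,
-- for all n ≥ 2 (where s n, t n ≥ 1 and the set is finite)
Enumerates : (ℕ → ℕ) → (ℕ → ℕ) → (ℕ → List (List ℕ)) → Set
Enumerates s t enum =
  ∀ n → 2 ℕ.≤ n → Unique (enum n) × (∀ λs → (λs ∈ enum n) ⇔ DistinctCore (s n) (t n) λs)

moment : ℕ → List (List ℕ) → ℚ
moment k L with length L
... | zero = ℕ→ℚ 0
... | suc m = (+ sum (map (λ λs → size λs ^ k) L)) / suc m

-- "f n = A n^e + O(n^(e-1))" for some real constant A. The real A is given
-- as a regular Cauchy sequence of rationals a (|a i - A| ≤ 1/(i+1));
-- the bound |f n - A n^e| ≤ C n^(e-1) is expressed equivalently as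
-- ∀ i, |f n - a i n^e| ≤ C n^(e-1) + n^e/(i+1).
HasLeadingTerm : (ℕ → ℚ) → ℕ → Set
HasLeadingTerm f e =
  Σ (ℕ → ℚ) λ a →
    (∀ i j → ∣ a i - a j ∣ ≤ (+ 1) / suc i + (+ 1) / suc j) ×
    Σ ℚ λ C → Σ ℕ λ N → ∀ n → N ℕ.≤ n → ∀ i →
      ∣ f n - a i * ℕ→ℚ (n ^ e) ∣ ≤ C * ℕ→ℚ (n ^ (e ∸ 1)) + ℕ→ℚ (n ^ e) * ((+ 1) / suc i)

{-# OPTIONS --safe #-}
-- A partition with distinct parts is an (n, dn ± 1)-core iff its first-column hook lengths form a
-- set of positive numbers without neighbours that is closed under subtracting n and lies below dn
-- (plus case) or dn - 1 (minus case). The numbers c_j of beads on the runners of the n-abacus turn such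
-- sets into words c_0 = 0, c_1, …, c_{n-1} ≤ d without two adjacent nonzero letters (c_{n-1} < d in
-- the minus case), and the size becomes S₁ + n S₂ - S₃ (S₃ - 1) / 2 with the linear statistics
-- S₁ = Σ j c_j, S₂ = Σ c_j (c_j - 1) / 2 and S₃ = Σ c_j.
--
-- Conditioning on the last letters gives recurrences for the mean and the variance of a linear
-- statistic. The coefficients, and with them the increments of the means, converge exponentially,
-- so the means of S₂ and S₃ are n times a sequence converging with error O(1/n), while 2 S₁ has the
-- mean of n S₃ up to O(n). The variances are O(n), O(n) and O(n³). Hence X / n² is a polynomial in
-- bounded quantities each of which has bias and variance O(1/n) around such a sequence; this
-- property passes to sums and products, in particular to (X / n²)^k. The constants of the theorem
-- are limits of these sequences and are never computed.
module Submission where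

open import Defs

-- The error term asks for a relative error `O(1/n)`, and this dictates what is tracked. A variance
-- of order `1/n` alone bounds the bias only by `O(n^(-1/2))`, so the bias is carried as a separate
-- quantity. The pair is stable under products: in the mean of a product the mixed term is at most
-- the sum of the two variances, again of order `1/n`. Hence no moment beyond the second is
-- estimated, although `k` is arbitrary. The limits behind the estimates may be irrational: the
-- ratio of consecutive numbers of tilings tends to the positive root of `d x² + x = 1`. All work
-- therefore stays in ℚ: convergence is a Cauchy rate, exponential decay is replaced by summability
-- of increments with and without a factor `n`, and the rate `d / (1 + d)` appears only in
-- inequalities multiplied by `1 + d`. Both families share one proof: the bound `b` on the top
-- letter is `d` or `d - 1`, and the restricted words are centred at the mean of the unrestricted
-- ones, which fixing the top tile shifts by little.

module Cores where

  open import Data.Nat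
  open import Data.Nat.Properties
  open import Data.Nat.DivMod
  open import Data.Nat.Divisibility using (_∣_; divides; divides-refl; ∣-refl)
  open import Data.Nat.ListAction using (sum)
  open import Data.Nat.Solver using (module +-*-Solver)
  open import Data.Bool using (if_then_else_)
  open import Data.List hiding (partition; tail; sum)
  open import Data.List.Properties using (filter-accept; filter-reject; ∷-injectiveˡ; ∷-injectiveʳ)
  open import Data.List.Relation.Unary.All as All using (All; []; _∷_)
  import Data.List.Relation.Unary.All.Properties as AllP
  open import Data.List.Relation.Unary.AllPairs as AllPairs using (AllPairs; []; _∷_)
  import Data.List.Relation.Unary.AllPairs.Properties as AllPairsP
  open import Data.List.Relation.Unary.Any using (here; there)
  open import Data.List.Relation.Unary.Linked using (Linked; []; [-]; _∷_)
  open import Data.List.Relation.Unary.Linked.Properties using (Linked⇒AllPairs)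
  open import Data.List.Relation.Unary.Unique.Propositional using (Unique)
  import Data.List.Relation.Unary.Unique.Propositional.Properties as UniqueP
  open import Data.List.Membership.Propositional using (_∈_; _∉_)
  open import Data.List.Membership.Propositional.Properties
    using (∈-filter⁺; ∈-filter⁻; ∈-downFrom⁺; ∈-map⁺; ∈-map⁻; ∈-++⁺ˡ; ∈-++⁺ʳ; ∈-++⁻)
  open import Data.List.Membership.DecPropositional _≟_ using (_∈?_)
  open import Data.Product using (Σ; ∃; _×_; _,_; proj₁; proj₂)
  open import Data.Sum using (_⊎_; inj₁; inj₂; [_,_]′)
  open import Data.Empty using (⊥; ⊥-elim)
  open import Data.Unit using (⊤; tt)
  open import Function using (_∘_)
  open import Relation.Nullary using (Dec; yes; no; does; ¬_)
  open import Relation.Nullary.Decidable using (dec-true; dec-false)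
  open import Relation.Unary using (Decidable)
  open import Relation.Binary.Definitions using (tri<; tri≈; tri>)
  open import Relation.Binary.PropositionalEquality
  open +-*-Solver using (solve; con; _:+_; _:*_; _:=_)

  -- Hook lengths and first-column hook lengths

  rowHooks : List ℕ → ℕ → ℕ → List ℕ
  rowHooks λs i r = applyUpTo (λ j₀ → (r ∸ suc j₀) + (conj λs (suc j₀) ∸ suc i) + 1) r

  -- A copy of the local function inside `hooks`, which cannot be named from outside.
  hooksOfRows : List ℕ → ℕ → List ℕ → List ℕ
  hooksOfRows λs i [] = []
  hooksOfRows λs i (r ∷ rs) = rowHooks λs i r ++ hooksOfRows λs (suc i) rs

  -- The local function inside `hooks` enters only as an `f` satisfying its two defining equations,
  -- both of which hold for it by `refl`.
  hooksOfRows-unique : (f : List ℕ → ℕ → List ℕ → List ℕ) →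
    (∀ λs i → f λs i [] ≡ []) →
    (∀ λs i r rs → f λs i (r ∷ rs) ≡ rowHooks λs i r ++ f λs (suc i) rs) →
    ∀ λs i rs → f λs i rs ≡ hooksOfRows λs i rs
  hooksOfRows-unique f e s λs i [] = e λs i
  hooksOfRows-unique f e s λs i (r ∷ rs) =
    trans (s λs i r rs) (cong (rowHooks λs i r ++_) (hooksOfRows-unique f e s λs (suc i) rs))

  -- The underscore is solved, by unification, with the local function of `hooks`:
  -- abstracting the first list and the row index leaves it applied to distinct variables.
  mutual
    localHooks : List ℕ → ℕ → List ℕ → List ℕ
    localHooks = _

    hooks≡hooksOfRows : ∀ λs → hooks λs ≡ hooksOfRows λs 0 λs
    hooks≡hooksOfRows [] = refl
    hooks≡hooksOfRows (r ∷ rs) with r ∷ rs | 1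
    ... | λs | i =
      cong (_ ++_) (hooksOfRows-unique localHooks (λ _ _ → refl) (λ _ _ _ _ → refl) λs i rs)

  -- The first-column hook lengths.
  β : List ℕ → List ℕ
  β [] = []
  β (r ∷ rs) = (r + length rs) ∷ β rs

  -- This is `j` plus the number of parts at most `j`. Number the steps of the boundary path of the
  -- diagram from the bottom left, starting at 0: the horizontal step of column `j` gets this label,
  -- and the vertical steps get the labels in `β`.
  gap : List ℕ → ℕ → ℕ
  gap [] j = j
  gap (x ∷ xs) j with x ≤? j
  ... | yes _ = suc (gap xs j)
  ... | no  _ = gap xs j

  gap-≤ : ∀ xs j → gap xs j ≤ j + length xs
  gap-≤ [] j = ≤-reflexive (sym (+-identityʳ j))
  gap-≤ (x ∷ xs) j rewrite +-suc j (length xs) with x ≤? j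
  ... | yes _ = s≤s (gap-≤ xs j)
  ... | no  _ = m≤n⇒m≤1+n (gap-≤ xs j)

  gap-top : ∀ xs j → All (_≤ j) xs → gap xs j ≡ j + length xs
  gap-top [] j [] = sym (+-identityʳ j)
  gap-top (x ∷ xs) j (p ∷ ps) rewrite +-suc j (length xs) with x ≤? j
  ... | yes _ = cong suc (gap-top xs j ps)
  ... | no ¬p = ⊥-elim (¬p p)

  gap+conj : ∀ xs j → gap xs j + conj xs (suc j) ≡ j + length xs
  gap+conj [] j = refl
  gap+conj (x ∷ xs) j with x ≤? j
  ... | yes p rewrite filter-reject (λ r → suc j ≤? r) {x} {xs} (λ q → <-irrefl refl (≤-trans q p)) =
    trans (cong suc (gap+conj xs j)) (sym (+-suc j _))
  ... | no ¬p rewrite filter-accept (λ r → suc j ≤? r) {x} {xs} (≰⇒> ¬p) =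
    trans (+-suc _ _) (trans (cong suc (gap+conj xs j)) (sym (+-suc j _)))

  Decreasing : List ℕ → Set
  Decreasing = AllPairs _>_

  -- The gaps enumerate the complement of the first-column hook lengths.
  gap-complete : ∀ xs → Decreasing xs → ∀ y → y ∈ β xs ⊎ ∃ λ j → y ≡ gap xs j
  gap-complete [] _ y = inj₂ (y , refl)
  gap-complete (x ∷ xs) (x> ∷ dec) y with gap-complete xs dec y
  ... | inj₁ y∈ = inj₁ (there y∈)
  ... | inj₂ (j , eq) with <-cmp j x
  -- At `j = x` the old gap is `x + length xs`, exactly the element that `β` gains. Smaller gaps
  -- keep their index, larger ones move down by one.
  ...   | tri≈ _ refl _ = inj₁ (here (trans eq (gap-top xs j (All.map <⇒≤ x>))))
  ...   | tri< j<x _ _ = inj₂ (j , trans eq (sym lem))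
    where
    lem : gap (x ∷ xs) j ≡ gap xs j
    lem with x ≤? j
    ... | yes x≤j = ⊥-elim (<⇒≱ j<x x≤j)
    ... | no _ = refl
  gap-complete (x ∷ xs) (x> ∷ dec) y | inj₂ (suc j , eq) | tri> _ _ (s≤s x≤j) = inj₂ (j , trans eq (sym lem))
    where
    lem : gap (x ∷ xs) j ≡ gap xs (suc j)
    lem with x ≤? j
    ... | yes _ = trans (cong suc (gap-top xs j (All.map (λ p → ≤-trans (<⇒≤ p) x≤j) x>)))
                        (sym (gap-top xs (suc j) (All.map (λ p → ≤-trans (<⇒≤ p) (m≤n⇒m≤1+n x≤j)) x>)))
    ... | no x≰j = ⊥-elim (x≰j x≤j)

  gap-∉ : ∀ xs → Decreasing xs → ∀ j → gap xs j ∉ β xs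
  gap-∉ [] _ j ()
  gap-∉ (x ∷ xs) (x> ∷ dec) j with x ≤? j
  ... | no x≰j = λ
    { (here eq) → <-irrefl eq (≤-<-trans (gap-≤ xs j) (+-monoˡ-< (length xs) (≰⇒> x≰j)))
    ; (there p) → gap-∉ xs dec j p
    }
  ... | yes x≤j = λ
    { (here eq) → <-irrefl (sym (trans (cong suc (sym top)) eq)) (s≤s (+-monoˡ-≤ (length xs) x≤j))
    ; (there p) → gap-∉ xs dec (suc j)
        (subst (_∈ β xs) (trans (cong suc top) (sym (gap-top xs (suc j) (All.map m≤n⇒m≤1+n xs≤j)))) p)
    }
    where
    xs≤j = All.map (λ p → ≤-trans (<⇒≤ p) x≤j) x>
    top = gap-top xs j xs≤j

  gap-reflects-< : ∀ r rs → All (r >_) rs → ∀ j → gap rs j < r + length rs → j < r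
  gap-reflects-< r rs r> j lt with j <? r
  ... | yes p = p
  ... | no ¬p = ⊥-elim (<⇒≱ lt (≤-trans (+-monoˡ-≤ (length rs) (≮⇒≥ ¬p))
                  (≤-reflexive (sym (gap-top rs j (All.map (λ q → ≤-trans (<⇒≤ q) (≮⇒≥ ¬p)) r>))))))

  -- By `hook+gap` the number `v` is the hook length in column `j`. The equation avoids truncated
  -- subtraction and refers only to the rows from `r` downwards, which makes induction on the rows
  -- possible.
  RowsCore : ℕ → List ℕ → Set
  RowsCore t [] = ⊤
  RowsCore t (r ∷ rs) = (∀ j → j < r → ∀ v → v + gap rs j ≡ r + length rs → ¬ (t ∣ v)) × RowsCore t rs

  -- A hook joins the boundary step of its column to that of its row, so its length is the
  -- difference of their labels.
  hook+gap : ∀ λs i r rs j → j < r → conj λs (suc j) ≡ i + conj (r ∷ rs) (suc j) →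
    ((r ∸ suc j) + (conj λs (suc j) ∸ suc i) + 1) + gap rs j ≡ r + length rs
  hook+gap λs i r rs j j<r eq
    rewrite eq | filter-accept (λ x → suc j ≤? x) {r} {rs} j<r
          | +-suc i (conj rs (suc j)) | m+n∸m≡n i (conj rs (suc j)) = begin
    (r ∸ suc j) + c + 1 + g     ≡⟨ solve 3 (λ a c g → a :+ c :+ con 1 :+ g := a :+ (con 1 :+ (g :+ c))) refl (r ∸ suc j) c g ⟩
    (r ∸ suc j) + suc (g + c)   ≡⟨ cong (λ z → (r ∸ suc j) + suc z) (gap+conj rs j) ⟩
    (r ∸ suc j) + (suc j + length rs) ≡⟨ sym (+-assoc (r ∸ suc j) (suc j) _) ⟩
    (r ∸ suc j) + suc j + length rs ≡⟨ cong (_+ length rs) (m∸n+n≡m j<r) ⟩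
    r + length rs ∎
    where
    open ≡-Reasoning
    c = conj rs (suc j)
    g = gap rs j

  -- The hypothesis of `hook+gap`, carried along the suffixes: the `i` rows above the suffix reach
  -- every column of its first row.
  PrefixAbove : List ℕ → ℕ → List ℕ → Set
  PrefixAbove λs i [] = ⊤
  PrefixAbove λs i (r ∷ rs) = ∀ j → j < r → conj λs (suc j) ≡ i + conj (r ∷ rs) (suc j)

  prefixAbove-tail : ∀ λs i r rs → All (r >_) rs → PrefixAbove λs i (r ∷ rs) → PrefixAbove λs (suc i) rs
  prefixAbove-tail λs i r [] _ _ = tt
  prefixAbove-tail λs i r (r' ∷ rs) (r>r' ∷ _) pre j j<r' = begin
    conj λs (suc j) ≡⟨ pre j j<r ⟩
    i + conj (r ∷ r' ∷ rs) (suc j) ≡⟨ cong (λ l → i + length l) (filter-accept (λ x → suc j ≤? x) {r} {r' ∷ rs} j<r) ⟩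
    i + suc (conj (r' ∷ rs) (suc j)) ≡⟨ +-suc i _ ⟩
    suc i + conj (r' ∷ rs) (suc j) ∎
    where
    open ≡-Reasoning
    j<r = <-trans j<r' r>r'

  rowsCore⁺ : ∀ t λs i rs → Decreasing rs → PrefixAbove λs i rs →
    All (λ h → ¬ (t ∣ h)) (hooksOfRows λs i rs) → RowsCore t rs
  rowsCore⁺ t λs i [] _ _ _ = tt
  rowsCore⁺ t λs i (r ∷ rs) (r> ∷ dec) pre all =
    (λ j j<r v eq t∣v → AllP.applyUpTo⁻ _ r (AllP.++⁻ˡ (rowHooks λs i r) all) j<r
       (subst (t ∣_) (+-cancelʳ-≡ (gap rs j) v _ (trans eq (sym (hook+gap λs i r rs j j<r (pre j j<r))))) t∣v))
    , rowsCore⁺ t λs (suc i) rs dec (prefixAbove-tail λs i r rs r> pre) (AllP.++⁻ʳ (rowHooks λs i r) all)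

  rowsCore⁻ : ∀ t λs i rs → Decreasing rs → PrefixAbove λs i rs →
    RowsCore t rs → All (λ h → ¬ (t ∣ h)) (hooksOfRows λs i rs)
  rowsCore⁻ t λs i [] _ _ _ = []
  rowsCore⁻ t λs i (r ∷ rs) (r> ∷ dec) pre (row , rows) =
    AllP.++⁺ (AllP.applyUpTo⁺₁ _ r (λ {j} j<r → row j j<r _ (hook+gap λs i r rs j j<r (pre j j<r))))
             (rowsCore⁻ t λs (suc i) rs dec (prefixAbove-tail λs i r rs r> pre) rows)

  -- The case `h = 0` matters: `t ∈ H` would force `0 ∈ H`, which is impossible for first-column
  -- hook lengths.
  Closed : ℕ → List ℕ → Set
  Closed t H = ∀ h → h + t ∈ H → h ∈ H

  closed-* : ∀ {t H} → Closed t H → ∀ q h → h + q * t ∈ H → h ∈ H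
  closed-* {H = H} cl zero h p = subst (_∈ H) (+-identityʳ h) p
  closed-* {t} {H} cl (suc q) h p = closed-* cl q h (cl _ (subst (_∈ H)
    (trans (cong (h +_) (+-comm t (q * t))) (sym (+-assoc h (q * t) t))) p))

  β-bound : ∀ r rs → Decreasing (r ∷ rs) → All (_< r + length rs) (β rs)
  β-bound r [] _ = []
  β-bound r (x ∷ xs) ((r>x ∷ _) ∷ dec) =
    lt ∷ All.map (λ p → <-trans p lt) (β-bound x xs dec)
    where lt = +-mono-< r>x (n<1+n (length xs))

  -- If `h` were not in `β`, it would be a gap, and the hook joining it to the row labelled `h + t`
  -- would have length exactly `t`.
  rowsCore⇒closed : ∀ t rs → 1 ≤ t → Decreasing rs → RowsCore t rs → Closed t (β rs)
  rowsCore⇒closed t (r ∷ rs) 1≤t (r> ∷ dec) (row , rows) h (there p) = there (rowsCore⇒closed t rs 1≤t dec rows h p)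
  rowsCore⇒closed t (r ∷ rs) 1≤t (r> ∷ dec) (row , rows) h (here eq) with gap-complete rs dec h
  ... | inj₁ p = there p
  ... | inj₂ (j , refl) = ⊥-elim (row j (gap-reflects-< r rs r> j lt) t (trans (+-comm t _) eq) ∣-refl)
    where lt = subst (gap rs j <_) eq (m<m+n (gap rs j) 1≤t)

  -- A hook of length `q * t` joins an element of `β` to a gap `q * t` below it; closure applied `q`
  -- times would put that gap into `β`.
  closed⇒rowsCore : ∀ t rs → Decreasing rs → Closed t (β rs) → RowsCore t rs
  closed⇒rowsCore t [] _ _ = tt
  closed⇒rowsCore t (r ∷ rs) (r> ∷ dec) cl = row , closed⇒rowsCore t rs dec closed-tail
    where
    row : ∀ j → j < r → ∀ v → v + gap rs j ≡ r + length rs → ¬ (t ∣ v)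
    row j j<r v eq (divides q refl)
      with closed-* cl q (gap rs j) (subst (_∈ β (r ∷ rs)) (trans (sym eq) (+-comm v _)) (here refl))
    ... | here eq' = <-irrefl eq' (≤-<-trans (gap-≤ rs j) (+-monoˡ-< (length rs) j<r))
    ... | there p = gap-∉ rs dec j p
    closed-tail : Closed t (β rs)
    closed-tail h p with cl h (there p)
    ... | there q = q
    ... | here refl = ⊥-elim (<⇒≱ (All.lookup (β-bound r rs (r> ∷ dec)) p) (m≤m+n _ t))

  initialPrefix : ∀ λs → PrefixAbove λs 0 λs
  initialPrefix [] = tt
  initialPrefix (r ∷ rs) = λ _ _ → refl

  core⇒closed : ∀ t λs → 1 ≤ t → Decreasing λs → IsCore t λs → Closed t (β λs)
  core⇒closed t λs 1≤t dec core = rowsCore⇒closed t λs 1≤t dec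
    (rowsCore⁺ t λs 0 λs dec (initialPrefix λs) (subst (All _) (hooks≡hooksOfRows λs) core))

  closed⇒core : ∀ t λs → Decreasing λs → Closed t (β λs) → IsCore t λs
  closed⇒core t λs dec cl = subst (All _) (sym (hooks≡hooksOfRows λs))
    (rowsCore⁻ t λs 0 λs dec (initialPrefix λs) (closed⇒rowsCore t λs dec cl))

  -- Cores on the abacus

  Sparse : List ℕ → Set
  Sparse = AllPairs (λ a b → suc b < a)

  β-head : ∀ r rs → Decreasing (r ∷ rs) → All (λ b → suc b < r + length rs) (β rs)
  β-head r [] _ = []
  β-head r (x ∷ xs) ((r>x ∷ _) ∷ dec) =
    lt ∷ All.map (λ p → <-trans (<-trans p (n<1+n _)) lt) (β-head x xs dec)
    where
    lt : suc (x + length xs) < r + suc (length xs)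
    lt rewrite +-suc r (length xs) = s≤s (+-monoˡ-< (length xs) r>x)

  β-sparse : ∀ rs → Decreasing rs → Sparse (β rs)
  β-sparse [] _ = []
  β-sparse (r ∷ rs) dec@(_ ∷ dec') = β-head r rs dec ∷ β-sparse rs dec'

  β-positive : ∀ rs → All (0 <_) rs → All (0 <_) (β rs)
  β-positive [] _ = []
  β-positive (r ∷ rs) (p ∷ ps) = ≤-trans p (m≤m+n r _) ∷ β-positive rs ps

  β-length : ∀ rs → length (β rs) ≡ length rs
  β-length [] = refl
  β-length (_ ∷ rs) = cong suc (β-length rs)

  -- Inverse of `β` on sparse lists of positive numbers, where `sparse-length` shows that the
  -- subtraction does not truncate.
  unβ : List ℕ → List ℕ
  unβ [] = []
  unβ (h ∷ hs) = (h ∸ length hs) ∷ unβ hs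

  unβ-length : ∀ hs → length (unβ hs) ≡ length hs
  unβ-length [] = refl
  unβ-length (_ ∷ hs) = cong suc (unβ-length hs)

  unβ-β : ∀ rs → unβ (β rs) ≡ rs
  unβ-β [] = refl
  unβ-β (r ∷ rs) rewrite β-length rs = cong₂ _∷_ (m+n∸n≡m r (length rs)) (unβ-β rs)

  sparse-length : ∀ h hs → Sparse (h ∷ hs) → All (0 <_) (h ∷ hs) → length hs < h
  sparse-length h [] _ (p ∷ _) = p
  sparse-length h (h' ∷ hs) ((gt ∷ _) ∷ sp) (_ ∷ pos) = <-trans (s≤s (sparse-length h' hs sp pos)) gt

  β-unβ : ∀ hs → Sparse hs → All (0 <_) hs → β (unβ hs) ≡ hs
  β-unβ [] _ _ = refl
  β-unβ (h ∷ hs) sp@(_ ∷ sp') pos@(_ ∷ pos') rewrite unβ-length hs =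
    cong₂ _∷_ (m∸n+n≡m (<⇒≤ (sparse-length h hs sp pos))) (β-unβ hs sp' pos')

  unβ-linked : ∀ hs → Sparse hs → All (0 <_) hs → Linked _>_ (unβ hs)
  unβ-linked [] _ _ = []
  unβ-linked (h ∷ []) _ _ = [-]
  unβ-linked (h ∷ h' ∷ hs) ((gt ∷ _) ∷ sp) (_ ∷ pos) =
    ∸-monoˡ-< gt (s≤s (<⇒≤ (sparse-length h' hs sp pos))) ∷ unβ-linked (h' ∷ hs) sp pos

  unβ-positive : ∀ hs → Sparse hs → All (0 <_) hs → All (0 <_) (unβ hs)
  unβ-positive [] _ _ = []
  unβ-positive (h ∷ hs) sp@(_ ∷ sp') pos@(_ ∷ pos') =
    m<n⇒0<n∸m (sparse-length h hs sp pos) ∷ unβ-positive hs sp' pos'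

  -- Allows bead sets to be handled by membership alone while partitions remain lists.
  decreasing-ext : ∀ {xs ys} → Decreasing xs → Decreasing ys →
    (∀ {z} → z ∈ xs → z ∈ ys) → (∀ {z} → z ∈ ys → z ∈ xs) → xs ≡ ys
  decreasing-ext {[]} {[]} _ _ _ _ = refl
  decreasing-ext {[]} {y ∷ ys} _ _ _ g with () ← g (here refl)
  decreasing-ext {x ∷ xs} {[]} _ _ f _ with () ← f (here refl)
  decreasing-ext {x ∷ xs} {y ∷ ys} (x> ∷ dx) (y> ∷ dy) f g
    with ≤-antisym (head≤ y> (f (here refl))) (head≤ x> (g (here refl)))
    where
    head≤ : ∀ {a b as} → All (a >_) as → b ∈ a ∷ as → b ≤ a
    head≤ _ (here refl) = ≤-refl
    head≤ a> (there p) = <⇒≤ (All.lookup a> p)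
  ... | refl = cong (x ∷_) (decreasing-ext dx dy
      (λ p → strip (All.lookup x> p) (f (there p))) (λ p → strip (All.lookup y> p) (g (there p))))
    where
    strip : ∀ {z zs} → z < x → z ∈ x ∷ zs → z ∈ zs
    strip z<x (here refl) = ⊥-elim (<-irrefl refl z<x)
    strip z<x (there p) = p

  sparse⇒decreasing : ∀ {hs} → Sparse hs → Decreasing hs
  sparse⇒decreasing = AllPairs.map (<-trans (n<1+n _))

  sparse-∌ : ∀ {hs h} → Sparse hs → h ∈ hs → suc h ∉ hs
  sparse-∌ (p ∷ sp) (here refl) (here ())
  sparse-∌ (p ∷ sp) (here refl) (there q) = <-asym (All.lookup p q) (<-trans (n<1+n _) (n<1+n _))
  sparse-∌ (p ∷ sp) (there q) (here refl) = <-irrefl refl (All.lookup p q)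
  sparse-∌ (p ∷ sp) (there q) (there q') = sparse-∌ sp q q'

  decreasing⇒sparse : ∀ {hs} → Decreasing hs → (∀ {h} → h ∈ hs → suc h ∉ hs) → Sparse hs
  decreasing⇒sparse [] _ = []
  decreasing⇒sparse {h ∷ hs} (h> ∷ dec) isol =
    All.tabulate (λ {b} b∈ → ≤∧≢⇒< (All.lookup h> b∈) (λ eq → isol (there b∈) (here eq)))
    ∷ decreasing⇒sparse dec (λ p q → isol (there p) (there q))

  [j+in]%n≡j : ∀ {j n} i .{{_ : NonZero n}} → j < n → (j + i * n) % n ≡ j
  [j+in]%n≡j {j} {n} i j<n = trans ([m+kn]%n≡m%n j i n) (m<n⇒m%n≡m j<n)

  [j+in]/n≡i : ∀ {j n} i .{{_ : NonZero n}} → j < n → (j + i * n) / n ≡ i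
  [j+in]/n≡i {j} {n} i j<n = trans (+-distrib-/-∣ʳ j (divides-refl i))
    (cong₂ _+_ (m<n⇒m/n≡0 j<n) (m*n/n≡m i n))

  -- An n-core is recorded by the number f j of beads on each runner j of the n-abacus.
  beads : (n : ℕ) .{{_ : NonZero n}} → ℕ → (ℕ → ℕ) → List ℕ
  beads n d f = filter (λ h → h / n <? f (h % n)) (downFrom (d * n))

  -- Beads fill each runner from the bottom, so two adjacent runners contain neighbouring numbers as
  -- soon as both are nonempty. The empty runner 0 excludes the number 0 and also the neighbours
  -- `n - 1 + i * n` and `(i + 1) * n`.
  record Runners (d : ℕ) (f : ℕ → ℕ) : Set where
    field
      zeroth   : f 0 ≡ 0
      isolated : ∀ j → f j ≡ 0 ⊎ f (suc j) ≡ 0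
      bounded  : ∀ j → f j ≤ d

  module _ (n : ℕ) .{{_ : NonZero n}} (d : ℕ) where

    ∈-beads⁻ : ∀ f {h} → h ∈ beads n d f → h / n < f (h % n)
    ∈-beads⁻ f p = proj₂ (∈-filter⁻ (λ h → h / n <? f (h % n)) {xs = downFrom (d * n)} p)

    ∈-beads⁺ : ∀ {f h} → (∀ j → f j ≤ d) → h / n < f (h % n) → h ∈ beads n d f
    ∈-beads⁺ {f} {h} f≤d p = ∈-filter⁺ (λ h → h / n <? f (h % n)) (∈-downFrom⁺ h<dn) p
      where
      h<dn : h < d * n
      h<dn = begin-strict
        h ≡⟨ m≡m%n+[m/n]*n h n ⟩
        h % n + h / n * n <⟨ +-monoˡ-< (h / n * n) (m%n<n h n) ⟩
        n + h / n * n ≡⟨⟩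
        suc (h / n) * n ≤⟨ *-monoˡ-≤ n (≤-trans p (f≤d _)) ⟩
        d * n ∎
        where open ≤-Reasoning

    j+in∈beads⁺ : ∀ {f} i j → (∀ j → f j ≤ d) → j < n → i < f j → j + i * n ∈ beads n d f
    j+in∈beads⁺ {f} i j f≤d j<n p = ∈-beads⁺ f≤d
      (subst₂ (λ a b → a < f b) (sym ([j+in]/n≡i i j<n)) (sym ([j+in]%n≡j i j<n)) p)

    j+in∈beads⁻ : ∀ f i j → j < n → j + i * n ∈ beads n d f → i < f j
    j+in∈beads⁻ f i j j<n p =
      subst₂ (λ a b → a < f b) ([j+in]/n≡i i j<n) ([j+in]%n≡j i j<n) (∈-beads⁻ f p)

    beads-decreasing : ∀ f → Decreasing (beads n d f)
    beads-decreasing f = AllPairsP.filter⁺ (λ h → h / n <? f (h % n))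
      (AllPairsP.applyDownFrom⁺₁ (λ h → h) (d * n) (λ j<i _ → j<i))

    beads-isolated : ∀ {f} → Runners d f → ∀ {h} → h ∈ beads n d f → suc h ∉ beads n d f
    beads-isolated {f} R {h} p q = clash (m≤n⇒m<n∨m≡n (m%n<n h n))
      where
      open Runners R
      h≡ = m≡m%n+[m/n]*n h n
      empty : ∀ {i j} → f j ≡ 0 → ¬ (i < f j)
      empty eq lt with () ← subst (_ <_) eq lt
      clash : suc (h % n) < n ⊎ suc (h % n) ≡ n → ⊥
      clash (inj₁ lt) with isolated (h % n)
      ... | inj₁ z = empty z (∈-beads⁻ f p)
      ... | inj₂ z = empty z (j+in∈beads⁻ f (h / n) (suc (h % n)) lt (subst (_∈ beads n d f) (cong suc h≡) q))
      clash (inj₂ eq) = empty zeroth (j+in∈beads⁻ f (suc (h / n)) 0 (>-nonZero⁻¹ n)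
        (subst (_∈ beads n d f) (trans (cong suc h≡) (cong (_+ h / n * n) eq)) q))

    beads-sparse : ∀ {f} → Runners d f → Sparse (beads n d f)
    beads-sparse {f} R = decreasing⇒sparse (beads-decreasing f) (beads-isolated R)

    beads-positive : ∀ {f} → Runners d f → All (0 <_) (beads n d f)
    beads-positive {f} R = All.tabulate positive
      where
      positive : ∀ {h} → h ∈ beads n d f → 0 < h
      positive {suc h} _ = z<s
      positive {zero} p with () ← subst (_ <_) (Runners.zeroth R) (j+in∈beads⁻ f 0 0 (>-nonZero⁻¹ n) p)

    beads-closed : ∀ {f} → Runners d f → Closed n (beads n d f)
    beads-closed {f} R h p = ∈-beads⁺ (Runners.bounded R) (<-trans (n<1+n _)
      (subst₂ (λ a b → a < f b) (trans (+-distrib-/-∣ʳ h (divides-refl 1)) div) (trans (cong (_% n) (cong (h +_) (*-identityˡ n))) ([m+n]%n≡m%n h n)) 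
        (∈-beads⁻ f (subst (_∈ beads n d f) (cong (h +_) (sym (*-identityˡ n))) p))))
      where
      div : h / n + 1 * n / n ≡ suc (h / n)
      div = trans (cong (h / n +_) (m*n/n≡m 1 n)) (+-comm _ 1)

    beads-< : ∀ {f h} → h ∈ beads n d f → h < d * n
    beads-< {f} p = All.lookup (AllP.filter⁺ (λ h → h / n <? f (h % n)) (AllP.applyDownFrom⁺₁ (λ h → h) (d * n) (λ i<n → i<n))) p

    beads-cong : ∀ {f g} → (∀ j → f j ≤ d) → (∀ j → g j ≤ d) → (∀ {j} → j < n → f j ≡ g j) → beads n d f ≡ beads n d g
    beads-cong {f} {g} f≤d g≤d eq = decreasing-ext (beads-decreasing f) (beads-decreasing g)
      (λ {h} p → ∈-beads⁺ g≤d (subst (h / n <_) (eq (m%n<n h n)) (∈-beads⁻ f p)))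
      (λ {h} p → ∈-beads⁺ f≤d (subst (h / n <_) (sym (eq (m%n<n h n))) (∈-beads⁻ g p)))

    beads-injective : ∀ {f g} → (∀ j → f j ≤ d) → (∀ j → g j ≤ d) → beads n d f ≡ beads n d g →
      ∀ {j} → j < n → f j ≡ g j
    beads-injective {f} {g} f≤d g≤d eq {j} j<n = ≤-antisym (incl f≤d eq) (incl g≤d (sym eq))
      where
      incl : ∀ {f g} → (∀ j → f j ≤ d) → beads n d f ≡ beads n d g → f j ≤ g j
      incl {f} {g} f≤d eq = ≮⇒≥ (λ g<f → <-irrefl refl
        (j+in∈beads⁻ g (g j) j j<n (subst (_ ∈_) eq (j+in∈beads⁺ (g j) j f≤d j<n g<f))))

  vacuously-closed : ∀ {t H} → (∀ {h} → h ∈ H → h < t) → Closed t H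
  vacuously-closed lt h p = ⊥-elim (<⇒≱ (lt p) (m≤n+m _ h))

  -- A set closed under -n and under -(dn ± 1) would contain two neighbours below any element ≥ dn.
  module _ {n d t : ℕ} {H : List ℕ} (sp : Sparse H) (0∉ : 0 ∉ H) (cl : Closed n H) (clt : Closed t H) where

    closed-<⁺ : t ≡ d * n + 1 → ∀ {h} → h ∈ H → h < d * n
    closed-<⁺ refl {h} p with h <? d * n
    ... | yes lt = lt
    ... | no ¬lt with m≤n⇒∃[o]m+o≡n (≮⇒≥ ¬lt)
    ...   | zero , refl = ⊥-elim (0∉ (closed-* cl d 0 (subst (_∈ H) (+-identityʳ _) p)))
    ...   | suc o , refl = ⊥-elim (sparse-∌ sp
              (clt o (subst (_∈ H) (solve 2 (λ a o → a :+ (con 1 :+ o) := o :+ (a :+ con 1)) refl (d * n) o) p))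
              (closed-* cl d (suc o) (subst (_∈ H) (+-comm (d * n) (suc o)) p)))
      where open +-*-Solver

    closed-<⁻ : suc t ≡ d * n → ∀ {h} → h ∈ H → h < t
    closed-<⁻ eq {h} p with h <? t
    ... | yes lt = lt
    ... | no ¬lt with m≤n⇒∃[o]m+o≡n (≮⇒≥ ¬lt)
    ...   | zero , refl = ⊥-elim (0∉ (clt 0 (subst (_∈ H) (+-identityʳ _) p)))
    ...   | suc o , refl = ⊥-elim (sparse-∌ sp
              (closed-* cl d o (subst (_∈ H) (trans (+-suc t o) (trans (cong (_+ o) eq) (+-comm (d * n) o))) p))
              (clt (suc o) (subst (_∈ H) (+-comm t (suc o)) p)))

  prefix-length : (P : ℕ → Set) → Decidable P → (∀ {i j} → i ≤ j → P j → P i) → ∀ d →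
    Σ ℕ λ c → c ≤ d × (∀ {i} → i < c → P i) × (∀ {i} → i < d → P i → i < c)
  prefix-length P P? down zero = 0 , z≤n , (λ ()) , (λ ())
  prefix-length P P? down (suc d) with P? d
  ... | yes p = suc d , ≤-refl , (λ i<c → down (≤-pred i<c) p) , (λ i<d _ → i<d)
  ... | no ¬p with prefix-length P P? down d
  ...   | c , c≤d , lo , hi = c , m≤n⇒m≤1+n c≤d , lo ,
          λ {i} i<sd Pi → hi (≤∧≢⇒< (≤-pred i<sd) (λ { refl → ¬p Pi })) Pi

  module _ (n : ℕ) .{{_ : NonZero n}} (d : ℕ) (H : List ℕ) (sp : Sparse H) (0∉ : 0 ∉ H)
           (cl : Closed n H) (H< : ∀ {h} → h ∈ H → h < d * n) where

    private
      OnRunner : ℕ → ℕ → Set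
      OnRunner j i = j + i * n ∈ H

      down : ∀ j {i i'} → i ≤ i' → OnRunner j i' → OnRunner j i
      down j {i} i≤i' p with m≤n⇒∃[o]m+o≡n i≤i'
      ... | o , refl = closed-* cl o (j + i * n)
        (subst (_∈ H) (solve 4 (λ j i o n → j :+ (i :+ o) :* n := j :+ i :* n :+ o :* n) refl j i o n) p)
        where open +-*-Solver

      height : ∀ j → Σ ℕ λ c → c ≤ d × (∀ {i} → i < c → OnRunner j i) × (∀ {i} → i < d → OnRunner j i → i < c)
      height j = prefix-length (OnRunner j) (λ i → (j + i * n) ∈? H) (down j) d

    heights : ℕ → ℕ
    heights j = proj₁ (height j)

    heights⇒∈ : ∀ i j → i < heights j → j + i * n ∈ H
    heights⇒∈ i j = proj₁ (proj₂ (proj₂ (height j)))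

    ∈⇒heights : ∀ i j → j + i * n ∈ H → i < heights j
    ∈⇒heights i j p = proj₂ (proj₂ (proj₂ (height j)))
      (*-cancelʳ-< n i d (≤-<-trans (m≤n+m _ j) (H< p))) p

    heights-runners : Runners d heights
    heights-runners = record
      { zeroth = zeroth _ refl
      ; isolated = λ j → isolated j _ _ refl refl
      ; bounded = λ j → proj₁ (proj₂ (height j))
      }
      where
      zeroth : ∀ c → heights 0 ≡ c → heights 0 ≡ 0
      zeroth zero eq = eq
      zeroth (suc c) eq = ⊥-elim (0∉ (heights⇒∈ 0 0 (subst (0 <_) (sym eq) z<s)))
      isolated : ∀ j c c' → heights j ≡ c → heights (suc j) ≡ c' → heights j ≡ 0 ⊎ heights (suc j) ≡ 0
      isolated j zero _ eq _ = inj₁ eq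
      isolated j _ zero _ eq = inj₂ eq
      isolated j (suc c) (suc c') eq eq' = ⊥-elim (sparse-∌ sp
        (subst (_∈ H) (+-identityʳ j) (heights⇒∈ 0 j (subst (0 <_) (sym eq) z<s)))
        (subst (_∈ H) (+-identityʳ (suc j)) (heights⇒∈ 0 (suc j) (subst (0 <_) (sym eq') z<s))))

    beads-heights : beads n d heights ≡ H
    beads-heights = decreasing-ext (beads-decreasing n d heights) (sparse⇒decreasing sp)
      (λ {h} p → subst (_∈ H) (sym (m≡m%n+[m/n]*n h n)) (heights⇒∈ (h / n) (h % n) (∈-beads⁻ n d heights p)))
      (λ {h} p → ∈-beads⁺ n d (Runners.bounded heights-runners)
        (∈⇒heights (h / n) (h % n) (subst (_∈ H) (m≡m%n+[m/n]*n h n) p)))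

  -- Runner heights as tilings

  dimers : ℕ → List (List ℕ) → List (List ℕ)
  dimers zero L = []
  dimers (suc b) L = map (λ cs → suc b ∷ 0 ∷ cs) L ++ dimers b L

  -- Runner heights, listed from the last runner down to runner 0, are the tilings
  -- by the monomer "0" and the dimers "a 0" with 1 ≤ a ≤ d.
  tilings : ℕ → ℕ → List (List ℕ)
  tilings d zero = [] ∷ []
  tilings d (suc zero) = (0 ∷ []) ∷ []
  tilings d (suc (suc n)) = map (0 ∷_) (tilings d (suc n)) ++ dimers d (tilings d n)

  -- The tilings of length n + 2 whose first entry is at most b.
  topTilings : ℕ → ℕ → ℕ → List (List ℕ)
  topTilings d b n = map (0 ∷_) (tilings d (suc n)) ++ dimers b (tilings d n)

  ∈-dimers⁻ : ∀ b {L cs} → cs ∈ dimers b L → ∃ λ a → ∃ λ cs' → 1 ≤ a × a ≤ b × cs' ∈ L × cs ≡ a ∷ 0 ∷ cs'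
  ∈-dimers⁻ (suc b) {L} p with ∈-++⁻ (map (λ cs → suc b ∷ 0 ∷ cs) L) p
  ... | inj₁ q with ∈-map⁻ (λ cs → suc b ∷ 0 ∷ cs) q
  ...   | cs' , cs'∈ , eq = suc b , cs' , s≤s z≤n , ≤-refl , cs'∈ , eq
  ∈-dimers⁻ (suc b) {L} p | inj₂ q with ∈-dimers⁻ b q
  ...   | a , cs' , 1≤a , a≤b , cs'∈ , eq = a , cs' , 1≤a , m≤n⇒m≤1+n a≤b , cs'∈ , eq

  ∈-dimers⁺ : ∀ b {L cs a} → 1 ≤ a → a ≤ b → cs ∈ L → a ∷ 0 ∷ cs ∈ dimers b L
  ∈-dimers⁺ zero {a = suc _} _ () _
  ∈-dimers⁺ (suc b) {L} {a = a} 1≤a a≤b p with a ≟ suc b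
  ... | yes refl = ∈-++⁺ˡ (∈-map⁺ (λ cs → suc b ∷ 0 ∷ cs) p)
  ... | no a≢ = ∈-++⁺ʳ (map (λ cs → suc b ∷ 0 ∷ cs) L) (∈-dimers⁺ b 1≤a (≤-pred (≤∧≢⇒< a≤b a≢)) p)

  dimers-unique : ∀ b {L} → Unique L → Unique (dimers b L)
  dimers-unique zero u = []
  dimers-unique (suc b) u = UniqueP.++⁺ (UniqueP.map⁺ (∷-injectiveʳ ∘ ∷-injectiveʳ) u) (dimers-unique b u) disjoint
    where
    disjoint : ∀ {cs} → cs ∈ map (λ cs → suc b ∷ 0 ∷ cs) _ × cs ∈ dimers b _ → ⊥
    disjoint (p , q) with ∈-map⁻ (λ cs → suc b ∷ 0 ∷ cs) p | ∈-dimers⁻ b q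
    ... | _ , _ , eq | _ , _ , _ , a≤b , _ , eq' = <-irrefl (sym (∷-injectiveˡ (trans (sym eq) eq'))) (s≤s a≤b)

  prepend-unique : ∀ b {L L'} → Unique L → Unique L' → Unique (map (0 ∷_) L ++ dimers b L')
  prepend-unique b u u' = UniqueP.++⁺ (UniqueP.map⁺ ∷-injectiveʳ u) (dimers-unique b u') disjoint
    where
    disjoint : ∀ {cs} → cs ∈ map (0 ∷_) _ × cs ∈ dimers b _ → ⊥
    disjoint (p , q) with ∈-map⁻ (0 ∷_) p | ∈-dimers⁻ b q
    ... | _ , _ , eq | _ , _ , 1≤a , _ , _ , eq' = <-irrefl (∷-injectiveˡ (trans (sym eq) eq')) 1≤a

  tilings-unique : ∀ d n → Unique (tilings d n)
  tilings-unique d zero = [] ∷ []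
  tilings-unique d (suc zero) = [] ∷ []
  tilings-unique d (suc (suc n)) = prepend-unique d (tilings-unique d (suc n)) (tilings-unique d n)

  topTilings-unique : ∀ d b n → Unique (topTilings d b n)
  topTilings-unique d b n = prepend-unique b (tilings-unique d (suc n)) (tilings-unique d n)

  -- The entry followed by exactly j others, or 0.
  at : List ℕ → ℕ → ℕ
  at [] j = 0
  at (c ∷ cs) j with j ≟ length cs
  ... | yes _ = c
  ... | no _ = at cs j

  at-head : ∀ c cs → at (c ∷ cs) (length cs) ≡ c
  at-head c cs with length cs ≟ length cs
  ... | yes _ = refl
  ... | no ≢ = ⊥-elim (≢ refl)

  at-tail : ∀ c cs {j} → j ≢ length cs → at (c ∷ cs) j ≡ at cs j
  at-tail c cs {j} j≢ with j ≟ length cs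
  ... | yes eq = ⊥-elim (j≢ eq)
  ... | no _ = refl

  at-beyond : ∀ cs {j} → length cs ≤ j → at cs j ≡ 0
  at-beyond [] _ = refl
  at-beyond (c ∷ cs) lt = trans (at-tail c cs (>⇒≢ lt)) (at-beyond cs (<⇒≤ lt))

  at-0∷ : ∀ cs j → at (0 ∷ cs) j ≡ at cs j
  at-0∷ cs j with j ≟ length cs
  ... | yes refl = sym (at-beyond cs ≤-refl)
  ... | no _ = refl

  at-ext : ∀ cs cs' → length cs ≡ length cs' → (∀ j → j < length cs → at cs j ≡ at cs' j) → cs ≡ cs'
  at-ext [] [] _ _ = refl
  at-ext (c ∷ cs) (c' ∷ cs') leq eq = cong₂ _∷_
    (trans (sym (at-head c cs)) (trans (eq _ ≤-refl) (trans (cong (at (c' ∷ cs')) (suc-injective leq)) (at-head c' cs'))))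
    (at-ext cs cs' (suc-injective leq) (λ j j< → trans (sym (at-tail c cs (<⇒≢ j<)))
      (trans (eq j (m≤n⇒m≤1+n j<)) (at-tail c' cs' (<⇒≢ (subst (j <_) (suc-injective leq) j<))))))

  length-map-downFrom : ∀ (f : ℕ → ℕ) n → length (map f (downFrom n)) ≡ n
  length-map-downFrom f zero = refl
  length-map-downFrom f (suc n) = cong suc (length-map-downFrom f n)

  at-map-downFrom : ∀ f n {j} → j < n → at (map f (downFrom n)) j ≡ f j
  at-map-downFrom f (suc n) {j} j<sn with j ≟ length (map f (downFrom n))
  ... | yes refl = cong f (sym (length-map-downFrom f n))
  ... | no j≢ = at-map-downFrom f n (≤∧≢⇒< (≤-pred j<sn) (λ eq → j≢ (trans eq (sym (length-map-downFrom f n)))))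

  runners-mono : ∀ {d cs} → Runners d (at cs) → Runners d (at (0 ∷ cs))
  runners-mono {d} {cs} R = record
    { zeroth = trans (at-0∷ cs 0) zeroth
    ; isolated = λ j → [ inj₁ ∘ trans (at-0∷ cs j) , inj₂ ∘ trans (at-0∷ cs (suc j)) ]′ (isolated j)
    ; bounded = λ j → subst (_≤ d) (sym (at-0∷ cs j)) (bounded j)
    }
    where open Runners R

  runners-dimer : ∀ {d a cs} → a ≤ d → Runners d (at cs) → Runners d (at (a ∷ 0 ∷ cs))
  runners-dimer {d} {a} {cs} a≤d R = record
    { zeroth = trans (below (λ ())) zeroth
    ; isolated = isol
    ; bounded = bound
    }
    where
    open Runners R
    below : ∀ {j} → j ≢ suc (length cs) → at (a ∷ 0 ∷ cs) j ≡ at cs j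
    below {j} j≢ = trans (at-tail a (0 ∷ cs) j≢) (at-0∷ cs j)
    isol : ∀ j → at (a ∷ 0 ∷ cs) j ≡ 0 ⊎ at (a ∷ 0 ∷ cs) (suc j) ≡ 0
    isol j = cases (j ≟ suc (length cs)) (suc j ≟ suc (length cs))
      where
      cases : Dec (j ≡ suc (length cs)) → Dec (suc j ≡ suc (length cs)) →
        at (a ∷ 0 ∷ cs) j ≡ 0 ⊎ at (a ∷ 0 ∷ cs) (suc j) ≡ 0
      cases (yes refl) _ = inj₂ (trans (below (>⇒≢ ≤-refl)) (at-beyond cs (≤-trans (n≤1+n _) (n≤1+n _))))
      cases (no ≢) (yes refl) = inj₁ (trans (below ≢) (at-beyond cs ≤-refl))
      cases (no ≢) (no ≢') = [ inj₁ ∘ trans (below ≢) , inj₂ ∘ trans (below ≢') ]′ (isolated j)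
    bound : ∀ j → at (a ∷ 0 ∷ cs) j ≤ d
    bound j with j ≟ suc (length cs)
    ... | yes _ = a≤d
    ... | no _ = subst (_≤ d) (sym (at-0∷ cs j)) (bounded j)

  ∈-prepend⁻ : ∀ b {L L' cs} → cs ∈ map (0 ∷_) L ++ dimers b L' →
    (∃ λ cs' → cs' ∈ L × cs ≡ 0 ∷ cs') ⊎ (∃ λ a → ∃ λ cs' → 1 ≤ a × a ≤ b × cs' ∈ L' × cs ≡ a ∷ 0 ∷ cs')
  ∈-prepend⁻ b {L} p with ∈-++⁻ (map (0 ∷_) L) p
  ... | inj₁ q = inj₁ (∈-map⁻ (0 ∷_) q)
  ... | inj₂ q = inj₂ (∈-dimers⁻ b q)

  ∈-tilings⁻ : ∀ d n {cs} → cs ∈ tilings d n → length cs ≡ n × Runners d (at cs)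
  ∈-topTilings⁻ : ∀ d b n {cs} → b ≤ d → cs ∈ topTilings d b n →
    length cs ≡ suc (suc n) × Runners d (at cs) × at cs (suc n) ≤ b

  ∈-tilings⁻ d zero (here refl) = refl , record { zeroth = refl ; isolated = λ _ → inj₁ refl ; bounded = λ _ → z≤n }
  ∈-tilings⁻ d (suc zero) (here refl) = refl , runners-mono {d} {[]} (proj₂ (∈-tilings⁻ d zero (here refl)))
  ∈-tilings⁻ d (suc (suc n)) p = let l , R , _ = ∈-topTilings⁻ d d n ≤-refl p in l , R

  ∈-topTilings⁻ d b n b≤d p with ∈-prepend⁻ b p
  ... | inj₁ (cs , cs∈ , refl) = let l , R = ∈-tilings⁻ d (suc n) cs∈ in
    cong suc l , runners-mono R
    , subst (_≤ b) (sym (trans (at-0∷ cs (suc n)) (at-beyond cs (≤-reflexive l)))) z≤n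
  ... | inj₂ (a , cs , _ , a≤b , cs∈ , refl) = let l , R = ∈-tilings⁻ d n cs∈ in
    cong (suc ∘ suc) l , runners-dimer (≤-trans a≤b b≤d) R
    , subst (_≤ b) (sym (trans (cong (at (a ∷ 0 ∷ cs) ∘ suc) (sym l)) (at-head a (0 ∷ cs)))) a≤b

  -- A nonzero top letter forces the runner below it to be empty, and the two form a dimer; a zero
  -- top letter is a monomer.
  ∈-prepend⁺ : ∀ {d} b n {f} → Runners d f → f (suc n) ≤ b →
    map f (downFrom (suc n)) ∈ tilings d (suc n) → map f (downFrom n) ∈ tilings d n →
    map f (downFrom (suc (suc n))) ∈ topTilings d b n
  ∈-prepend⁺ {d} b n {f} R fb p q with f (suc n) in eq
  ... | zero = ∈-++⁺ˡ (∈-map⁺ (0 ∷_) p)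
  ... | suc c with Runners.isolated R n
  ...   | inj₂ z with () ← trans (sym z) eq
  ...   | inj₁ z rewrite z = ∈-++⁺ʳ (map (0 ∷_) (tilings d (suc n))) (∈-dimers⁺ b (s≤s z≤n) fb q)

  ∈-tilings⁺ : ∀ d n {f} → Runners d f → map f (downFrom n) ∈ tilings d n
  ∈-tilings⁺ d zero R = here refl
  ∈-tilings⁺ d (suc zero) R = here (cong (_∷ []) (Runners.zeroth R))
  ∈-tilings⁺ d (suc (suc n)) R =
    ∈-prepend⁺ d n R (Runners.bounded R (suc n)) (∈-tilings⁺ d (suc n) R) (∈-tilings⁺ d n R)

  ∈-topTilings⁺ : ∀ d b n {f} → Runners d f → f (suc n) ≤ b → map f (downFrom (suc (suc n))) ∈ topTilings d b n
  ∈-topTilings⁺ d b n R fb = ∈-prepend⁺ b n R fb (∈-tilings⁺ d (suc n) R) (∈-tilings⁺ d n R)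

  partition : ℕ → ℕ → List ℕ → List ℕ
  partition n d cs = unβ (beads (suc (suc n)) d (at cs))

  -- The two families of the theorem: t = dn + 1, and t = dn - 1 with one bead fewer on the last runner.
  data Family (d n : ℕ) : ℕ → ℕ → Set where
    plus  : Family d n d (d * suc (suc n) + 1)
    minus : ∀ {b t} → suc b ≡ d → suc t ≡ d * suc (suc n) → Family d n b t

  module _ {d n b t : ℕ} (1≤d : 1 ≤ d) (fam : Family d n b t) where

    private
      N = suc (suc n)

    b≤d : b ≤ d
    b≤d = le fam
      where
      le : ∀ {b t} → Family d n b t → b ≤ d
      le plus = ≤-refl
      le (minus refl _) = n≤1+n _

    1≤t : 1 ≤ t
    1≤t = positive fam
      where
      positive : ∀ {b t} → Family d n b t → 1 ≤ t
      positive plus = m≤n+m 1 _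
      positive (minus _ eq) = ≤-pred (≤-trans (s≤s (s≤s z≤n)) (≤-trans (*-mono-≤ 1≤d (≤-refl {N})) (≤-reflexive (sym eq))))

    -- With all beads below `t`, closure under subtracting `t` is vacuous. In the minus case the
    -- only candidate to exclude is `t = d * N - 1`, which is position `b` of the last runner and
    -- hence a bead only if that runner holds more than `b`.
    beads-<t : ∀ {f} → Runners d f → f (suc n) ≤ b → ∀ {h} → h ∈ beads N d f → h < t
    beads-<t {f} R fb {h} p = below fam fb
      where
      h<dN = beads-< N d {f} p
      below : ∀ {b t} → Family d n b t → f (suc n) ≤ b → h < t
      below plus _ = <-trans h<dN (m<m+n _ z<s)
      below {b} {t} (minus refl eq) fb = ≤∧≢⇒< (≤-pred (≤-trans h<dN (≤-reflexive (sym eq)))) h≢t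
        where
        h≢t : h ≢ t
        h≢t refl = <⇒≱ (j+in∈beads⁻ N d f b (suc n) ≤-refl (subst (_∈ beads N d f) (suc-injective eq) p)) fb

    partition-core : ∀ {cs} → cs ∈ topTilings d b n → DistinctCore N t (partition n d cs)
    partition-core {cs} p = (linked , unβ-positive H sp pos)
      , closed⇒core N _ dec (subst (Closed N) (sym ββ) (beads-closed N d R))
      , closed⇒core t _ dec (subst (Closed t) (sym ββ) (vacuously-closed (beads-<t R top)))
      where
      H = beads N d (at cs)
      R = proj₁ (proj₂ (∈-topTilings⁻ d b n b≤d p))
      top = proj₂ (proj₂ (∈-topTilings⁻ d b n b≤d p))
      sp = beads-sparse N d R
      pos = beads-positive N d R
      linked = unβ-linked H sp pos
      dec = Linked⇒AllPairs (λ p q → <-trans q p) linked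
      ββ = β-unβ H sp pos

    core-partition : ∀ {λs} → DistinctCore N t λs → λs ∈ map (partition n d) (topTilings d b n)
    core-partition {λs} ((linked , pos) , coreN , coreT) =
      subst (_∈ map (partition n d) (topTilings d b n)) same (∈-map⁺ (partition n d) (∈-topTilings⁺ d b n R (top fam)))
      where
      dec = Linked⇒AllPairs (λ p q → <-trans q p) linked
      H = β λs
      sp = β-sparse λs dec
      0∉ : 0 ∉ H
      0∉ p = <-irrefl refl (All.lookup (β-positive λs pos) p)
      cl = core⇒closed N λs (s≤s z≤n) dec coreN
      clt = core⇒closed t λs 1≤t dec coreT
      H< : ∀ {h} → h ∈ H → h < d * N
      H< = bound fam clt
        where
        bound : ∀ {b t} → Family d n b t → Closed t H → ∀ {h} → h ∈ H → h < d * N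
        bound plus clt = closed-<⁺ {d = d} sp 0∉ cl clt refl
        bound (minus _ eq) clt p = <-trans (closed-<⁻ {d = d} sp 0∉ cl clt eq p) (≤-reflexive eq)
      f = heights N d H sp 0∉ cl H<
      R = heights-runners N d H sp 0∉ cl H<
      top : Family d n b t → f (suc n) ≤ b
      top = go clt
        where
        go : ∀ {b t} → Closed t H → Family d n b t → f (suc n) ≤ b
        go _ plus = Runners.bounded R (suc n)
        go {b} clt (minus refl eq) with f (suc n) ≤? b
        ... | yes le = le
        ... | no ¬le = ⊥-elim (<-irrefl (sym (suc-injective eq))
                (closed-<⁻ {d = d} sp 0∉ cl clt eq (heights⇒∈ N d H sp 0∉ cl H< b (suc n) (≰⇒> ¬le))))
      -- Beyond runner `N - 1` the heights `f` need not vanish, since they recount beads of lower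
      -- runners; `f'` is `f` cut off there, which leaves the bead set unchanged.
      f' = at (map f (downFrom N))
      R' : Runners d f'
      R' = proj₁ (proj₂ (∈-topTilings⁻ d b n b≤d (∈-topTilings⁺ d b n R (top fam))))
      f'≡f : ∀ {j} → j < N → f' j ≡ f j
      f'≡f = at-map-downFrom f N
      same-beads : beads N d f' ≡ H
      same-beads = trans (beads-cong N d (Runners.bounded R') (Runners.bounded R) f'≡f) (beads-heights N d H sp 0∉ cl H<)
      same : partition n d (map f (downFrom N)) ≡ λs
      same = trans (cong unβ same-beads) (unβ-β λs)

    partition-injective : ∀ {cs cs'} → cs ∈ topTilings d b n → cs' ∈ topTilings d b n →
      partition n d cs ≡ partition n d cs' → cs ≡ cs'
    partition-injective {cs} {cs'} p p' eq =
      at-ext cs cs' (trans l (sym l')) (λ j j< → beads-injective N d (Runners.bounded R) (Runners.bounded R') beads≡ (subst (j <_) l j<))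
      where
      l = proj₁ (∈-topTilings⁻ d b n b≤d p)
      R = proj₁ (proj₂ (∈-topTilings⁻ d b n b≤d p))
      l' = proj₁ (∈-topTilings⁻ d b n b≤d p')
      R' = proj₁ (proj₂ (∈-topTilings⁻ d b n b≤d p'))
      beads≡ : beads N d (at cs) ≡ beads N d (at cs')
      beads≡ = trans (sym (β-unβ _ (beads-sparse N d R) (beads-positive N d R)))
        (trans (cong β eq) (β-unβ _ (beads-sparse N d R') (beads-positive N d R')))

  unique-map : ∀ {A B : Set} (f : A → B) {xs} →
    (∀ {x y} → x ∈ xs → y ∈ xs → f x ≡ f y → x ≡ y) → Unique xs → Unique (map f xs)
  unique-map f inj [] = []
  unique-map f inj (x∉ ∷ u) =
    AllP.map⁺ (All.tabulate (λ y∈ eq → All.lookup x∉ y∈ (inj (here refl) (there y∈) eq)))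
    ∷ unique-map f (λ p q → inj (there p) (there q)) u

  -- The size of a core

  -- The value is n (n - 1) / 2 = 0 + 1 + ... + (n - 1), one index behind the usual triangular
  -- numbers.
  triangular : ℕ → ℕ
  triangular zero = 0
  triangular (suc n) = n + triangular n

  sum-β : ∀ rs → sum (β rs) ≡ sum rs + triangular (length rs)
  sum-β [] = refl
  sum-β (r ∷ rs) rewrite sum-β rs =
    solve 4 (λ r l s t → r :+ l :+ (s :+ t) := r :+ s :+ (l :+ t)) refl r (length rs) (sum rs) (triangular (length rs))

  sumTo : ℕ → (ℕ → ℕ) → ℕ
  sumTo zero F = 0
  sumTo (suc n) F = F n + sumTo n F

  sumTo-cong : ∀ n {F G} → (∀ i → i < n → F i ≡ G i) → sumTo n F ≡ sumTo n G
  sumTo-cong zero eq = refl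
  sumTo-cong (suc n) eq = cong₂ _+_ (eq n ≤-refl) (sumTo-cong n (λ i i<n → eq i (m≤n⇒m≤1+n i<n)))

  sumTo-+ : ∀ n F G → sumTo n (λ i → F i + G i) ≡ sumTo n F + sumTo n G
  sumTo-+ zero F G = refl
  sumTo-+ (suc n) F G rewrite sumTo-+ n F G =
    solve 4 (λ a b c d → a :+ b :+ (c :+ d) := a :+ c :+ (b :+ d)) refl (F n) (G n) (sumTo n F) (sumTo n G)

  sumTo-0 : ∀ n → sumTo n (λ _ → 0) ≡ 0
  sumTo-0 zero = refl
  sumTo-0 (suc n) = sumTo-0 n

  sumTo-swap : ∀ m n (F : ℕ → ℕ → ℕ) → sumTo m (λ i → sumTo n (λ j → F i j)) ≡ sumTo n (λ j → sumTo m (λ i → F i j))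
  sumTo-swap zero n F = sym (sumTo-0 n)
  sumTo-swap (suc m) n F = trans (cong (sumTo n (F m) +_) (sumTo-swap m n F)) (sym (sumTo-+ n (F m) (λ j → sumTo m (λ i → F i j))))

  sumTo-split : ∀ m k F → sumTo (m + k) F ≡ sumTo m (λ i → F (i + k)) + sumTo k F
  sumTo-split zero k F = refl
  sumTo-split (suc m) k F = trans (cong (F (m + k) +_) (sumTo-split m k F)) (sym (+-assoc (F (m + k)) _ _))

  sumTo-* : ∀ d n F → sumTo (d * n) F ≡ sumTo d (λ i → sumTo n (λ j → F (j + i * n)))
  sumTo-* zero n F = refl
  sumTo-* (suc d) n F = trans (sumTo-split n (d * n) F) (cong (sumTo n (λ j → F (j + d * n)) +_) (sumTo-* d n F))

  below : ℕ → ℕ → ℕ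
  below i c = if does (i <? c) then 1 else 0

  <⇒below≡1 : ∀ {i c} → i < c → below i c ≡ 1
  <⇒below≡1 {i} {c} p rewrite dec-true (i <? c) p = refl

  ≮⇒below≡0 : ∀ {i c} → ¬ (i < c) → below i c ≡ 0
  ≮⇒below≡0 {i} {c} p rewrite dec-false (i <? c) p = refl

  sumTo-truncate : ∀ {c} d G → c ≤ d → sumTo d (λ i → below i c * G i) ≡ sumTo c G
  sumTo-truncate {c} zero G z≤n = refl
  sumTo-truncate {c} (suc d) G c≤ with c ≟ suc d
  ... | yes refl = sumTo-cong (suc d) (λ i i< → trans (cong (_* G i) (<⇒below≡1 i<)) (*-identityˡ _))
  ... | no c≢ = trans (cong (λ z → z * G d + sumTo d (λ i → below i c * G i)) (≮⇒below≡0 (≤⇒≯ c≤d))) (sumTo-truncate d G c≤d)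
    where c≤d = ≤-pred (≤∧≢⇒< c≤ c≢)

  sum-filter : ∀ (a b g : ℕ → ℕ) n →
    sum (map g (filter (λ h → a h <? b h) (downFrom n))) ≡ sumTo n (λ h → below (a h) (b h) * g h)
  sum-filter a b g zero = refl
  sum-filter a b g (suc n) = split (a n <? b n)
    where
    rest = sum-filter a b g n
    split : Dec (a n < b n) → sum (map g (filter (λ h → a h <? b h) (downFrom (suc n)))) ≡
                              below (a n) (b n) * g n + sumTo n (λ h → below (a h) (b h) * g h)
    split (yes p) rewrite filter-accept (λ h → a h <? b h) {n} {downFrom n} p | <⇒below≡1 p =
      cong₂ _+_ (sym (*-identityˡ (g n))) rest
    split (no p) rewrite filter-reject (λ h → a h <? b h) {n} {downFrom n} p | ≮⇒below≡0 p = rest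

  -- With the filter turned into an indicator, `h = j + i * n` splits the sum into rows of the
  -- abacus; after summing by runners instead, the indicator keeps the first `f j` rows.
  sum-beads : ∀ n .{{_ : NonZero n}} d f (g : ℕ → ℕ) → (∀ j → f j ≤ d) →
    sum (map g (beads n d f)) ≡ sumTo n (λ j → sumTo (f j) (λ i → g (j + i * n)))
  sum-beads n d f g f≤d = begin
    sum (map g (beads n d f)) ≡⟨ sum-filter (_/ n) (λ h → f (h % n)) g (d * n) ⟩
    sumTo (d * n) (λ h → below (h / n) (f (h % n)) * g h) ≡⟨ sumTo-* d n _ ⟩
    sumTo d (λ i → sumTo n (λ j → below ((j + i * n) / n) (f ((j + i * n) % n)) * g (j + i * n)))
      ≡⟨ sumTo-cong d (λ i _ → sumTo-cong n (λ j j<n →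
           cong₂ (λ a b → below a (f b) * g (j + i * n)) ([j+in]/n≡i i j<n) ([j+in]%n≡j i j<n))) ⟩
    sumTo d (λ i → sumTo n (λ j → below i (f j) * g (j + i * n))) ≡⟨ sumTo-swap d n (λ i j → below i (f j) * g (j + i * n)) ⟩
    sumTo n (λ j → sumTo d (λ i → below i (f j) * g (j + i * n)))
      ≡⟨ sumTo-cong n (λ j _ → sumTo-truncate d _ (f≤d j)) ⟩
    sumTo n (λ j → sumTo (f j) (λ i → g (j + i * n))) ∎
    where open ≡-Reasoning

  sumTo-progression : ∀ c j n → sumTo c (λ i → j + i * n) ≡ c * j + n * triangular c
  sumTo-progression zero j n = sym (*-zeroʳ n)
  sumTo-progression (suc c) j n rewrite sumTo-progression c j n =
    solve 4 (λ c j n t → j :+ c :* n :+ (c :* j :+ n :* t) := j :+ c :* j :+ n :* (c :+ t)) refl c j n (triangular c)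

  sumTo-1 : ∀ c → sumTo c (λ _ → 1) ≡ c
  sumTo-1 zero = refl
  sumTo-1 (suc c) = cong suc (sumTo-1 c)

  sum-map-id : ∀ xs → sum (map (λ h → h) xs) ≡ sum xs
  sum-map-id [] = refl
  sum-map-id (x ∷ xs) = cong (x +_) (sum-map-id xs)

  sum-map-1 : ∀ (xs : List ℕ) → sum (map (λ _ → 1) xs) ≡ length xs
  sum-map-1 [] = refl
  sum-map-1 (x ∷ xs) = cong suc (sum-map-1 xs)

  -- This is S₁, as the letter `c` belongs to runner `length cs`; `pairs` is S₂ and `sum` is S₃.
  moment₁ : List ℕ → ℕ
  moment₁ [] = 0
  moment₁ (c ∷ cs) = c * length cs + moment₁ cs

  pairs : List ℕ → ℕ
  pairs [] = 0
  pairs (c ∷ cs) = triangular c + pairs cs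

  sumTo-at : ∀ cs → sumTo (length cs) (at cs) ≡ sum cs
  sumTo-at [] = refl
  sumTo-at (c ∷ cs) = cong₂ _+_ (at-head c cs)
    (trans (sumTo-cong (length cs) (λ j j< → at-tail c cs (<⇒≢ j<))) (sumTo-at cs))

  sumTo-runners : ∀ n cs → sumTo (length cs) (λ j → at cs j * j + n * triangular (at cs j)) ≡ moment₁ cs + n * pairs cs
  sumTo-runners n [] = sym (*-zeroʳ n)
  sumTo-runners n (c ∷ cs) = trans (cong₂ _+_
      (cong (λ z → z * length cs + n * triangular z) (at-head c cs))
      (trans (sumTo-cong (length cs) (λ j j< → cong (λ z → z * j + n * triangular z) (at-tail c cs (<⇒≢ j<)))) (sumTo-runners n cs)))
    (solve 5 (λ a n t m p → a :+ n :* t :+ (m :+ n :* p) := a :+ m :+ n :* (t :+ p)) refl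
       (c * length cs) n (triangular c) (moment₁ cs) (pairs cs))

  -- Runner `j` carries an arithmetic progression of `c_j` beads with sum
  -- `c_j * j + N * triangular c_j`, and passing from the S₃ beads to parts subtracts 0, 1, ..., S₃
  -- - 1. Moving that term to the left keeps the identity in ℕ.
  size-partition : ∀ {d n cs} → length cs ≡ suc (suc n) → Runners d (at cs) →
    size (partition n d cs) + triangular (sum cs) ≡ moment₁ cs + suc (suc n) * pairs cs
  size-partition {d} {n} {cs} l R = begin
    size (unβ H) + triangular (sum cs) ≡⟨ cong (λ z → size (unβ H) + triangular z) (sym length-H) ⟩
    size (unβ H) + triangular (length H) ≡⟨ cong (λ z → size (unβ H) + triangular z) (sym (unβ-length H)) ⟩
    size (unβ H) + triangular (length (unβ H)) ≡⟨ sym (sum-β (unβ H)) ⟩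
    sum (β (unβ H)) ≡⟨ cong sum (β-unβ H (beads-sparse N d R) (beads-positive N d R)) ⟩
    sum H ≡⟨ sym (sum-map-id H) ⟩
    sum (map (λ h → h) H) ≡⟨ sum-beads N d (at cs) (λ h → h) (Runners.bounded R) ⟩
    sumTo N (λ j → sumTo (at cs j) (λ i → j + i * N)) ≡⟨ sumTo-cong N (λ j _ → sumTo-progression (at cs j) j N) ⟩
    sumTo N (λ j → at cs j * j + N * triangular (at cs j)) ≡⟨ cong (λ z → sumTo z (λ j → at cs j * j + N * triangular (at cs j))) (sym l) ⟩
    sumTo (length cs) (λ j → at cs j * j + N * triangular (at cs j)) ≡⟨ sumTo-runners N cs ⟩
    moment₁ cs + N * pairs cs ∎
    where
    open ≡-Reasoning
    N = suc (suc n)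
    H = beads N d (at cs)
    length-H : length H ≡ sum cs
    length-H = begin
      length H ≡⟨ sym (sum-map-1 H) ⟩
      sum (map (λ _ → 1) H) ≡⟨ sum-beads N d (at cs) (λ _ → 1) (Runners.bounded R) ⟩
      sumTo N (λ j → sumTo (at cs j) (λ _ → 1)) ≡⟨ sumTo-cong N (λ j _ → sumTo-1 (at cs j)) ⟩
      sumTo N (at cs) ≡⟨ cong (λ z → sumTo z (at cs)) (sym l) ⟩
      sumTo (length cs) (at cs) ≡⟨ sumTo-at cs ⟩
      sum cs ∎

module Asymptotics where

  open import Data.Nat as ℕ using (ℕ; zero; suc; z≤n; s≤s)
  import Data.Nat.Properties as ℕP
  import Data.Nat.Solver as ℕSolver
  open import Data.Nat.ListAction using (sum)
  open import Data.Nat.ListAction.Properties using (sum-↭)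
  import Data.Integer as ℤ
  import Data.Integer.Properties as ℤP
  open import Data.Rational
  open import Data.Rational.Properties
  open import Data.Rational.Solver using (module +-*-Solver)
  open import Data.Rational.Unnormalised as ℚᵘ using (mkℚᵘ; *≡*)
  import Data.Rational.Unnormalised.Properties as ℚᵘP
  open import Data.List using (List; []; _∷_; _++_; map; length)
  open import Data.List.Properties using (length-++; length-map)
  open import Data.List.Membership.Propositional using (_∈_)
  open import Data.List.Membership.Propositional.Properties using (∈-map⁻)
  open import Data.List.Membership.Propositional.Properties.WithK using (unique∧set⇒bag)
  open import Data.List.Relation.Binary.BagAndSetEquality using (∼bag⇒↭)
  open import Data.List.Relation.Binary.Permutation.Propositional using (_↭_)
  open import Data.List.Relation.Binary.Permutation.Propositional.Properties using (map⁺; ↭-length)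
  open import Data.List.Relation.Unary.Any using (here; there)
  open import Data.Product using (∃; _×_; _,_; proj₁; proj₂)
  open import Data.Sum using (inj₁; inj₂)
  open import Function using (_∘_)
  open import Function.Bundles using (mk⇔; Equivalence)
  open import Relation.Binary.PropositionalEquality
  open Cores
  open +-*-Solver using (solve; con; _:+_; _:*_; _:-_; :-_; _:=_)

  -- Rational arithmetic

  0≤1 : 0ℚ ≤ 1ℚ
  0≤1 = nonNegative⁻¹ 1ℚ

  0≤+ : ∀ {p q} → 0ℚ ≤ p → 0ℚ ≤ q → 0ℚ ≤ p + q
  0≤+ {p} {q} a b = +-mono-≤ {0ℚ} {p} {0ℚ} {q} a b

  *-monoˡ-≤₀ : ∀ {p q} r → 0ℚ ≤ r → p ≤ q → r * p ≤ r * q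
  *-monoˡ-≤₀ r 0≤r p≤q = *-monoˡ-≤-nonNeg r {{nonNegative 0≤r}} p≤q

  *-monoʳ-≤₀ : ∀ {p q} r → 0ℚ ≤ r → p ≤ q → p * r ≤ q * r
  *-monoʳ-≤₀ r 0≤r p≤q = *-monoʳ-≤-nonNeg r {{nonNegative 0≤r}} p≤q

  0≤* : ∀ {p q} → 0ℚ ≤ p → 0ℚ ≤ q → 0ℚ ≤ p * q
  0≤* {p} {q} a b = ≤-trans (≤-reflexive (sym (*-zeroʳ p))) (*-monoˡ-≤₀ p a b)

  *-mono-≤₀ : ∀ {p q r s} → 0ℚ ≤ q → 0ℚ ≤ r → p ≤ q → r ≤ s → p * r ≤ q * s
  *-mono-≤₀ {p} {q} {r} {s} 0≤q 0≤r p≤q r≤s = ≤-trans (*-monoʳ-≤₀ r 0≤r p≤q) (*-monoˡ-≤₀ q 0≤q r≤s)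

  -- Turns an inequality with known slack `e` into a ring identity for the solver.
  diff-≤ : ∀ {p q} e → 0ℚ ≤ e → q ≡ p + e → p ≤ q
  diff-≤ {p} {q} e 0≤e eq = subst (p ≤_) (sym eq)
    (subst (_≤ p + e) (+-identityʳ p) (+-monoʳ-≤ p 0≤e))

  ∣p∣²≡p² : ∀ p → ∣ p ∣ * ∣ p ∣ ≡ p * p
  ∣p∣²≡p² p with ∣p∣≡p∨∣p∣≡-p p
  ... | inj₁ eq rewrite eq = refl
  ... | inj₂ eq rewrite eq = solve 1 (λ p → (:- p) :* (:- p) := p :* p) refl p

  0≤p² : ∀ p → 0ℚ ≤ p * p
  0≤p² p = subst (0ℚ ≤_) (∣p∣²≡p² p) (0≤* (0≤∣p∣ p) (0≤∣p∣ p))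

  ∣p-q∣≡∣q-p∣ : ∀ p q → ∣ p - q ∣ ≡ ∣ q - p ∣
  ∣p-q∣≡∣q-p∣ p q = trans (sym (∣-p∣≡∣p∣ (p - q))) (cong ∣_∣ (solve 2 (λ p q → :- (p :- q) := q :- p) refl p q))

  ∣+∣≤ : ∀ {p q a b} → ∣ p ∣ ≤ a → ∣ q ∣ ≤ b → ∣ p + q ∣ ≤ a + b
  ∣+∣≤ {p} {q} p≤ q≤ = ≤-trans (∣p+q∣≤∣p∣+∣q∣ p q) (+-mono-≤ p≤ q≤)

  ∣-∣≤ : ∀ {p q a b} → ∣ p ∣ ≤ a → ∣ q ∣ ≤ b → ∣ p - q ∣ ≤ a + b
  ∣-∣≤ {p} {q} p≤ q≤ = ≤-trans (∣p-q∣≤∣p∣+∣q∣ p q) (+-mono-≤ p≤ q≤)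

  ∣*∣≤ : ∀ {p q a b} → ∣ p ∣ ≤ a → ∣ q ∣ ≤ b → ∣ p * q ∣ ≤ a * b
  ∣*∣≤ {p} {q} p≤ q≤ = ≤-trans (≤-reflexive (∣p*q∣≡∣p∣*∣q∣ p q))
    (*-mono-≤₀ (≤-trans (0≤∣p∣ p) p≤) (0≤∣p∣ q) p≤ q≤)

  toℚᵘ-/1 : ∀ n → toℚᵘ (ℕ→ℚ n) ℚᵘ.≃ mkℚᵘ (ℤ.+ n) 0
  toℚᵘ-/1 n = toℚᵘ-fromℚᵘ (mkℚᵘ (ℤ.+ n) 0)

  /-*-cancel : ∀ a i → ((ℤ.+ a) / suc i) * ℕ→ℚ (suc i) ≡ ℕ→ℚ a
  /-*-cancel a i = toℚᵘ-injective (begin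
    toℚᵘ (((ℤ.+ a) / suc i) * ℕ→ℚ (suc i)) ≈⟨ toℚᵘ-homo-* ((ℤ.+ a) / suc i) (ℕ→ℚ (suc i)) ⟩
    toℚᵘ ((ℤ.+ a) / suc i) ℚᵘ.* toℚᵘ (ℕ→ℚ (suc i)) ≈⟨ ℚᵘP.*-cong (toℚᵘ-fromℚᵘ (mkℚᵘ (ℤ.+ a) i)) (toℚᵘ-/1 (suc i)) ⟩
    mkℚᵘ (ℤ.+ a) i ℚᵘ.* mkℚᵘ (ℤ.+ suc i) 0 ≈⟨ *≡* (trans (ℤP.*-assoc (ℤ.+ a) (ℤ.+ suc i) (ℤ.+ 1))
        (cong ((ℤ.+ a) ℤ.*_) (trans (ℤP.*-identityʳ (ℤ.+ suc i)) (cong (λ z → ℤ.+ suc z) (sym (ℕP.*-identityʳ i)))))) ⟩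
    mkℚᵘ (ℤ.+ a) 0 ≈⟨ ℚᵘP.≃-sym (toℚᵘ-/1 a) ⟩
    toℚᵘ (ℕ→ℚ a) ∎)
    where open ℚᵘP.≃-Reasoning

  ℕ→ℚ-+ : ∀ m n → ℕ→ℚ (m ℕ.+ n) ≡ ℕ→ℚ m + ℕ→ℚ n
  ℕ→ℚ-+ m n = toℚᵘ-injective (begin
    toℚᵘ (ℕ→ℚ (m ℕ.+ n)) ≈⟨ toℚᵘ-/1 (m ℕ.+ n) ⟩
    mkℚᵘ (ℤ.+ (m ℕ.+ n)) 0 ≈⟨ *≡* (cong (ℤ._* (ℤ.+ 1)) (cong₂ ℤ._+_ (sym (ℤP.*-identityʳ (ℤ.+ m))) (sym (ℤP.*-identityʳ (ℤ.+ n))))) ⟩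
    mkℚᵘ (ℤ.+ m) 0 ℚᵘ.+ mkℚᵘ (ℤ.+ n) 0 ≈⟨ ℚᵘP.≃-sym (ℚᵘP.+-cong (toℚᵘ-/1 m) (toℚᵘ-/1 n)) ⟩
    toℚᵘ (ℕ→ℚ m) ℚᵘ.+ toℚᵘ (ℕ→ℚ n) ≈⟨ ℚᵘP.≃-sym (toℚᵘ-homo-+ (ℕ→ℚ m) (ℕ→ℚ n)) ⟩
    toℚᵘ (ℕ→ℚ m + ℕ→ℚ n) ∎)
    where open ℚᵘP.≃-Reasoning

  ℕ→ℚ-* : ∀ m n → ℕ→ℚ (m ℕ.* n) ≡ ℕ→ℚ m * ℕ→ℚ n
  ℕ→ℚ-* zero n = sym (*-zeroˡ (ℕ→ℚ n))
  ℕ→ℚ-* (suc m) n = begin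
    ℕ→ℚ (n ℕ.+ m ℕ.* n) ≡⟨ ℕ→ℚ-+ n (m ℕ.* n) ⟩
    ℕ→ℚ n + ℕ→ℚ (m ℕ.* n) ≡⟨ cong (λ z → ℕ→ℚ n + z) (ℕ→ℚ-* m n) ⟩
    ℕ→ℚ n + ℕ→ℚ m * ℕ→ℚ n ≡⟨ solve 2 (λ m n → n :+ m :* n := (con 1ℚ :+ m) :* n) refl (ℕ→ℚ m) (ℕ→ℚ n) ⟩
    (1ℚ + ℕ→ℚ m) * ℕ→ℚ n ≡⟨ cong (λ z → z * ℕ→ℚ n) (sym (ℕ→ℚ-+ 1 m)) ⟩
    ℕ→ℚ (suc m) * ℕ→ℚ n ∎
    where open ≡-Reasoning

  ℕ→ℚ-suc : ∀ n → ℕ→ℚ (suc n) ≡ 1ℚ + ℕ→ℚ n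
  ℕ→ℚ-suc n = ℕ→ℚ-+ 1 n

  0≤ℕ→ℚ : ∀ n → 0ℚ ≤ ℕ→ℚ n
  0≤ℕ→ℚ zero = ≤-refl
  0≤ℕ→ℚ (suc n) = subst (0ℚ ≤_) (sym (ℕ→ℚ-suc n)) (0≤+ 0≤1 (0≤ℕ→ℚ n))

  ℕ→ℚ-mono : ∀ {m n} → m ℕ.≤ n → ℕ→ℚ m ≤ ℕ→ℚ n
  ℕ→ℚ-mono {m} m≤n with ℕP.m≤n⇒∃[o]m+o≡n m≤n
  ... | o , refl = diff-≤ (ℕ→ℚ o) (0≤ℕ→ℚ o) (ℕ→ℚ-+ m o)

  ℕ→ℚ-pos : ∀ n → Positive (ℕ→ℚ (suc n))
  ℕ→ℚ-pos n = positive (<-≤-trans (positive⁻¹ 1ℚ) (ℕ→ℚ-mono {1} {suc n} (ℕ.s≤s ℕ.z≤n)))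

  inv : ℕ → ℚ
  inv i = (ℤ.+ 1) / suc i

  inv-* : ∀ i → inv i * ℕ→ℚ (suc i) ≡ 1ℚ
  inv-* i = /-*-cancel 1 i

  *-cancel-≤ : ∀ n {p q} → p * ℕ→ℚ (suc n) ≤ q * ℕ→ℚ (suc n) → p ≤ q
  *-cancel-≤ n = *-cancelʳ-≤-pos (ℕ→ℚ (suc n)) {{ℕ→ℚ-pos n}}

  *-cancel-≡ : ∀ n {p q} → p * ℕ→ℚ (suc n) ≡ q * ℕ→ℚ (suc n) → p ≡ q
  *-cancel-≡ n eq = ≤-antisym (*-cancel-≤ n (≤-reflexive eq)) (*-cancel-≤ n (≤-reflexive (sym eq)))

  0≤inv : ∀ i → 0ℚ ≤ inv i
  0≤inv i = nonNegative⁻¹ (inv i) {{normalize-nonNeg 1 (suc i)}}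

  inv≤1 : ∀ i → inv i ≤ 1ℚ
  inv≤1 i = *-cancel-≤ i (subst₂ _≤_ (sym (inv-* i)) (sym (*-identityˡ _)) (ℕ→ℚ-mono {1} {suc i} (ℕ.s≤s ℕ.z≤n)))

  inv-step : ∀ i → inv i * inv (suc i) ≡ inv i - inv (suc i)
  inv-step i = *-cancel-≡ i (*-cancel-≡ (suc i) (trans (lhs) (sym rhs)))
    where
    a = inv i
    b = inv (suc i)
    m = ℕ→ℚ (suc i)
    n = ℕ→ℚ (suc (suc i))
    lhs : a * b * m * n ≡ 1ℚ
    lhs = trans (solve 4 (λ a b m n → a :* b :* m :* n := (a :* m) :* (b :* n)) refl a b m n)
      (cong₂ _*_ (inv-* i) (inv-* (suc i)))
    rhs : (a - b) * m * n ≡ 1ℚ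
    rhs = begin
      (a - b) * m * n ≡⟨ solve 4 (λ a b m n → (a :- b) :* m :* n := (a :* m) :* n :- (b :* n) :* m) refl a b m n ⟩
      (a * m) * n - (b * n) * m ≡⟨ cong₂ (λ x y → x * n - y * m) (inv-* i) (inv-* (suc i)) ⟩
      1ℚ * n - 1ℚ * m ≡⟨ cong (λ z → 1ℚ * z - 1ℚ * m) (ℕ→ℚ-suc (suc i)) ⟩
      1ℚ * (1ℚ + m) - 1ℚ * m ≡⟨ solve 1 (λ m → con 1ℚ :* (con 1ℚ :+ m) :- con 1ℚ :* m := con 1ℚ) refl m ⟩
      1ℚ ∎
      where open ≡-Reasoning

  inv-antitone : ∀ {i j} → i ℕ.≤ j → inv j ≤ inv i
  inv-antitone {i} {j} i≤j = *-cancel-≤ i (*-cancel-≤ j (subst₂ _≤_ (sym lhs) (sym rhs) (ℕ→ℚ-mono (ℕ.s≤s i≤j))))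
    where
    m = ℕ→ℚ (suc i)
    n = ℕ→ℚ (suc j)
    lhs : inv j * m * n ≡ m
    lhs = trans (solve 3 (λ b m n → b :* m :* n := (b :* n) :* m) refl (inv j) m n)
      (trans (cong (_* m) (inv-* j)) (*-identityˡ m))
    rhs : inv i * m * n ≡ n
    rhs = trans (cong (_* n) (inv-* i)) (*-identityˡ n)

  archimedean : ∀ p → ∃ λ n → p ≤ ℕ→ℚ n
  archimedean p@(mkℚ (ℤ.+ a) d _) = a , *-cancel-≤ d (≤-trans (≤-reflexive eq)
      (≤-trans (≤-reflexive (sym (*-identityʳ _))) (*-monoˡ-≤₀ (ℕ→ℚ a) (0≤ℕ→ℚ a) (ℕ→ℚ-mono {1} {suc d} (ℕ.s≤s ℕ.z≤n)))))
    where
    eq : p * ℕ→ℚ (suc d) ≡ ℕ→ℚ a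
    eq = trans (cong (_* ℕ→ℚ (suc d)) (sym (↥p/↧p≡p p))) (/-*-cancel a d)
  archimedean p@(mkℚ (ℤ.-[1+ a ]) d _) = 0 , nonPositive⁻¹ p

  -- The recurrence for means

  Σ< : ℕ → (ℕ → ℚ) → ℚ
  Σ< zero F = 0ℚ
  Σ< (suc n) F = F n + Σ< n F

  Σ<-mono : ∀ n {F G} → (∀ i → F i ≤ G i) → Σ< n F ≤ Σ< n G
  Σ<-mono zero le = ≤-refl
  Σ<-mono (suc n) le = +-mono-≤ (le n) (Σ<-mono n le)

  Σ<-+ : ∀ n F G → Σ< n (λ i → F i + G i) ≡ Σ< n F + Σ< n G
  Σ<-+ zero F G = refl
  Σ<-+ (suc n) F G rewrite Σ<-+ n F G =
    solve 4 (λ a b c e → a :+ b :+ (c :+ e) := a :+ c :+ (b :+ e)) refl (F n) (G n) (Σ< n F) (Σ< n G)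

  Σ<-* : ∀ n c F → Σ< n (λ i → c * F i) ≡ c * Σ< n F
  Σ<-* zero c F = sym (*-zeroʳ c)
  Σ<-* (suc n) c F rewrite Σ<-* n c F = sym (*-distribˡ-+ c (F n) (Σ< n F))

  Summable : (ℕ → ℚ) → Set
  Summable F = ∃ λ C → ∀ n → Σ< n F ≤ C

  summable-≤ : ∀ {F G} → (∀ i → F i ≤ G i) → Summable G → Summable F
  summable-≤ le (C , h) = C , λ n → ≤-trans (Σ<-mono n le) (h n)

  summable-+ : ∀ {F G} → Summable F → Summable G → Summable (λ i → F i + G i)
  summable-+ {F} {G} (C , h) (C' , h') = C + C' , λ n →
    ≤-trans (≤-reflexive (Σ<-+ n F G)) (+-mono-≤ (h n) (h' n))

  summable-* : ∀ {F} c → 0ℚ ≤ c → Summable F → Summable (λ i → c * F i)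
  summable-* {F} c 0≤c (C , h) = c * C , λ n →
    ≤-trans (≤-reflexive (Σ<-* n c F)) (*-monoˡ-≤₀ c 0≤c (h n))

  weighted : (ℕ → ℚ) → ℕ → ℚ
  weighted F i = ℕ→ℚ i * F i

  Bounded : (ℕ → ℚ) → Set
  Bounded F = ∃ λ C → ∀ n → ∣ F n ∣ ≤ C

  bounded-by-increments : ∀ {F D} → (∀ n → ∣ F (suc n) - F n ∣ ≤ D n) → Summable D → Bounded F
  bounded-by-increments {F} {D} inc (C , h) = ∣ F 0 ∣ + C , λ n →
    ≤-trans (go n) (+-monoʳ-≤ ∣ F 0 ∣ (h n))
    where
    go : ∀ n → ∣ F n ∣ ≤ ∣ F 0 ∣ + Σ< n D
    go zero = ≤-reflexive (sym (+-identityʳ ∣ F 0 ∣))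
    go (suc n) = subst₂ _≤_
      (cong ∣_∣ (solve 2 (λ a b → (b :- a) :+ a := b) refl (F n) (F (suc n))))
      (solve 3 (λ a b c → a :+ (b :+ c) := b :+ (a :+ c)) refl (D n) ∣ F 0 ∣ (Σ< n D))
      (∣+∣≤ {F (suc n) - F n} {F n} (inc n) (go n))

  -- Convergence at rate `O(1/i)` without mention of the limit, which need not be rational.
  Conv : (ℕ → ℚ) → Set
  Conv z = ∃ λ C → 0ℚ ≤ C × ∀ i j → ∣ z i - z j ∣ ≤ C * (inv i + inv j)

  -- By `inv-step` the hypothesis is an increment of order `1/i²`, in a form whose sums collapse.
  conv-telescope : ∀ {z} C → 0ℚ ≤ C → (∀ i → ∣ z (suc i) - z i ∣ ≤ C * (inv i - inv (suc i))) → Conv z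
  conv-telescope {z} C 0≤C inc = C , 0≤C , both
    where
    up : ∀ i o → ∣ z (o ℕ.+ i) - z i ∣ ≤ C * (inv i - inv (o ℕ.+ i))
    up i zero = ≤-reflexive (trans (cong ∣_∣ (+-inverseʳ (z i))) (sym (trans (cong (C *_) (+-inverseʳ (inv i))) (*-zeroʳ C))))
    up i (suc o) = subst₂ _≤_
      (cong ∣_∣ (solve 3 (λ a b c → (a :- b) :+ (b :- c) := a :- c) refl (z (suc o ℕ.+ i)) (z (o ℕ.+ i)) (z i)))
      (solve 4 (λ e a b c → e :* (a :- b) :+ e :* (c :- a) := e :* (c :- b)) refl C (inv (o ℕ.+ i)) (inv (suc o ℕ.+ i)) (inv i))
      (∣+∣≤ {z (suc o ℕ.+ i) - z (o ℕ.+ i)} {z (o ℕ.+ i) - z i} (inc (o ℕ.+ i)) (up i o))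
    weaken : ∀ i j → C * (inv i - inv j) ≤ C * (inv i + inv j)
    weaken i j = *-monoˡ-≤₀ C 0≤C (+-monoʳ-≤ (inv i) (≤-trans (neg-antimono-≤ (0≤inv j)) (0≤inv j)))
    both : ∀ i j → ∣ z i - z j ∣ ≤ C * (inv i + inv j)
    both i j with ℕP.≤-total i j
    ... | inj₁ i≤j with ℕP.m≤n⇒∃[o]m+o≡n i≤j
    ...   | o , refl rewrite ℕP.+-comm i o =
      ≤-trans (≤-reflexive (∣p-q∣≡∣q-p∣ (z i) (z (o ℕ.+ i)))) (≤-trans (up i o) (weaken i (o ℕ.+ i)))
    both i j | inj₂ j≤i with ℕP.m≤n⇒∃[o]m+o≡n j≤i
    ...   | o , refl rewrite ℕP.+-comm j o =
      ≤-trans (up j o) (≤-trans (weaken j (o ℕ.+ j)) (≤-reflexive (cong (C *_) (+-comm (inv j) (inv (o ℕ.+ j))))))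

  module Contraction (d : ℕ) where

    dq : ℚ
    dq = ℕ→ℚ d

    0≤d : 0ℚ ≤ dq
    0≤d = 0≤ℕ→ℚ d

    0≤1+d : 0ℚ ≤ 1ℚ + dq
    0≤1+d = 0≤+ 0≤1 0≤d

    cancel-1+d : ∀ {p q} → (1ℚ + dq) * p ≤ (1ℚ + dq) * q → p ≤ q
    cancel-1+d {p} {q} le = *-cancel-≤ d (subst₂ _≤_ (eq p) (eq q) le)
      where
      eq : ∀ p → (1ℚ + dq) * p ≡ p * ℕ→ℚ (suc d)
      eq p = trans (*-comm (1ℚ + dq) p) (cong (p *_) (sym (ℕ→ℚ-suc d)))

    -- The inequalities `step` are added up: of every `(1 + d) * x j`, the part `d * x j` pays for
    -- the next step and one `x j` stays in the sum. No powers of `d / (1 + d)` are needed.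
    contraction-summable : ∀ {x w} → (∀ j → 0ℚ ≤ x j) →
      (∀ j → (1ℚ + dq) * x (suc j) ≤ dq * x j + w j) → Summable w → Summable x
    contraction-summable {x} {w} 0≤x step (W , h) = (1ℚ + dq) * x 0 + W , bound
      where
      invariant : ∀ n → Σ< (suc n) x + dq * x n ≤ (1ℚ + dq) * x 0 + Σ< n w
      invariant zero = ≤-reflexive (solve 2 (λ a e → a :+ con 0ℚ :+ e :* a := (con 1ℚ :+ e) :* a :+ con 0ℚ) refl (x 0) dq)
      invariant (suc n) = begin
        x (suc n) + Σ< (suc n) x + dq * x (suc n)
          ≡⟨ solve 3 (λ a s e → a :+ s :+ e :* a := s :+ (con 1ℚ :+ e) :* a) refl (x (suc n)) (Σ< (suc n) x) dq ⟩
        Σ< (suc n) x + (1ℚ + dq) * x (suc n) ≤⟨ +-monoʳ-≤ (Σ< (suc n) x) (step n) ⟩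
        Σ< (suc n) x + (dq * x n + w n) ≡⟨ sym (+-assoc (Σ< (suc n) x) (dq * x n) (w n)) ⟩
        Σ< (suc n) x + dq * x n + w n ≤⟨ +-monoˡ-≤ (w n) (invariant n) ⟩
        (1ℚ + dq) * x 0 + Σ< n w + w n
          ≡⟨ solve 3 (λ a b c → a :+ b :+ c := a :+ (c :+ b)) refl ((1ℚ + dq) * x 0) (Σ< n w) (w n) ⟩
        (1ℚ + dq) * x 0 + (w n + Σ< n w) ∎
        where open ≤-Reasoning
      bound : ∀ n → Σ< n x ≤ (1ℚ + dq) * x 0 + W
      bound n = begin
        Σ< n x ≤⟨ diff-≤ (x n + dq * x n) (0≤+ (0≤x n) (0≤* 0≤d (0≤x n)))
                   (solve 3 (λ a s e → a :+ s :+ e :* a := s :+ (a :+ e :* a)) refl (x n) (Σ< n x) dq) ⟩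
        Σ< (suc n) x + dq * x n ≤⟨ invariant n ⟩
        (1ℚ + dq) * x 0 + Σ< n w ≤⟨ +-monoʳ-≤ ((1ℚ + dq) * x 0) (h n) ⟩
        (1ℚ + dq) * x 0 + W ∎
        where open ≤-Reasoning

    -- The sequence `j * x j` obeys the same contraction; having the factor `j + 1` in place of `j`
    -- adds `dq * x j + w j` to the perturbation, which is summable by the unweighted case.
    contraction-weighted : ∀ {x w} → (∀ j → 0ℚ ≤ x j) →
      (∀ j → (1ℚ + dq) * x (suc j) ≤ dq * x j + w j) →
      Summable w → Summable (weighted w) → Summable (weighted x)
    contraction-weighted {x} {w} 0≤x step sw sww =
      contraction-summable (λ j → 0≤* (0≤ℕ→ℚ j) (0≤x j)) step'
        (summable-+ (summable-* dq 0≤d (contraction-summable 0≤x step sw)) (summable-+ sww sw))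
      where
      step' : ∀ j → (1ℚ + dq) * weighted x (suc j) ≤ dq * weighted x j + (dq * x j + (weighted w j + w j))
      step' j = begin
        (1ℚ + dq) * (ℕ→ℚ (suc j) * x (suc j))
          ≡⟨ solve 3 (λ a b c → a :* (b :* c) := b :* (a :* c)) refl (1ℚ + dq) (ℕ→ℚ (suc j)) (x (suc j)) ⟩
        ℕ→ℚ (suc j) * ((1ℚ + dq) * x (suc j)) ≤⟨ *-monoˡ-≤₀ (ℕ→ℚ (suc j)) (0≤ℕ→ℚ (suc j)) (step j) ⟩
        ℕ→ℚ (suc j) * (dq * x j + w j) ≡⟨ cong (_* (dq * x j + w j)) (ℕ→ℚ-suc j) ⟩
        (1ℚ + ℕ→ℚ j) * (dq * x j + w j)
          ≡⟨ solve 4 (λ n e x w → (con 1ℚ :+ n) :* (e :* x :+ w) := e :* (n :* x) :+ (e :* x :+ (n :* w :+ w))) refl (ℕ→ℚ j) dq (x j) (w j) ⟩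
        dq * weighted x j + (dq * x j + (weighted w j + w j)) ∎
        where open ≤-Reasoning

  -- r n is the ratio of the numbers of tilings of lengths n and n + 1.
  module Recurrence (d : ℕ) (r : ℕ → ℚ) (0≤r : ∀ n → 0ℚ ≤ r n) (r₀ : r 0 ≡ 1ℚ)
    (r-rec : ∀ n → ℕ→ℚ d * (r (suc n) * r n) ≡ 1ℚ - r (suc n)) where

    open Contraction d public

    -- The proportion of tilings of length `n + 1` that begin with a dimer.
    q : ℕ → ℚ
    q n = 1ℚ - r n

    0≤q : ∀ n → 0ℚ ≤ q n
    0≤q zero = ≤-reflexive (sym (trans (cong (λ z → 1ℚ - z) r₀) (+-inverseʳ 1ℚ)))
    0≤q (suc n) = subst (0ℚ ≤_) (r-rec n) (0≤* 0≤d (0≤* (0≤r (suc n)) (0≤r n)))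

    -- The recurrence says `s * (1 + d * t) = 1`, and `t ≤ 1` then gives `s ≥ 1 / (1 + d)`. This
    -- uniform bound is the source of every contraction below, because each recurrence has some
    -- `q n` as its factor.
    q-contract : ∀ n → (1ℚ + dq) * q n ≤ dq
    q-contract zero = subst (_≤ dq) (sym (trans (cong (λ z → (1ℚ + dq) * (1ℚ - z)) r₀) (trans (cong ((1ℚ + dq) *_) (+-inverseʳ 1ℚ)) (*-zeroʳ (1ℚ + dq))))) 0≤d
    q-contract (suc n) = diff-≤ (dq * (r (suc n) * q n)) (0≤* 0≤d (0≤* (0≤r (suc n)) (0≤q n))) (sym (begin
      (1ℚ + dq) * (1ℚ - s) + dq * (s * (1ℚ - t))
        ≡⟨ solve 3 (λ e s t → (con 1ℚ :+ e) :* (con 1ℚ :- s) :+ e :* (s :* (con 1ℚ :- t)) := e :+ ((con 1ℚ :- s) :- e :* (s :* t))) refl dq s t ⟩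
      dq + ((1ℚ - s) - dq * (s * t)) ≡⟨ cong (λ z → dq + ((1ℚ - s) - z)) (r-rec n) ⟩
      dq + ((1ℚ - s) - (1ℚ - s)) ≡⟨ solve 2 (λ e s → e :+ ((con 1ℚ :- s) :- (con 1ℚ :- s)) := e) refl dq s ⟩
      dq ∎))
      where
      open ≡-Reasoning
      s = r (suc n)
      t = r n

    ∣q∣ : ∀ n → ∣ q n ∣ ≡ q n
    ∣q∣ n = 0≤p⇒∣p∣≡p (0≤q n)

    q-step : ∀ n {p c} → ∣ p ∣ ≤ c → (1ℚ + dq) * ∣ q n * p ∣ ≤ dq * c
    q-step n {p} {c} le = begin
      (1ℚ + dq) * ∣ q n * p ∣ ≡⟨ cong ((1ℚ + dq) *_) (trans (∣p*q∣≡∣p∣*∣q∣ (q n) p) (cong (_* ∣ p ∣) (∣q∣ n))) ⟩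
      (1ℚ + dq) * (q n * ∣ p ∣) ≡⟨ sym (*-assoc (1ℚ + dq) (q n) ∣ p ∣) ⟩
      (1ℚ + dq) * q n * ∣ p ∣ ≤⟨ *-mono-≤₀ 0≤d (0≤∣p∣ p) (q-contract n) le ⟩
      dq * c ∎
      where open ≤-Reasoning

    x : ℕ → ℚ
    x n = ∣ r (suc n) - r n ∣

    -- In `c * 1 - b * 1` the first 1 is replaced by `b + d * b * a` and the second by
    -- `c + d * c * b`, so that the products `c * b` cancel.
    r-diff : ∀ n → r (suc (suc n)) - r (suc n) ≡ q (suc (suc n)) * (r n - r (suc n))
    r-diff n = begin
      c - b ≡⟨ solve 2 (λ b c → c :- b := c :* (con 1ℚ) :- b :* (con 1ℚ)) refl b c ⟩
      c * 1ℚ - b * 1ℚ ≡⟨ cong₂ (λ y z → c * y - b * z) (unit n) (unit (suc n)) ⟩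
      c * (b + dq * (b * a)) - b * (c + dq * (c * b))
        ≡⟨ solve 4 (λ e a b c → c :* (b :+ e :* (b :* a)) :- b :* (c :+ e :* (c :* b)) := e :* (c :* b) :* (a :- b)) refl dq a b c ⟩
      dq * (c * b) * (a - b) ≡⟨ cong (_* (a - b)) (r-rec (suc n)) ⟩
      q (suc (suc n)) * (a - b) ∎
      where
      open ≡-Reasoning
      a = r n
      b = r (suc n)
      c = r (suc (suc n))
      unit : ∀ n → 1ℚ ≡ r (suc n) + dq * (r (suc n) * r n)
      unit n = trans (solve 1 (λ s → con 1ℚ := s :+ (con 1ℚ :- s)) refl (r (suc n))) (cong (r (suc n) +_) (sym (r-rec n)))

    x-contract : ∀ n → (1ℚ + dq) * x (suc n) ≤ dq * x n
    x-contract n = subst (λ z → (1ℚ + dq) * ∣ z ∣ ≤ dq * x n) (sym (r-diff n))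
      (q-step (suc (suc n)) (≤-reflexive (∣p-q∣≡∣q-p∣ (r n) (r (suc n)))))

    0≤x : ∀ n → 0ℚ ≤ x n
    0≤x n = 0≤∣p∣ (r (suc n) - r n)

    x-antitone : ∀ n → x (suc n) ≤ x n
    x-antitone n = cancel-1+d (≤-trans (x-contract n) (diff-≤ (x n) (0≤x n)
      (solve 2 (λ e x → (con 1ℚ :+ e) :* x := e :* x :+ x) refl dq (x n))))

    private
      x-step : ∀ n → (1ℚ + dq) * x (suc n) ≤ dq * x n + 0ℚ
      x-step n = ≤-trans (x-contract n) (≤-reflexive (sym (+-identityʳ (dq * x n))))

      Σ0 : ∀ n → Σ< n (λ _ → 0ℚ) ≡ 0ℚ
      Σ0 zero = refl
      Σ0 (suc n) = trans (+-identityˡ _) (Σ0 n)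

      summable-0 : Summable (λ _ → 0ℚ)
      summable-0 = 0ℚ , λ n → ≤-reflexive (Σ0 n)

    x-summable : Summable x
    x-summable = contraction-summable 0≤x x-step summable-0

    x-weighted : Summable (weighted x)
    x-weighted = contraction-weighted 0≤x x-step summable-0
      (summable-≤ (λ i → ≤-reflexive (*-zeroʳ (ℕ→ℚ i))) summable-0)

    -- Increments of the mean of a linear statistic whose dimers at height n weigh b n on average.
    δ : (ℕ → ℚ) → ℕ → ℚ
    δ b zero = 0ℚ
    δ b (suc n) = q (suc n) * (b n - δ b n)

    mean : (ℕ → ℚ) → ℕ → ℚ
    mean b zero = 0ℚ
    mean b (suc n) = mean b n + δ b n

    -- The constant is the fixed point of the step: `d / (1 + d) * (B + d * B) = d * B`.
    δ-bound : ∀ {b B : ℕ → ℚ} → (∀ n → ∣ b n ∣ ≤ B n) → (∀ n → B n ≤ B (suc n)) → ∀ n → ∣ δ b n ∣ ≤ dq * B n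
    δ-bound {b} {B} b≤ mono zero = 0≤* 0≤d (≤-trans (0≤∣p∣ (b 0)) (b≤ 0))
    δ-bound {b} {B} b≤ mono (suc n) = ≤-trans (cancel-1+d (begin
      (1ℚ + dq) * ∣ q (suc n) * (b n - δ b n) ∣ ≤⟨ q-step (suc n) (∣-∣≤ {b n} {δ b n} (b≤ n) (δ-bound {b} {B} b≤ mono n)) ⟩
      dq * (B n + dq * B n) ≡⟨ solve 2 (λ e B → e :* (B :+ e :* B) := (con 1ℚ :+ e) :* (e :* B)) refl dq (B n) ⟩
      (1ℚ + dq) * (dq * B n) ∎)) (*-monoˡ-≤₀ dq 0≤d (mono n))
      where open ≤-Reasoning

    module ConstantMean (b : ℚ) where

      private
        δ' = δ (λ _ → b)
        m = mean (λ _ → b)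

      δ-bounded : ∀ n → ∣ δ' n ∣ ≤ dq * ∣ b ∣
      δ-bounded = δ-bound {λ _ → b} {λ _ → ∣ b ∣} (λ _ → ≤-refl) (λ _ → ≤-refl)

      K : ℚ
      K = (1ℚ + dq) * (∣ b ∣ + dq * ∣ b ∣)

      0≤K : 0ℚ ≤ K
      0≤K = 0≤* 0≤1+d (0≤+ (0≤∣p∣ b) (0≤* 0≤d (0≤∣p∣ b)))

      y : ℕ → ℚ
      y n = ∣ δ' (suc n) - δ' n ∣

      -- The recurrence of `δ'` has a varying coefficient. Freezing it yields the contraction; its
      -- drift is a difference of consecutive ratios times the bounded `b - δ'`, which `K * x n`
      -- absorbs.
      y-step : ∀ n → (1ℚ + dq) * y (suc n) ≤ dq * y n + K * x n
      y-step n = begin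
        (1ℚ + dq) * ∣ δ' (suc (suc n)) - δ' (suc n) ∣ ≡⟨ cong (λ z → (1ℚ + dq) * ∣ z ∣) diff ⟩
        (1ℚ + dq) * ∣ q (suc n) * (δ' n - δ' (suc n)) + (r (suc n) - r (suc (suc n))) * (b - δ' (suc n)) ∣
          ≤⟨ *-monoˡ-≤₀ (1ℚ + dq) 0≤1+d (∣p+q∣≤∣p∣+∣q∣ (q (suc n) * (δ' n - δ' (suc n))) ((r (suc n) - r (suc (suc n))) * (b - δ' (suc n)))) ⟩
        (1ℚ + dq) * (∣ q (suc n) * (δ' n - δ' (suc n)) ∣ + ∣ (r (suc n) - r (suc (suc n))) * (b - δ' (suc n)) ∣)
          ≡⟨ *-distribˡ-+ (1ℚ + dq) _ _ ⟩
        (1ℚ + dq) * ∣ q (suc n) * (δ' n - δ' (suc n)) ∣ + (1ℚ + dq) * ∣ (r (suc n) - r (suc (suc n))) * (b - δ' (suc n)) ∣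
          ≤⟨ +-mono-≤ (q-step (suc n) (≤-reflexive (∣p-q∣≡∣q-p∣ (δ' n) (δ' (suc n)))))
               (*-monoˡ-≤₀ (1ℚ + dq) 0≤1+d (∣*∣≤ {r (suc n) - r (suc (suc n))} {b - δ' (suc n)}
                 (≤-trans (≤-reflexive (∣p-q∣≡∣q-p∣ (r (suc n)) (r (suc (suc n))))) (x-antitone n))
                 (∣-∣≤ {b} {δ' (suc n)} ≤-refl (δ-bounded (suc n))))) ⟩
        dq * y n + (1ℚ + dq) * (x n * (∣ b ∣ + dq * ∣ b ∣))
          ≡⟨ cong (dq * y n +_) (solve 3 (λ e x B → e :* (x :* B) := e :* B :* x) refl (1ℚ + dq) (x n) (∣ b ∣ + dq * ∣ b ∣)) ⟩
        dq * y n + K * x n ∎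
        where
        open ≤-Reasoning
        diff : δ' (suc (suc n)) - δ' (suc n) ≡
               q (suc n) * (δ' n - δ' (suc n)) + (r (suc n) - r (suc (suc n))) * (b - δ' (suc n))
        diff = solve 5 (λ s t b u v → (con 1ℚ :- t) :* (b :- v) :- (con 1ℚ :- s) :* (b :- u) :=
                  (con 1ℚ :- s) :* (u :- v) :+ (s :- t) :* (b :- v)) refl (r (suc n)) (r (suc (suc n))) b (δ' n) (δ' (suc n))

      y-summable : Summable y
      y-summable = contraction-summable (λ n → 0≤∣p∣ (δ' (suc n) - δ' n)) y-step (summable-* K 0≤K x-summable)

      y-weighted : Summable (weighted y)
      y-weighted = contraction-weighted (λ n → 0≤∣p∣ (δ' (suc n) - δ' n)) y-step (summable-* K 0≤K x-summable)
        (summable-≤ (λ n → ≤-reflexive (solve 3 (λ n k x → n :* (k :* x) := k :* (n :* x)) refl (ℕ→ℚ n) K (x n)))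
          (summable-* K 0≤K x-weighted))

      -- Abel summation of the mean: `ψ` starts at 0 and has the increments
      -- `(n + 1) * (δ' (n + 1) - δ' n)`, which is why the weighted sums of `y` are bounded above.
      ψ : ℕ → ℚ
      ψ n = ℕ→ℚ n * δ' n - m n

      ψ-bounded : Bounded ψ
      ψ-bounded = bounded-by-increments inc (summable-+ y-weighted y-summable)
        where
        inc : ∀ n → ∣ ψ (suc n) - ψ n ∣ ≤ weighted y n + y n
        inc n = begin
          ∣ ℕ→ℚ (suc n) * v - (m n + u) - (ℕ→ℚ n * u - m n) ∣ ≡⟨ cong (λ z → ∣ z * v - (m n + u) - (ℕ→ℚ n * u - m n) ∣) (ℕ→ℚ-suc n) ⟩
          ∣ (1ℚ + ℕ→ℚ n) * v - (m n + u) - (ℕ→ℚ n * u - m n) ∣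
            ≡⟨ cong ∣_∣ (solve 4 (λ n u v m → (con 1ℚ :+ n) :* v :- (m :+ u) :- (n :* u :- m) := (n :+ con 1ℚ) :* (v :- u)) refl (ℕ→ℚ n) u v (m n)) ⟩
          ∣ (ℕ→ℚ n + 1ℚ) * (v - u) ∣ ≡⟨ ∣p*q∣≡∣p∣*∣q∣ (ℕ→ℚ n + 1ℚ) (v - u) ⟩
          ∣ ℕ→ℚ n + 1ℚ ∣ * y n ≡⟨ cong (_* y n) (0≤p⇒∣p∣≡p (0≤+ (0≤ℕ→ℚ n) 0≤1)) ⟩
          (ℕ→ℚ n + 1ℚ) * y n ≡⟨ solve 2 (λ n y → (n :+ con 1ℚ) :* y := n :* y :+ y) refl (ℕ→ℚ n) (y n) ⟩
          weighted y n + y n ∎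
          where
          open ≤-Reasoning
          u = δ' n
          v = δ' (suc n)

      density : ℕ → ℚ
      density i = m (suc i) * inv i

      -- The increment of `density` at `i` is exactly `ψ (suc i) * (inv i * inv (suc i))`, with `ψ`
      -- bounded.
      density-conv : Conv density
      density-conv = conv-telescope {density} C 0≤C inc
        where
        C = proj₁ ψ-bounded
        0≤C : 0ℚ ≤ C
        0≤C = ≤-trans (0≤∣p∣ (ψ 0)) (proj₂ ψ-bounded 0)
        inc : ∀ i → ∣ density (suc i) - density i ∣ ≤ C * (inv i - inv (suc i))
        inc i = begin
          ∣ (M + u) * b' - M * a ∣ ≡⟨ cong ∣_∣ eq ⟩
          ∣ ψ (suc i) * (a * b') ∣ ≡⟨ ∣p*q∣≡∣p∣*∣q∣ (ψ (suc i)) (a * b') ⟩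
          ∣ ψ (suc i) ∣ * ∣ a * b' ∣ ≡⟨ cong (∣ ψ (suc i) ∣ *_) (0≤p⇒∣p∣≡p 0≤ab) ⟩
          ∣ ψ (suc i) ∣ * (a * b') ≤⟨ *-monoʳ-≤₀ (a * b') 0≤ab (proj₂ ψ-bounded (suc i)) ⟩
          C * (a * b') ≡⟨ cong (C *_) (inv-step i) ⟩
          C * (a - b') ∎
          where
          open ≤-Reasoning
          M = m (suc i)
          u = δ' (suc i)
          a = inv i
          b' = inv (suc i)
          0≤ab = 0≤* (0≤inv i) (0≤inv (suc i))
          n = ℕ→ℚ (suc i)
          eq : (M + u) * b' - M * a ≡ (n * u - M) * (a * b')
          eq = trans (solve 4 (λ M u a b → (M :+ u) :* b :- M :* a := con 1ℚ :* u :* b :- M :* (a :- b)) refl M u a b')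
            (trans (cong₂ (λ y z → y * u * b' - M * z) (sym (inv-* i)) (sym (inv-step i)))
              (solve 5 (λ M u a b n → a :* n :* u :* b :- M :* (a :* b) := (n :* u :- M) :* (a :* b)) refl M u a b' n))

      private
        s = mean (λ n → b * ℕ→ℚ (suc n))
        η = δ (λ n → b * ℕ→ℚ (suc n))
        ζ : ℕ → ℚ
        ζ n = η n - ℕ→ℚ n * δ' n
        E = dq * ∣ b ∣

      -- Both `η n` and `n * δ' n` follow nearly the same recurrence; their difference satisfies
      -- `ζ (suc n) = q (suc n) * (δ' n - ζ n)`. As `E` bounds `δ'`, the fixed point is again
      -- `d * E`.
      ζ-bound : ∀ n → ∣ ζ n ∣ ≤ dq * E
      ζ-bound zero = ≤-trans (≤-reflexive (cong (λ z → ∣ 0ℚ - z ∣) (*-zeroʳ 0ℚ)))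
        (0≤* 0≤d (0≤* 0≤d (0≤∣p∣ b)))
      ζ-bound (suc n) = cancel-1+d (begin
        (1ℚ + dq) * ∣ q (suc n) * (b * ℕ→ℚ (suc n) - η n) - ℕ→ℚ (suc n) * (q (suc n) * (b - δ' n)) ∣
          ≡⟨ cong (λ z → (1ℚ + dq) * ∣ q (suc n) * (b * z - η n) - z * (q (suc n) * (b - δ' n)) ∣) (ℕ→ℚ-suc n) ⟩
        (1ℚ + dq) * ∣ q (suc n) * (b * (1ℚ + ℕ→ℚ n) - η n) - (1ℚ + ℕ→ℚ n) * (q (suc n) * (b - δ' n)) ∣
          ≡⟨ cong (λ z → (1ℚ + dq) * ∣ z ∣) (solve 5 (λ t b n e u →
               t :* (b :* (con 1ℚ :+ n) :- e) :- (con 1ℚ :+ n) :* (t :* (b :- u)) := t :* (u :- (e :- n :* u)))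
               refl (q (suc n)) b (ℕ→ℚ n) (η n) (δ' n)) ⟩
        (1ℚ + dq) * ∣ q (suc n) * (δ' n - ζ n) ∣ ≤⟨ q-step (suc n) (∣-∣≤ {δ' n} {ζ n} (δ-bounded n) (ζ-bound n)) ⟩
        dq * (E + dq * E) ≡⟨ solve 2 (λ e E → e :* (E :+ e :* E) := (con 1ℚ :+ e) :* (e :* E)) refl dq E ⟩
        (1ℚ + dq) * (dq * E) ∎)
        where open ≤-Reasoning

      -- The mean position of the dimers is the middle of the tiling, up to a bounded error.
      linear-mean : ∃ λ C → ∀ n → ∣ s n + s n - ℕ→ℚ n * m n ∣ ≤ C * ℕ→ℚ n
      linear-mean = C , go
        where
        -- The increment of `ω` is `ζ n + ζ n + (ψ n - δ' n)`, and `C` adds the bounds of its terms.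
        C = dq * E + dq * E + (proj₁ ψ-bounded + E)
        ω : ℕ → ℚ
        ω n = s n + s n - ℕ→ℚ n * m n
        go : ∀ n → ∣ ω n ∣ ≤ C * ℕ→ℚ n
        go zero = ≤-reflexive (trans (cong ∣_∣ (solve 1 (λ z → con 0ℚ :+ con 0ℚ :- z :* con 0ℚ := con 0ℚ) refl (ℕ→ℚ 0))) (sym (*-zeroʳ C)))
        go (suc n) = begin
          ∣ s n + η n + (s n + η n) - ℕ→ℚ (suc n) * (m n + δ' n) ∣
            ≡⟨ cong (λ z → ∣ s n + η n + (s n + η n) - z * (m n + δ' n) ∣) (ℕ→ℚ-suc n) ⟩
          ∣ s n + η n + (s n + η n) - (1ℚ + ℕ→ℚ n) * (m n + δ' n) ∣
            ≡⟨ cong ∣_∣ (solve 5 (λ s e n m u → s :+ e :+ (s :+ e) :- (con 1ℚ :+ n) :* (m :+ u) :=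
                 (e :- n :* u) :+ (e :- n :* u) :+ ((n :* u :- m) :- u) :+ (s :+ s :- n :* m)) refl (s n) (η n) (ℕ→ℚ n) (m n) (δ' n)) ⟩
          ∣ ζ n + ζ n + (ψ n - δ' n) + ω n ∣
            ≤⟨ ∣+∣≤ {ζ n + ζ n + (ψ n - δ' n)} {ω n}
                 (∣+∣≤ {ζ n + ζ n} {ψ n - δ' n} (∣+∣≤ {ζ n} {ζ n} (ζ-bound n) (ζ-bound n))
                    (∣-∣≤ {ψ n} {δ' n} (proj₂ ψ-bounded n) (δ-bounded n))) (go n) ⟩
          C + C * ℕ→ℚ n ≡⟨ solve 2 (λ C n → C :+ C :* n := C :* (con 1ℚ :+ n)) refl C (ℕ→ℚ n) ⟩
          C * (1ℚ + ℕ→ℚ n) ≡⟨ cong (C *_) (sym (ℕ→ℚ-suc n)) ⟩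
          C * ℕ→ℚ (suc n) ∎
          where open ≤-Reasoning

  -- Statistics of tilings

  module _ {A : Set} where

    ΣL : (A → ℚ) → List A → ℚ
    ΣL f [] = 0ℚ
    ΣL f (x ∷ xs) = f x + ΣL f xs

    count : List A → ℚ
    count L = ℕ→ℚ (length L)

    0≤count : ∀ L → 0ℚ ≤ count L
    0≤count L = 0≤ℕ→ℚ (length L)

    count-++ : ∀ xs ys → count (xs ++ ys) ≡ count xs + count ys
    count-++ xs ys = trans (cong ℕ→ℚ (length-++ xs)) (ℕ→ℚ-+ (length xs) (length ys))

    ΣL-++ : ∀ f xs ys → ΣL f (xs ++ ys) ≡ ΣL f xs + ΣL f ys
    ΣL-++ f [] ys = sym (+-identityˡ (ΣL f ys))
    ΣL-++ f (x ∷ xs) ys = trans (cong (f x +_) (ΣL-++ f xs ys)) (sym (+-assoc (f x) (ΣL f xs) (ΣL f ys)))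

    ΣL-cong : ∀ {f g} xs → (∀ {x} → x ∈ xs → f x ≡ g x) → ΣL f xs ≡ ΣL g xs
    ΣL-cong [] eq = refl
    ΣL-cong (x ∷ xs) eq = cong₂ _+_ (eq (here refl)) (ΣL-cong xs (eq ∘ there))

    ΣL-mono : ∀ {f g} xs → (∀ {x} → x ∈ xs → f x ≤ g x) → ΣL f xs ≤ ΣL g xs
    ΣL-mono [] le = ≤-refl
    ΣL-mono (x ∷ xs) le = +-mono-≤ (le (here refl)) (ΣL-mono xs (le ∘ there))

    ΣL-+ : ∀ f g xs → ΣL (λ x → f x + g x) xs ≡ ΣL f xs + ΣL g xs
    ΣL-+ f g [] = refl
    ΣL-+ f g (x ∷ xs) rewrite ΣL-+ f g xs =
      solve 4 (λ a b c e → a :+ b :+ (c :+ e) := a :+ c :+ (b :+ e)) refl (f x) (g x) (ΣL f xs) (ΣL g xs)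

    ΣL-* : ∀ c f xs → ΣL (λ x → c * f x) xs ≡ c * ΣL f xs
    ΣL-* c f [] = sym (*-zeroʳ c)
    ΣL-* c f (x ∷ xs) rewrite ΣL-* c f xs = sym (*-distribˡ-+ c (f x) (ΣL f xs))

    ΣL-const : ∀ c xs → ΣL (λ _ → c) xs ≡ count xs * c
    ΣL-const c [] = sym (*-zeroˡ c)
    ΣL-const c (x ∷ xs) rewrite ΣL-const c xs | ℕ→ℚ-suc (length xs) =
      solve 2 (λ c n → c :+ n :* c := (con 1ℚ :+ n) :* c) refl c (count xs)

    ΣL-abs : ∀ f xs → ∣ ΣL f xs ∣ ≤ ΣL (λ x → ∣ f x ∣) xs
    ΣL-abs f [] = ≤-refl
    ΣL-abs f (x ∷ xs) = ∣+∣≤ {f x} {ΣL f xs} ≤-refl (ΣL-abs f xs)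

    ΣL-center : ∀ f μ xs → ΣL (λ x → f x - μ) xs ≡ ΣL f xs - count xs * μ
    ΣL-center f μ xs = trans (ΣL-+ f (λ _ → - μ) xs) (cong (ΣL f xs +_)
      (trans (ΣL-const (- μ) xs) (sym (neg-distribʳ-* (count xs) μ))))

    -- The cross term vanishes because `m` is the mean.
    ΣL-recenter : ∀ f m μ xs → ΣL f xs ≡ count xs * m →
      ΣL (λ x → (f x - μ) * (f x - μ)) xs ≡ ΣL (λ x → (f x - m) * (f x - m)) xs + count xs * ((m - μ) * (m - μ))
    ΣL-recenter f m μ xs mean≡ = begin
      ΣL (λ x → (f x - μ) * (f x - μ)) xs
        ≡⟨ ΣL-cong xs (λ {x} _ → solve 3 (λ f m μ → (f :- μ) :* (f :- μ) :=
             (f :- m) :* (f :- m) :+ ((m :- μ) :+ (m :- μ)) :* (f :- m) :+ (m :- μ) :* (m :- μ)) refl (f x) m μ) ⟩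
      ΣL (λ x → (f x - m) * (f x - m) + c * (f x - m) + (m - μ) * (m - μ)) xs
        ≡⟨ trans (ΣL-+ (λ x → (f x - m) * (f x - m) + c * (f x - m)) (λ _ → (m - μ) * (m - μ)) xs)
             (cong₂ _+_ (ΣL-+ (λ x → (f x - m) * (f x - m)) (λ x → c * (f x - m)) xs) (ΣL-const ((m - μ) * (m - μ)) xs)) ⟩
      S + ΣL (λ x → c * (f x - m)) xs + T
        ≡⟨ cong (λ z → S + z + T) (trans (ΣL-* c (λ x → f x - m) xs) (cong (c *_) (trans (ΣL-center f m xs)
             (trans (cong (_- count xs * m) mean≡) (+-inverseʳ (count xs * m)))))) ⟩
      S + c * 0ℚ + T ≡⟨ solve 3 (λ s c t → s :+ c :* con 0ℚ :+ t := s :+ t) refl S c T ⟩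
      S + T ∎
      where
      open ≡-Reasoning
      c = (m - μ) + (m - μ)
      S = ΣL (λ x → (f x - m) * (f x - m)) xs
      T = count xs * ((m - μ) * (m - μ))

  ΣL-map : ∀ {A B : Set} (h : A → B) f xs → ΣL f (map h xs) ≡ ΣL (f ∘ h) xs
  ΣL-map h f [] = refl
  ΣL-map h f (x ∷ xs) = cong (f (h x) +_) (ΣL-map h f xs)

  ΣL-dimers : ∀ f b L → ΣL f (dimers b L) ≡ Σ< b (λ i → ΣL (λ cs → f (suc i ∷ 0 ∷ cs)) L)
  ΣL-dimers f zero L = refl
  ΣL-dimers f (suc b) L = trans (ΣL-++ f (map (λ cs → suc b ∷ 0 ∷ cs) L) (dimers b L))
    (cong₂ _+_ (ΣL-map (λ cs → suc b ∷ 0 ∷ cs) f L) (ΣL-dimers f b L))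

  count-dimers : ∀ b L → count (dimers b L) ≡ ℕ→ℚ b * count L
  count-dimers zero L = sym (*-zeroˡ (count L))
  count-dimers (suc b) L = begin
    count (map (λ cs → suc b ∷ 0 ∷ cs) L ++ dimers b L) ≡⟨ count-++ (map (λ cs → suc b ∷ 0 ∷ cs) L) (dimers b L) ⟩
    count (map (λ cs → suc b ∷ 0 ∷ cs) L) + count (dimers b L)
      ≡⟨ cong₂ _+_ (cong ℕ→ℚ (length-map (λ cs → suc b ∷ 0 ∷ cs) L)) (count-dimers b L) ⟩
    count L + ℕ→ℚ b * count L ≡⟨ solve 2 (λ b c → c :+ b :* c := (con 1ℚ :+ b) :* c) refl (ℕ→ℚ b) (count L) ⟩
    (1ℚ + ℕ→ℚ b) * count L ≡⟨ cong (_* count L) (sym (ℕ→ℚ-suc b)) ⟩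
    ℕ→ℚ (suc b) * count L ∎
    where open ≡-Reasoning

  Σ<-mono-< : ∀ n {F G} → (∀ i → i ℕ.< n → F i ≤ G i) → Σ< n F ≤ Σ< n G
  Σ<-mono-< zero le = ≤-refl
  Σ<-mono-< (suc n) le = +-mono-≤ (le n ℕP.≤-refl) (Σ<-mono-< n (λ i i<n → le i (ℕP.m≤n⇒m≤1+n i<n)))

  Σ<-cong : ∀ n {F G} → (∀ i → F i ≡ G i) → Σ< n F ≡ Σ< n G
  Σ<-cong zero eq = refl
  Σ<-cong (suc n) eq = cong₂ _+_ (eq n) (Σ<-cong n eq)

  Σ<-const : ∀ n c → Σ< n (λ _ → c) ≡ ℕ→ℚ n * c
  Σ<-const zero c = sym (*-zeroˡ c)
  Σ<-const (suc n) c rewrite Σ<-const n c | ℕ→ℚ-suc n =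
    solve 2 (λ c n → c :+ n :* c := (con 1ℚ :+ n) :* c) refl c (ℕ→ℚ n)

  Σ<-abs : ∀ n F → ∣ Σ< n F ∣ ≤ Σ< n (λ i → ∣ F i ∣)
  Σ<-abs zero F = ≤-refl
  Σ<-abs (suc n) F = ∣+∣≤ {F n} {Σ< n F} ≤-refl (Σ<-abs n F)

  module Statistics (d : ℕ) where

    private
      -- One less than the number of tilings, so that `suc (g n)` is visibly nonzero and can serve
      -- as a denominator.
      g : ℕ → ℕ
      g zero = 0
      g (suc zero) = 0
      g (suc (suc n)) = g (suc n) ℕ.+ d ℕ.* suc (g n)

    tilingCount : ℕ → ℚ
    tilingCount n = ℕ→ℚ (suc (g n))

    tilingCount-rec : ∀ n → tilingCount (suc (suc n)) ≡ tilingCount (suc n) + ℕ→ℚ d * tilingCount n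
    tilingCount-rec n = trans (ℕ→ℚ-+ (suc (g (suc n))) (d ℕ.* suc (g n))) (cong (tilingCount (suc n) +_) (ℕ→ℚ-* d (suc (g n))))

    count-top : ∀ b n → count (topTilings d b n) ≡ count (tilings d (suc n)) + ℕ→ℚ b * count (tilings d n)
    count-top b n = trans (count-++ (map (0 ∷_) (tilings d (suc n))) (dimers b (tilings d n)))
      (cong₂ _+_ (cong ℕ→ℚ (length-map (0 ∷_) (tilings d (suc n)))) (count-dimers b (tilings d n)))

    count-tilings : ∀ n → count (tilings d n) ≡ tilingCount n
    count-tilings zero = refl
    count-tilings (suc zero) = refl
    count-tilings (suc (suc n)) = trans (count-top d n)
      (trans (cong₂ (λ x y → x + ℕ→ℚ d * y) (count-tilings (suc n)) (count-tilings n)) (sym (tilingCount-rec n)))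

    ratio : ℕ → ℚ
    ratio n = (ℤ.+ suc (g n)) / suc (g (suc n))

    ratio-* : ∀ n → ratio n * tilingCount (suc n) ≡ tilingCount n
    ratio-* n = /-*-cancel (suc (g n)) (g (suc n))

    0≤ratio : ∀ n → 0ℚ ≤ ratio n
    0≤ratio n = nonNegative⁻¹ (ratio n) {{normalize-nonNeg (suc (g n)) (suc (g (suc n)))}}

    ratio-rec : ∀ n → ℕ→ℚ d * (ratio (suc n) * ratio n) ≡ 1ℚ - ratio (suc n)
    ratio-rec n = *-cancel-≡ (g (suc (suc n))) (begin
      e * (s * t) * c₂ ≡⟨ solve 4 (λ e s t c → e :* (s :* t) :* c := e :* (t :* (s :* c))) refl e s t c₂ ⟩
      e * (t * (s * c₂)) ≡⟨ cong (λ z → e * (t * z)) (ratio-* (suc n)) ⟩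
      e * (t * c₁) ≡⟨ cong (e *_) (ratio-* n) ⟩
      e * c₀ ≡⟨ solve 2 (λ a b → b := a :+ b :- a) refl c₁ (e * c₀) ⟩
      c₁ + e * c₀ - c₁ ≡⟨ cong₂ _-_ (sym (tilingCount-rec n)) (sym (ratio-* (suc n))) ⟩
      c₂ - s * c₂ ≡⟨ solve 2 (λ s c → c :- s :* c := (con 1ℚ :- s) :* c) refl s c₂ ⟩
      (1ℚ - s) * c₂ ∎)
      where
      open ≡-Reasoning
      e = ℕ→ℚ d
      s = ratio (suc n)
      t = ratio n
      c₀ = tilingCount n
      c₁ = tilingCount (suc n)
      c₂ = tilingCount (suc (suc n))

    open Recurrence d ratio 0≤ratio refl ratio-rec public

    ΣL-top : ∀ f b n → ΣL f (topTilings d b n) ≡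
      ΣL (λ cs → f (0 ∷ cs)) (tilings d (suc n)) + Σ< b (λ i → ΣL (λ cs → f (suc i ∷ 0 ∷ cs)) (tilings d n))
    ΣL-top f b n = trans (ΣL-++ f (map (0 ∷_) (tilings d (suc n))) (dimers b (tilings d n)))
      (cong₂ _+_ (ΣL-map (0 ∷_) f (tilings d (suc n))) (ΣL-dimers f b (tilings d n)))

    -- Statistics additive over tiles, with monomers of weight 0: `φ n a` is the weight of the dimer
    -- with letter `a` on top of a tiling of length `n`, and `φ̄ n` its average over the letters,
    -- defined without division.
    record Linear (W : List ℕ → ℚ) (φ : ℕ → ℕ → ℚ) (φ̄ B : ℕ → ℚ) : Set where
      field
        W-[]    : W [] ≡ 0ℚ
        W-mono  : ∀ cs → W (0 ∷ cs) ≡ W cs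
        W-dimer : ∀ a cs → W (a ∷ 0 ∷ cs) ≡ W cs + φ (length cs) a
        average : ∀ n → dq * φ̄ n ≡ Σ< d (λ i → φ n (suc i))
        B-mono  : ∀ n → B n ≤ B (suc n)
        φ-bound : ∀ n a → a ℕ.≤ d → ∣ φ n a ∣ ≤ B n
        φ̄-bound : ∀ n → ∣ φ̄ n ∣ ≤ B n

    module Moments {W φ φ̄ B} (lin : Linear W φ φ̄ B) where

      open Linear lin

      private
        m = mean φ̄
        T = tilings d

      0≤B : ∀ n → 0ℚ ≤ B n
      0≤B n = ≤-trans (0≤∣p∣ (φ̄ n)) (φ̄-bound n)

      W-dimer-on : ∀ n a {cs} → cs ∈ T n → W (a ∷ 0 ∷ cs) ≡ W cs + φ n a
      W-dimer-on n a {cs} p = trans (W-dimer a cs) (cong (λ l → W cs + φ l a) (proj₁ (∈-tilings⁻ d n p)))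

      -- Conditioning on the top tile gives `m (n + 2) = r (n + 1) * m (n + 1) + q (n + 1) * (m n +
      -- φ̄ n)`; subtracting `m (n + 1)` turns this into the recurrence of `δ`.
      ΣL-mean : ∀ n → ΣL W (T n) ≡ count (T n) * m n
      ΣL-mean zero = trans (cong (_+ 0ℚ) W-[]) (sym (*-zeroʳ 1ℚ))
      ΣL-mean (suc zero) = trans (cong (_+ 0ℚ) (trans (W-mono []) W-[])) (solve 0 (con 0ℚ :+ con 0ℚ := con 1ℚ :* (con 0ℚ :+ con 0ℚ)) refl)
      ΣL-mean (suc (suc n)) = begin
        ΣL W (T (suc (suc n))) ≡⟨ ΣL-top W d n ⟩
        ΣL (λ cs → W (0 ∷ cs)) (T (suc n)) + Σ< d (λ i → ΣL (λ cs → W (suc i ∷ 0 ∷ cs)) (T n))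
          ≡⟨ cong₂ _+_ (trans (ΣL-cong (T (suc n)) (λ {cs} _ → W-mono cs)) (ΣL-mean (suc n))) (Σ<-cong d dimer) ⟩
        C₁ * M + Σ< d (λ i → C₀ * m n + C₀ * φ n (suc i))
          ≡⟨ cong (C₁ * M +_) (trans (Σ<-+ d (λ _ → C₀ * m n) (λ i → C₀ * φ n (suc i)))
               (cong₂ _+_ (Σ<-const d (C₀ * m n)) (trans (Σ<-* d C₀ (λ i → φ n (suc i))) (cong (C₀ *_) (sym (average n)))))) ⟩
        C₁ * M + (dq * (C₀ * m n) + C₀ * (dq * φ̄ n))
          ≡⟨ solve 6 (λ C₁ C₀ m u e f → C₁ :* (m :+ u) :+ (e :* (C₀ :* m) :+ C₀ :* (e :* f)) :=
               (C₁ :+ e :* C₀) :* (m :+ u) :+ e :* C₀ :* (f :- u)) refl C₁ C₀ (m n) (δ φ̄ n) dq (φ̄ n) ⟩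
        (C₁ + dq * C₀) * M + dq * C₀ * (φ̄ n - δ φ̄ n)
          ≡⟨ cong₂ (λ x y → x * M + y * (φ̄ n - δ φ̄ n)) (sym (count-top d n)) dC₀ ⟩
        C₂ * M + q (suc n) * C₂ * (φ̄ n - δ φ̄ n)
          ≡⟨ solve 4 (λ C M q f → C :* M :+ q :* C :* f := C :* (M :+ q :* f)) refl C₂ M (q (suc n)) (φ̄ n - δ φ̄ n) ⟩
        C₂ * m (suc (suc n)) ∎
        where
        open ≡-Reasoning
        C₀ = count (T n)
        C₁ = count (T (suc n))
        C₂ = count (T (suc (suc n)))
        M = m (suc n)
        dimer : ∀ i → ΣL (λ cs → W (suc i ∷ 0 ∷ cs)) (T n) ≡ C₀ * m n + C₀ * φ n (suc i)
        dimer i = trans (ΣL-cong (T n) (W-dimer-on n (suc i)))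
          (trans (ΣL-+ W (λ _ → φ n (suc i)) (T n)) (cong₂ _+_ (ΣL-mean n) (ΣL-const (φ n (suc i)) (T n))))
        dC₀ : dq * C₀ ≡ q (suc n) * C₂
        dC₀ = begin
          dq * C₀ ≡⟨ cong (dq *_) (count-tilings n) ⟩
          dq * tilingCount n ≡⟨ solve 2 (λ a b → b := a :+ b :- a) refl (tilingCount (suc n)) (dq * tilingCount n) ⟩
          tilingCount (suc n) + dq * tilingCount n - tilingCount (suc n)
            ≡⟨ cong₂ _-_ (sym (tilingCount-rec n)) (sym (ratio-* (suc n))) ⟩
          tilingCount (suc (suc n)) - ratio (suc n) * tilingCount (suc (suc n))
            ≡⟨ solve 2 (λ s c → c :- s :* c := (con 1ℚ :- s) :* c) refl (ratio (suc n)) (tilingCount (suc (suc n))) ⟩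
          q (suc n) * tilingCount (suc (suc n)) ≡⟨ cong (q (suc n) *_) (sym (count-tilings (suc (suc n)))) ⟩
          q (suc n) * C₂ ∎

      -- Bounds the shift of the mean caused by fixing the top tile: the weight of one dimer, at
      -- most `B`, and two increments of the mean, at most `dq * B` each.
      spread : ℕ → ℚ
      spread n = B n + (dq * B n + dq * B n)

      0≤spread : ∀ n → 0ℚ ≤ spread n
      0≤spread n = 0≤+ (0≤B n) (0≤+ (0≤* 0≤d (0≤B n)) (0≤* 0≤d (0≤B n)))

      spread-mono : ∀ n → spread n ≤ spread (suc n)
      spread-mono n = +-mono-≤ (B-mono n) (+-mono-≤ (*-monoˡ-≤₀ dq 0≤d (B-mono n)) (*-monoˡ-≤₀ dq 0≤d (B-mono n)))

      spread² : ℕ → ℚ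
      spread² n = spread n * spread n

      0≤spread² : ∀ n → 0ℚ ≤ spread² n
      0≤spread² n = 0≤p² (spread n)

      spread²-mono : ∀ n → spread² n ≤ spread² (suc n)
      spread²-mono n = *-mono-≤₀ (0≤spread (suc n)) (0≤spread n) (spread-mono n) (spread-mono n)

      B-mono₂ : ∀ n → B n ≤ B (suc (suc n))
      B-mono₂ n = ≤-trans (B-mono n) (B-mono (suc n))

      δ≤ : ∀ n → ∣ δ φ̄ n ∣ ≤ dq * B n
      δ≤ = δ-bound φ̄-bound B-mono

      mono-bias : ∀ n → ∣ m (suc n) - m (suc (suc n)) ∣ ≤ spread (suc (suc n))
      mono-bias n = begin
        ∣ m (suc n) - (m (suc n) + δ φ̄ (suc n)) ∣ ≡⟨ cong ∣_∣ (solve 2 (λ m u → m :- (m :+ u) := :- u) refl (m (suc n)) (δ φ̄ (suc n))) ⟩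
        ∣ - δ φ̄ (suc n) ∣ ≡⟨ ∣-p∣≡∣p∣ (δ φ̄ (suc n)) ⟩
        ∣ δ φ̄ (suc n) ∣ ≤⟨ δ≤ (suc n) ⟩
        dq * B (suc n) ≤⟨ *-monoˡ-≤₀ dq 0≤d (B-mono (suc n)) ⟩
        dq * B (suc (suc n)) ≤⟨ diff-≤ (B₂ + dq * B₂) (0≤+ (0≤B _) (0≤* 0≤d (0≤B _)))
             (solve 2 (λ e b → b :+ (e :* b :+ e :* b) := e :* b :+ (b :+ e :* b)) refl dq B₂) ⟩
        spread (suc (suc n)) ∎
        where
        open ≤-Reasoning
        B₂ = B (suc (suc n))

      dimer-bias : ∀ n a → a ℕ.≤ d → ∣ m n + φ n a - m (suc (suc n)) ∣ ≤ spread (suc (suc n))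
      dimer-bias n a a≤d = begin
        ∣ m n + φ n a - (m n + u + v) ∣ ≡⟨ cong ∣_∣ (solve 4 (λ m f u v → m :+ f :- (m :+ u :+ v) := f :- (u :+ v)) refl (m n) (φ n a) u v) ⟩
        ∣ φ n a - (u + v) ∣ ≤⟨ ∣-∣≤ {φ n a} {u + v} (φ-bound n a a≤d) (∣+∣≤ {u} {v} (δ≤ n) (δ≤ (suc n))) ⟩
        B n + (dq * B n + dq * B (suc n)) ≤⟨ +-mono-≤ (B-mono₂ n) (+-mono-≤ (*-monoˡ-≤₀ dq 0≤d (B-mono₂ n)) (*-monoˡ-≤₀ dq 0≤d (B-mono (suc n)))) ⟩
        spread (suc (suc n)) ∎
        where
        open ≤-Reasoning
        u = δ φ̄ n
        v = δ φ̄ (suc n)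

      square-≤ : ∀ {p c} → ∣ p ∣ ≤ c → p * p ≤ c * c
      square-≤ {p} le = subst (_≤ _) (∣p∣²≡p² p) (*-mono-≤₀ (≤-trans (0≤∣p∣ p) le) (0≤∣p∣ p) le le)

      -- Given any single top tile, the mean is within `spread` of the mean of all tilings, so the
      -- same holds for every set of admissible top letters.
      top-bias : ∀ b n → b ℕ.≤ d →
        ∣ ΣL (λ cs → W cs - m (suc (suc n))) (topTilings d b n) ∣ ≤ count (topTilings d b n) * spread (suc (suc n))
      top-bias b n b≤d = begin
        ∣ ΣL (λ cs → W cs - μ) (topTilings d b n) ∣ ≡⟨ cong ∣_∣ (ΣL-top (λ cs → W cs - μ) b n) ⟩
        ∣ ΣL (λ cs → W (0 ∷ cs) - μ) (T (suc n)) + Σ< b (λ i → ΣL (λ cs → W (suc i ∷ 0 ∷ cs) - μ) (T n)) ∣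
          ≡⟨ cong ∣_∣ (cong₂ _+_ mono (Σ<-cong b dimer)) ⟩
        ∣ C₁ * (m (suc n) - μ) + Σ< b (λ i → C₀ * (m n + φ n (suc i) - μ)) ∣
          ≤⟨ ∣+∣≤ {C₁ * (m (suc n) - μ)} {Σ< b (λ i → C₀ * (m n + φ n (suc i) - μ))}
               (scaled (0≤count (T (suc n))) (mono-bias n))
               (≤-trans (Σ<-abs b (λ i → C₀ * (m n + φ n (suc i) - μ)))
                 (≤-trans (Σ<-mono-< b (λ i i<b → scaled (0≤count (T n)) (dimer-bias n (suc i) (ℕP.≤-trans i<b b≤d))))
                   (≤-reflexive (Σ<-const b (C₀ * S))))) ⟩
        C₁ * S + ℕ→ℚ b * (C₀ * S) ≡⟨ solve 4 (λ a b c s → a :* s :+ b :* (c :* s) := (a :+ b :* c) :* s) refl C₁ (ℕ→ℚ b) C₀ S ⟩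
        (C₁ + ℕ→ℚ b * C₀) * S ≡⟨ cong (_* S) (sym (count-top b n)) ⟩
        count (topTilings d b n) * S ∎
        where
        open ≤-Reasoning
        μ = m (suc (suc n))
        S = spread (suc (suc n))
        C₀ = count (T n)
        C₁ = count (T (suc n))
        scaled : ∀ {c p s} → 0ℚ ≤ c → ∣ p ∣ ≤ s → ∣ c * p ∣ ≤ c * s
        scaled {c} {p} 0≤c le = ∣*∣≤ {c} {p} (≤-reflexive (0≤p⇒∣p∣≡p 0≤c)) le
        mono : ΣL (λ cs → W (0 ∷ cs) - μ) (T (suc n)) ≡ C₁ * (m (suc n) - μ)
        mono = trans (ΣL-cong (T (suc n)) (λ {cs} _ → cong (_- μ) (W-mono cs)))
          (trans (ΣL-center W μ (T (suc n))) (trans (cong (_- C₁ * μ) (ΣL-mean (suc n)))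
            (solve 3 (λ c m μ → c :* m :- c :* μ := c :* (m :- μ)) refl C₁ (m (suc n)) μ)))
        dimer : ∀ i → ΣL (λ cs → W (suc i ∷ 0 ∷ cs) - μ) (T n) ≡ C₀ * (m n + φ n (suc i) - μ)
        dimer i = trans (ΣL-cong (T n) (λ {cs} p → trans (cong (_- μ) (W-dimer-on n (suc i) p))
              (solve 3 (λ w f μ → w :+ f :- μ := w :- (μ :- f)) refl (W cs) (φ n (suc i)) μ)))
          (trans (ΣL-center W (μ - φ n (suc i)) (T n)) (trans (cong (_- C₀ * (μ - φ n (suc i))) (ΣL-mean n))
            (solve 4 (λ c m f μ → c :* m :- c :* (μ :- f) := c :* (m :+ f :- μ)) refl C₀ (m n) (φ n (suc i)) μ)))

      centered² : ℚ → List ℕ → ℚ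
      centered² μ cs = (W cs - μ) * (W cs - μ)

      VarianceBound : ℕ → Set
      VarianceBound n = ΣL (centered² (m n)) (T n) ≤ count (T n) * (ℕ→ℚ n * spread² n)

      -- Law of total variance: within each class of top tile the induction hypothesis bounds the
      -- variance about the mean of the class, and moving the centre adds the square of a bias. Each
      -- step thus costs one `spread²`. A general `b` serves the induction and the restricted words
      -- alike.
      variance-step : ∀ b n → b ℕ.≤ d → VarianceBound n → VarianceBound (suc n) →
        ΣL (centered² (m (suc (suc n)))) (topTilings d b n) ≤ count (topTilings d b n) * (ℕ→ℚ (suc (suc n)) * spread² (suc (suc n)))
      variance-step b n b≤d var₀ var₁ = begin
        ΣL (centered² μ) (topTilings d b n) ≡⟨ ΣL-top (centered² μ) b n ⟩
        ΣL (λ cs → centered² μ (0 ∷ cs)) (T (suc n)) + Σ< b (λ i → ΣL (λ cs → centered² μ (suc i ∷ 0 ∷ cs)) (T n))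
          ≤⟨ +-mono-≤ mono (≤-trans (Σ<-mono-< b dimer) (≤-reflexive (Σ<-const b (C₀ * (N * S))))) ⟩
        C₁ * (N * S) + ℕ→ℚ b * (C₀ * (N * S))
          ≡⟨ solve 4 (λ a b c s → a :* s :+ b :* (c :* s) := (a :+ b :* c) :* s) refl C₁ (ℕ→ℚ b) C₀ (N * S) ⟩
        (C₁ + ℕ→ℚ b * C₀) * (N * S) ≡⟨ cong (_* (N * S)) (sym (count-top b n)) ⟩
        count (topTilings d b n) * (N * S) ∎
        where
        open ≤-Reasoning
        μ = m (suc (suc n))
        S = spread² (suc (suc n))
        N = ℕ→ℚ (suc (suc n))
        C₀ = count (T n)
        C₁ = count (T (suc n))
        add : ∀ {c v k s t} → 0ℚ ≤ c → v ≤ c * (k * s) → s ≤ S → t ≤ S → 0ℚ ≤ k → 1ℚ + k ≤ N → v + c * t ≤ c * (N * S)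
        add {c} {v} {k} {s} {t} 0≤c v≤ s≤ t≤ 0≤k k≤ = begin
          v + c * t ≤⟨ +-mono-≤ (≤-trans v≤ (*-monoˡ-≤₀ c 0≤c (*-monoˡ-≤₀ k 0≤k s≤))) (*-monoˡ-≤₀ c 0≤c t≤) ⟩
          c * (k * S) + c * S ≡⟨ solve 3 (λ c k S → c :* (k :* S) :+ c :* S := c :* ((con 1ℚ :+ k) :* S)) refl c k S ⟩
          c * ((1ℚ + k) * S) ≤⟨ *-monoˡ-≤₀ c 0≤c (*-monoʳ-≤₀ S (0≤spread² (suc (suc n))) k≤) ⟩
          c * (N * S) ∎
        mono : ΣL (λ cs → centered² μ (0 ∷ cs)) (T (suc n)) ≤ C₁ * (N * S)
        mono = ≤-trans (≤-reflexive (trans (ΣL-cong (T (suc n)) (λ {cs} _ → cong (λ z → (z - μ) * (z - μ)) (W-mono cs)))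
            (ΣL-recenter W (m (suc n)) μ (T (suc n)) (ΣL-mean (suc n)))))
          (add (0≤count (T (suc n))) var₁ (spread²-mono (suc n)) (square-≤ (mono-bias n))
            (0≤ℕ→ℚ (suc n)) (≤-reflexive (sym (ℕ→ℚ-suc (suc n)))))
        dimer : ∀ i → i ℕ.< b → ΣL (λ cs → centered² μ (suc i ∷ 0 ∷ cs)) (T n) ≤ C₀ * (N * S)
        dimer i i<b = ≤-trans (≤-reflexive (trans (ΣL-cong (T n) (λ {cs} p → cong (λ z → z * z) (trans (cong (_- μ) (W-dimer-on n (suc i) p))
              (solve 3 (λ w f μ → w :+ f :- μ := w :- (μ :- f)) refl (W cs) (φ n (suc i)) μ))))
            (ΣL-recenter W (m n) (μ - φ n (suc i)) (T n) (ΣL-mean n))))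
          (add (0≤count (T n)) var₀ (≤-trans (spread²-mono n) (spread²-mono (suc n)))
            (square-≤ (≤-trans (≤-reflexive (cong ∣_∣ (solve 3 (λ m f μ → m :- (μ :- f) := m :+ f :- μ) refl (m n) (φ n (suc i)) μ)))
              (dimer-bias n (suc i) (ℕP.≤-trans i<b b≤d))))
            (0≤ℕ→ℚ n) (≤-trans (≤-reflexive (sym (ℕ→ℚ-suc n))) (ℕ→ℚ-mono (ℕP.n≤1+n (suc n)))))

      variance : ∀ n → VarianceBound n
      variance zero = ≤-reflexive (trans (cong (λ z → (z - 0ℚ) * (z - 0ℚ) + 0ℚ) W-[]) (sym (trans (*-identityˡ _) (*-zeroˡ (spread² 0)))))
      variance (suc zero) = ≤-trans (≤-reflexive (cong (λ z → (z - 0ℚ) * (z - 0ℚ) + 0ℚ) (trans (W-mono []) W-[])))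
        (0≤* 0≤1 (0≤* 0≤1 (0≤spread² 1)))
      variance (suc (suc n)) = variance-step d n ℕP.≤-refl (variance n) (variance (suc n))

      top-variance : ∀ b n → b ℕ.≤ d →
        ΣL (centered² (m (suc (suc n)))) (topTilings d b n) ≤ count (topTilings d b n) * (ℕ→ℚ (suc (suc n)) * spread² (suc (suc n)))
      top-variance b n b≤d = variance-step b n b≤d (variance n) (variance (suc n))

  -- Concentration

  -- The n-th family consists of objects of size n + 2.
  ε : ℕ → ℚ
  ε n = inv (suc n)

  0≤ε : ∀ n → 0ℚ ≤ ε n
  0≤ε n = 0≤inv (suc n)

  ε²≤ε : ∀ n → ε n * ε n ≤ ε n
  ε²≤ε n = ≤-trans (*-monoˡ-≤₀ (ε n) (0≤ε n) (inv≤1 (suc n))) (≤-reflexive (*-identityʳ (ε n)))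

  conv-bounded : ∀ z → Conv z → Bounded z
  conv-bounded z (C , 0≤C , h) = C * (1ℚ + 1ℚ) + ∣ z 0 ∣ , λ n → begin
    ∣ z n ∣ ≡⟨ cong ∣_∣ (solve 2 (λ a b → a := (a :- b) :+ b) refl (z n) (z 0)) ⟩
    ∣ (z n - z 0) + z 0 ∣ ≤⟨ ∣+∣≤ {z n - z 0} {z 0} (≤-trans (h n 0) (*-monoˡ-≤₀ C 0≤C (+-mono-≤ (inv≤1 n) (inv≤1 0)))) ≤-refl ⟩
    C * (1ℚ + 1ℚ) + ∣ z 0 ∣ ∎
    where open ≤-Reasoning

  conv-const : ∀ c → Conv (λ _ → c)
  conv-const c = 0ℚ , ≤-refl , λ i j → ≤-reflexive (trans (cong ∣_∣ (+-inverseʳ c)) (sym (*-zeroˡ (inv i + inv j))))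

  conv-+ : ∀ z z' → Conv z → Conv z' → Conv (λ i → z i + z' i)
  conv-+ z z' (C , 0≤C , h) (C' , 0≤C' , h') = C + C' , 0≤+ 0≤C 0≤C' , λ i j → subst₂ _≤_
    (cong ∣_∣ (solve 4 (λ a b a' b' → (a :- b) :+ (a' :- b') := a :+ a' :- (b :+ b')) refl (z i) (z j) (z' i) (z' j)))
    (sym (*-distribʳ-+ (inv i + inv j) C C'))
    (∣+∣≤ {z i - z j} {z' i - z' j} (h i j) (h' i j))

  conv-* : ∀ z z' → Conv z → Conv z' → Conv (λ i → z i * z' i)
  conv-* z z' cz@(C , 0≤C , h) cz'@(C' , 0≤C' , h') = M * C' + M' * C , 0≤+ (0≤* 0≤M 0≤C') (0≤* 0≤M' 0≤C) , λ i j → subst₂ _≤_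
    (cong ∣_∣ (solve 4 (λ a b a' b' → a :* (a' :- b') :+ b' :* (a :- b) := a :* a' :- b :* b') refl (z i) (z j) (z' i) (z' j)))
    (solve 5 (λ M C' M' C e → M :* (C' :* e) :+ M' :* (C :* e) := (M :* C' :+ M' :* C) :* e) refl M C' M' C (inv i + inv j))
    (∣+∣≤ {z i * (z' i - z' j)} {z' j * (z i - z j)}
      (∣*∣≤ {z i} {z' i - z' j} (proj₂ (conv-bounded z cz) i) (h' i j))
      (∣*∣≤ {z' j} {z i - z j} (proj₂ (conv-bounded z' cz') j) (h i j)))
    where
    M = proj₁ (conv-bounded z cz)
    M' = proj₁ (conv-bounded z' cz')
    0≤M = ≤-trans (0≤∣p∣ (z 0)) (proj₂ (conv-bounded z cz) 0)
    0≤M' = ≤-trans (0≤∣p∣ (z' 0)) (proj₂ (conv-bounded z' cz') 0)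

  conv-suc : ∀ z → Conv z → Conv (z ∘ suc)
  conv-suc z (C , 0≤C , h) = C , 0≤C , λ i j → ≤-trans (h (suc i) (suc j))
    (*-monoˡ-≤₀ C 0≤C (+-mono-≤ (inv-antitone (ℕP.n≤1+n i)) (inv-antitone (ℕP.n≤1+n j))))

  square-+-≤ : ∀ p q → (p + q) * (p + q) ≤ (1ℚ + 1ℚ) * (p * p + q * q)
  square-+-≤ p q = diff-≤ ((p - q) * (p - q)) (0≤p² (p - q))
    (solve 2 (λ p q → (con 1ℚ :+ con 1ℚ) :* (p :* p :+ q :* q) := (p :+ q) :* (p :+ q) :+ (p :- q) :* (p :- q)) refl p q)

  ∣product∣≤ : ∀ p q → ∣ p * q ∣ ≤ p * p + q * q
  ∣product∣≤ p q = ≤-trans (≤-reflexive (∣p*q∣≡∣p∣*∣q∣ p q)) (≤-trans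
    (diff-≤ ((a - b) * (a - b) + a * b) (0≤+ (0≤p² (a - b)) (0≤* (0≤∣p∣ p) (0≤∣p∣ q)))
      (solve 2 (λ a b → a :* a :+ b :* b := a :* b :+ ((a :- b) :* (a :- b) :+ a :* b)) refl a b))
    (≤-reflexive (cong₂ _+_ (∣p∣²≡p² p) (∣p∣²≡p² q))))
    where
    a = ∣ p ∣
    b = ∣ q ∣

  module Concentration {A : Set} (L : ℕ → List A) where

    -- Sums are compared with multiples of `count`, so nothing is divided by the number of objects.
    -- The uniform bound `w-≤` serves the variance of products.
    record Concentrates (w : ℕ → A → ℚ) : Set where
      field
        z      : ℕ → ℚ
        z-conv : Conv z
        Cw     : ℚ
        w-≤    : ∀ n {x} → x ∈ L n → ∣ w n x ∣ ≤ Cw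
        Cb     : ℚ
        bias   : ∀ n → ∣ ΣL (λ x → w n x - z n) (L n) ∣ ≤ count (L n) * (Cb * ε n)
        Cv     : ℚ
        var    : ∀ n → ΣL (λ x → (w n x - z n) * (w n x - z n)) (L n) ≤ count (L n) * (Cv * ε n)

      Cz : ℚ
      Cz = proj₁ (conv-bounded z z-conv)

      z-≤ : ∀ n → ∣ z n ∣ ≤ Cz
      z-≤ = proj₂ (conv-bounded z z-conv)

    ΣL-zero : ∀ f xs → (∀ {x} → x ∈ xs → f x ≡ 0ℚ) → ΣL {A} f xs ≡ 0ℚ
    ΣL-zero f xs eq = trans (ΣL-cong xs eq) (trans (ΣL-const 0ℚ xs) (*-zeroʳ (count xs)))

    concentrates-const : ∀ c → Concentrates (λ _ _ → c)
    concentrates-const c = record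
      { z = λ _ → c
      ; z-conv = conv-const c
      ; Cw = ∣ c ∣
      ; w-≤ = λ _ _ → ≤-refl
      ; Cb = 0ℚ
      ; bias = λ n → ≤-reflexive (trans (cong ∣_∣ (ΣL-zero (λ _ → c - c) (L n) (λ _ → +-inverseʳ c))) (sym (zero-bound n)))
      ; Cv = 0ℚ
      ; var = λ n → ≤-reflexive (trans (ΣL-zero (λ _ → (c - c) * (c - c)) (L n)
          (λ _ → solve 1 (λ c → (c :- c) :* (c :- c) := con 0ℚ) refl c)) (sym (zero-bound n)))
      }
      where
      zero-bound : ∀ n → count (L n) * (0ℚ * ε n) ≡ 0ℚ
      zero-bound n = solve 2 (λ c e → c :* (con 0ℚ :* e) := con 0ℚ) refl (count (L n)) (ε n)

    concentrates-cong : ∀ {w w'} → (∀ n {x} → x ∈ L n → w n x ≡ w' n x) → Concentrates w → Concentrates w'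
    concentrates-cong {w} {w'} eq con-w = record
      { z = z
      ; z-conv = z-conv
      ; Cw = Cw
      ; w-≤ = λ n p → subst (λ y → ∣ y ∣ ≤ Cw) (eq n p) (w-≤ n p)
      ; Cb = Cb
      ; bias = λ n → subst (λ y → ∣ y ∣ ≤ count (L n) * (Cb * ε n)) (ΣL-cong (L n) (λ p → cong (_- z n) (eq n p))) (bias n)
      ; Cv = Cv
      ; var = λ n → subst (_≤ count (L n) * (Cv * ε n)) (ΣL-cong (L n) (λ p → cong (λ y → (y - z n) * (y - z n)) (eq n p))) (var n)
      }
      where open Concentrates con-w

    concentrates-+ : ∀ {w w'} → Concentrates w → Concentrates w' → Concentrates (λ n x → w n x + w' n x)
    concentrates-+ {w} {w'} con-w con-w' = record
      { z = λ n → z n + z' n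
      ; z-conv = conv-+ z z' z-conv z-conv'
      ; Cw = Cw + Cw'
      ; w-≤ = λ n {x} p → ∣+∣≤ {w n x} {w' n x} (w-≤ n p) (w-≤' n p)
      ; Cb = Cb + Cb'
      ; bias = bias''
      ; Cv = (1ℚ + 1ℚ) * (Cv + Cv')
      ; var = var''
      }
      where
      open Concentrates con-w
      open Concentrates con-w' renaming (z to z'; z-conv to z-conv'; Cw to Cw'; w-≤ to w-≤'; Cb to Cb'; bias to bias'; Cv to Cv'; var to var'; Cz to Cz'; z-≤ to z-≤')
      split : ∀ n x → w n x + w' n x - (z n + z' n) ≡ (w n x - z n) + (w' n x - z' n)
      split n x = solve 4 (λ a b a' b' → a :+ a' :- (b :+ b') := (a :- b) :+ (a' :- b')) refl (w n x) (z n) (w' n x) (z' n)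
      bias'' : ∀ n → ∣ ΣL (λ x → w n x + w' n x - (z n + z' n)) (L n) ∣ ≤ count (L n) * ((Cb + Cb') * ε n)
      bias'' n = subst₂ _≤_
        (cong ∣_∣ (sym (trans (ΣL-cong (L n) (λ {x} _ → split n x)) (ΣL-+ (λ x → w n x - z n) (λ x → w' n x - z' n) (L n)))))
        (solve 4 (λ c a b e → c :* (a :* e) :+ c :* (b :* e) := c :* ((a :+ b) :* e)) refl (count (L n)) Cb Cb' (ε n))
        (∣+∣≤ {ΣL (λ x → w n x - z n) (L n)} {ΣL (λ x → w' n x - z' n) (L n)} (bias n) (bias' n))
      var'' : ∀ n → ΣL (λ x → (w n x + w' n x - (z n + z' n)) * (w n x + w' n x - (z n + z' n))) (L n)
                  ≤ count (L n) * ((1ℚ + 1ℚ) * (Cv + Cv') * ε n)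
      var'' n = begin
        ΣL (λ x → (w n x + w' n x - (z n + z' n)) * (w n x + w' n x - (z n + z' n))) (L n)
          ≤⟨ ΣL-mono (L n) (λ {x} _ → ≤-trans (≤-reflexive (cong (λ y → y * y) (split n x))) (square-+-≤ (w n x - z n) (w' n x - z' n))) ⟩
        ΣL (λ x → (1ℚ + 1ℚ) * (v n x + v' n x)) (L n)
          ≡⟨ trans (ΣL-* (1ℚ + 1ℚ) (λ x → v n x + v' n x) (L n)) (cong ((1ℚ + 1ℚ) *_) (ΣL-+ (v n) (v' n) (L n))) ⟩
        (1ℚ + 1ℚ) * (ΣL (v n) (L n) + ΣL (v' n) (L n)) ≤⟨ *-monoˡ-≤₀ (1ℚ + 1ℚ) (0≤+ 0≤1 0≤1) (+-mono-≤ (var n) (var' n)) ⟩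
        (1ℚ + 1ℚ) * (count (L n) * (Cv * ε n) + count (L n) * (Cv' * ε n))
          ≡⟨ solve 5 (λ t c a b e → t :* (c :* (a :* e) :+ c :* (b :* e)) := c :* (t :* (a :+ b) :* e)) refl (1ℚ + 1ℚ) (count (L n)) Cv Cv' (ε n) ⟩
        count (L n) * ((1ℚ + 1ℚ) * (Cv + Cv') * ε n) ∎
        where
        open ≤-Reasoning
        v = λ n x → (w n x - z n) * (w n x - z n)
        v' = λ n x → (w' n x - z' n) * (w' n x - z' n)

    -- w w' - z z' = (w - z)(w' - z') + z (w' - z') + z' (w - z), and the first term has mean O(1/n).
    concentrates-* : ∀ {w w'} → Concentrates w → Concentrates w' → Concentrates (λ n x → w n x * w' n x)
    concentrates-* {w} {w'} con-w con-w' = record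
      { z = λ n → z n * z' n
      ; z-conv = conv-* z z' z-conv z-conv'
      ; Cw = Cw * Cw'
      ; w-≤ = λ n {x} p → ∣*∣≤ {w n x} {w' n x} (w-≤ n p) (w-≤' n p)
      ; Cb = Cv + Cv' + Cz * Cb' + Cz' * Cb
      ; bias = bias''
      ; Cv = (1ℚ + 1ℚ) * (Cw * Cw * Cv' + Cz' * Cz' * Cv)
      ; var = var''
      }
      where
      open Concentrates con-w
      open Concentrates con-w' renaming (z to z'; z-conv to z-conv'; Cw to Cw'; w-≤ to w-≤'; Cb to Cb'; bias to bias'; Cv to Cv'; var to var'; Cz to Cz'; z-≤ to z-≤')
      u = λ n x → w n x - z n
      u' = λ n x → w' n x - z' n
      v = λ n x → u n x * u n x
      v' = λ n x → u' n x * u' n x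
      bias'' : ∀ n → ∣ ΣL (λ x → w n x * w' n x - z n * z' n) (L n) ∣ ≤ count (L n) * ((Cv + Cv' + Cz * Cb' + Cz' * Cb) * ε n)
      bias'' n = begin
        ∣ ΣL (λ x → w n x * w' n x - z n * z' n) (L n) ∣
          ≡⟨ cong ∣_∣ (trans (ΣL-cong (L n) (λ {x} _ → solve 4 (λ a b a' b' → a :* a' :- b :* b' :=
               (a :- b) :* (a' :- b') :+ b :* (a' :- b') :+ b' :* (a :- b)) refl (w n x) (z n) (w' n x) (z' n)))
               (trans (ΣL-+ (λ x → u n x * u' n x + z n * u' n x) (λ x → z' n * u n x) (L n))
                 (cong₂ _+_ (trans (ΣL-+ (λ x → u n x * u' n x) (λ x → z n * u' n x) (L n))
                   (cong (ΣL (λ x → u n x * u' n x) (L n) +_) (ΣL-* (z n) (u' n) (L n)))) (ΣL-* (z' n) (u n) (L n))))) ⟩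
        ∣ ΣL (λ x → u n x * u' n x) (L n) + z n * ΣL (u' n) (L n) + z' n * ΣL (u n) (L n) ∣
          ≤⟨ ∣+∣≤ {ΣL (λ x → u n x * u' n x) (L n) + z n * ΣL (u' n) (L n)} {z' n * ΣL (u n) (L n)}
               (∣+∣≤ {ΣL (λ x → u n x * u' n x) (L n)} {z n * ΣL (u' n) (L n)} cross
                 (∣*∣≤ {z n} {ΣL (u' n) (L n)} (z-≤ n) (bias' n)))
               (∣*∣≤ {z' n} {ΣL (u n) (L n)} (z-≤' n) (bias n)) ⟩
        N * (Cv * e) + N * (Cv' * e) + Cz * (N * (Cb' * e)) + Cz' * (N * (Cb * e))
          ≡⟨ solve 8 (λ N e a a' c b' c' b → N :* (a :* e) :+ N :* (a' :* e) :+ c :* (N :* (b' :* e)) :+ c' :* (N :* (b :* e)) :=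
               N :* ((a :+ a' :+ c :* b' :+ c' :* b) :* e)) refl N e Cv Cv' Cz Cb' Cz' Cb ⟩
        N * ((Cv + Cv' + Cz * Cb' + Cz' * Cb) * e) ∎
        where
        open ≤-Reasoning
        N = count (L n)
        e = ε n
        cross : ∣ ΣL (λ x → u n x * u' n x) (L n) ∣ ≤ N * (Cv * e) + N * (Cv' * e)
        cross = begin
          ∣ ΣL (λ x → u n x * u' n x) (L n) ∣ ≤⟨ ΣL-abs (λ x → u n x * u' n x) (L n) ⟩
          ΣL (λ x → ∣ u n x * u' n x ∣) (L n) ≤⟨ ΣL-mono (L n) (λ {x} _ → ∣product∣≤ (u n x) (u' n x)) ⟩
          ΣL (λ x → v n x + v' n x) (L n) ≡⟨ ΣL-+ (v n) (v' n) (L n) ⟩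
          ΣL (v n) (L n) + ΣL (v' n) (L n) ≤⟨ +-mono-≤ (var n) (var' n) ⟩
          N * (Cv * e) + N * (Cv' * e) ∎
      square-*-≤ : ∀ {p c} s → ∣ p ∣ ≤ c → (p * s) * (p * s) ≤ c * c * (s * s)
      square-*-≤ {p} {c} s le = ≤-trans
        (≤-reflexive (trans (solve 2 (λ p s → (p :* s) :* (p :* s) := (p :* p) :* (s :* s)) refl p s) (cong (_* (s * s)) (sym (∣p∣²≡p² p)))))
        (*-monoʳ-≤₀ (s * s) (0≤p² s) (*-mono-≤₀ (≤-trans (0≤∣p∣ p) le) (0≤∣p∣ p) le le))
      var'' : ∀ n → ΣL (λ x → (w n x * w' n x - z n * z' n) * (w n x * w' n x - z n * z' n)) (L n)
                  ≤ count (L n) * ((1ℚ + 1ℚ) * (Cw * Cw * Cv' + Cz' * Cz' * Cv) * ε n)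
      var'' n = begin
        ΣL (λ x → (w n x * w' n x - z n * z' n) * (w n x * w' n x - z n * z' n)) (L n)
          ≤⟨ ΣL-mono (L n) pointwise ⟩
        ΣL (λ x → two * (P * v' n x + Q * v n x)) (L n)
          ≡⟨ trans (ΣL-* two (λ x → P * v' n x + Q * v n x) (L n)) (cong (two *_)
               (trans (ΣL-+ (λ x → P * v' n x) (λ x → Q * v n x) (L n)) (cong₂ _+_ (ΣL-* P (v' n) (L n)) (ΣL-* Q (v n) (L n))))) ⟩
        two * (P * ΣL (v' n) (L n) + Q * ΣL (v n) (L n))
          ≤⟨ *-monoˡ-≤₀ two (0≤+ 0≤1 0≤1) (+-mono-≤ (*-monoˡ-≤₀ P (0≤p² Cw) (var' n)) (*-monoˡ-≤₀ Q (0≤p² Cz') (var n))) ⟩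
        two * (P * (N * (Cv' * e)) + Q * (N * (Cv * e)))
          ≡⟨ solve 7 (λ t P Q N a b e → t :* (P :* (N :* (a :* e)) :+ Q :* (N :* (b :* e))) := N :* (t :* (P :* a :+ Q :* b) :* e))
               refl two P Q N Cv' Cv e ⟩
        N * (two * (P * Cv' + Q * Cv) * e) ∎
        where
        open ≤-Reasoning
        N = count (L n)
        e = ε n
        two = 1ℚ + 1ℚ
        P = Cw * Cw
        Q = Cz' * Cz'
        -- For the variance the splitting is `w * u' + z' * u` with bounded coefficients; squaring
        -- the product `u * u'` of the other splitting would call for fourth moments.
        pointwise : ∀ {x} → x ∈ L n → (w n x * w' n x - z n * z' n) * (w n x * w' n x - z n * z' n) ≤ two * (P * v' n x + Q * v n x)
        pointwise {x} p = begin
          (w n x * w' n x - z n * z' n) * (w n x * w' n x - z n * z' n)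
            ≡⟨ cong (λ y → y * y) (solve 4 (λ a b a' b' → a :* a' :- b :* b' := a :* (a' :- b') :+ b' :* (a :- b)) refl (w n x) (z n) (w' n x) (z' n)) ⟩
          (w n x * u' n x + z' n * u n x) * (w n x * u' n x + z' n * u n x) ≤⟨ square-+-≤ (w n x * u' n x) (z' n * u n x) ⟩
          two * ((w n x * u' n x) * (w n x * u' n x) + (z' n * u n x) * (z' n * u n x))
            ≤⟨ *-monoˡ-≤₀ two (0≤+ 0≤1 0≤1) (+-mono-≤ (square-*-≤ (u' n x) (w-≤ n p)) (square-*-≤ (u n x) (z-≤' n))) ⟩
          two * (P * v' n x + Q * v n x) ∎

    power : ℚ → ℕ → ℚ
    power y zero = 1ℚ
    power y (suc k) = y * power y k

    concentrates-^ : ∀ {w} → Concentrates w → ∀ k → Concentrates (λ n x → power (w n x) k)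
    concentrates-^ con-w zero = concentrates-const 1ℚ
    concentrates-^ con-w (suc k) = concentrates-* con-w (concentrates-^ con-w k)

    -- Moves the centre from a mean `c` to a sequence `z` known to converge. The shift adds `K` to
    -- the bias and, since `ε² ≤ ε`, a multiple of `K²` to the variance.
    concentrates-near : ∀ {w} (c z : ℕ → ℚ) (Cw Cb Cv K : ℚ) → Conv z →
      (∀ n {x} → x ∈ L n → ∣ w n x ∣ ≤ Cw) →
      (∀ n → ∣ ΣL (λ x → w n x - c n) (L n) ∣ ≤ count (L n) * (Cb * ε n)) →
      (∀ n → ΣL (λ x → (w n x - c n) * (w n x - c n)) (L n) ≤ count (L n) * (Cv * ε n)) →
      (∀ n → ∣ c n - z n ∣ ≤ K * ε n) → Concentrates w
    concentrates-near {w} c z Cw Cb Cv K z-conv w-≤ bias var near = record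
      { z = z
      ; z-conv = z-conv
      ; Cw = Cw
      ; w-≤ = w-≤
      ; Cb = Cb + K
      ; bias = bias'
      ; Cv = (1ℚ + 1ℚ) * (Cv + K * K)
      ; var = var'
      }
      where
      split : ∀ n x → w n x - z n ≡ (w n x - c n) + (c n - z n)
      split n x = solve 3 (λ w c z → w :- z := (w :- c) :+ (c :- z)) refl (w n x) (c n) (z n)
      bias' : ∀ n → ∣ ΣL (λ x → w n x - z n) (L n) ∣ ≤ count (L n) * ((Cb + K) * ε n)
      bias' n = subst₂ _≤_
        (cong ∣_∣ (sym (trans (ΣL-cong (L n) (λ {x} _ → split n x)) (trans (ΣL-+ (λ x → w n x - c n) (λ _ → c n - z n) (L n))
          (cong (ΣL (λ x → w n x - c n) (L n) +_) (ΣL-const (c n - z n) (L n)))))))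
        (solve 4 (λ N b k e → N :* (b :* e) :+ N :* (k :* e) := N :* ((b :+ k) :* e)) refl (count (L n)) Cb K (ε n))
        (∣+∣≤ {ΣL (λ x → w n x - c n) (L n)} {count (L n) * (c n - z n)} (bias n)
          (∣*∣≤ {count (L n)} {c n - z n} (≤-reflexive (0≤p⇒∣p∣≡p (0≤count (L n)))) (near n)))
      shift² : ∀ n → (c n - z n) * (c n - z n) ≤ K * K * ε n
      shift² n = begin
        (c n - z n) * (c n - z n) ≡⟨ sym (∣p∣²≡p² (c n - z n)) ⟩
        ∣ c n - z n ∣ * ∣ c n - z n ∣ ≤⟨ *-mono-≤₀ (≤-trans (0≤∣p∣ (c n - z n)) (near n)) (0≤∣p∣ (c n - z n)) (near n) (near n) ⟩
        (K * ε n) * (K * ε n) ≡⟨ solve 2 (λ k e → (k :* e) :* (k :* e) := k :* k :* (e :* e)) refl K (ε n) ⟩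
        K * K * (ε n * ε n) ≤⟨ *-monoˡ-≤₀ (K * K) (0≤p² K) (ε²≤ε n) ⟩
        K * K * ε n ∎
        where open ≤-Reasoning
      var' : ∀ n → ΣL (λ x → (w n x - z n) * (w n x - z n)) (L n) ≤ count (L n) * ((1ℚ + 1ℚ) * (Cv + K * K) * ε n)
      var' n = begin
        ΣL (λ x → (w n x - z n) * (w n x - z n)) (L n)
          ≤⟨ ΣL-mono (L n) (λ {x} _ → ≤-trans (≤-reflexive (cong (λ y → y * y) (split n x))) (square-+-≤ (w n x - c n) (c n - z n))) ⟩
        ΣL (λ x → two * (v x + t)) (L n)
          ≡⟨ trans (ΣL-* two (λ x → v x + t) (L n)) (cong (two *_) (trans (ΣL-+ v (λ _ → t) (L n)) (cong (ΣL v (L n) +_) (ΣL-const t (L n))))) ⟩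
        two * (ΣL v (L n) + count (L n) * t)
          ≤⟨ *-monoˡ-≤₀ two (0≤+ 0≤1 0≤1) (+-mono-≤ (var n) (*-monoˡ-≤₀ (count (L n)) (0≤count (L n)) (shift² n))) ⟩
        two * (count (L n) * (Cv * ε n) + count (L n) * (K * K * ε n))
          ≡⟨ solve 5 (λ t N a k e → t :* (N :* (a :* e) :+ N :* (k :* e)) := N :* (t :* (a :+ k) :* e)) refl two (count (L n)) Cv (K * K) (ε n) ⟩
        count (L n) * (two * (Cv + K * K) * ε n) ∎
        where
        open ≤-Reasoning
        two = 1ℚ + 1ℚ
        v = λ x → (w n x - c n) * (w n x - c n)
        t = (c n - z n) * (c n - z n)

    -- Meant for the lower-order term `S₃ / 2` of the size, which after division by the square of
    -- the length is half of `ε` times the normalised S₃.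
    concentrates-ε : Concentrates (λ n _ → ε n)
    concentrates-ε = record
      { z = λ _ → 0ℚ
      ; z-conv = conv-const 0ℚ
      ; Cw = 1ℚ
      ; w-≤ = λ n _ → ≤-trans (≤-reflexive (0≤p⇒∣p∣≡p (0≤ε n))) (inv≤1 (suc n))
      ; Cb = 1ℚ
      ; bias = λ n → ≤-reflexive (trans (cong ∣_∣ (ΣL-const (ε n - 0ℚ) (L n)))
          (trans (0≤p⇒∣p∣≡p (0≤* (0≤count (L n)) (subst (0ℚ ≤_) (sym (+-identityʳ (ε n))) (0≤ε n))))
            (solve 2 (λ c e → c :* (e :- con 0ℚ) := c :* (con 1ℚ :* e)) refl (count (L n)) (ε n))))
      ; Cv = 1ℚ
      ; var = λ n → ≤-trans (≤-reflexive (trans (ΣL-const ((ε n - 0ℚ) * (ε n - 0ℚ)) (L n))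
            (solve 2 (λ c e → c :* ((e :- con 0ℚ) :* (e :- con 0ℚ)) := c :* (e :* e)) refl (count (L n)) (ε n))))
          (*-monoˡ-≤₀ (count (L n)) (0≤count (L n)) (≤-trans (ε²≤ε n) (≤-reflexive (sym (*-identityˡ (ε n))))))
      }

  -- Leading terms from a rate of convergence

  module _ {f : ℕ → ℚ} (e : ℕ) {z : ℕ → ℚ} (z-conv : Conv z) (D : ℚ)
    (close : ∀ n → ∣ f (suc (suc n)) - z n * ℕ→ℚ (suc (suc n) ℕ.^ suc e) ∣ ≤ D * ε n * ℕ→ℚ (suc (suc n) ℕ.^ suc e)) where

    private
      C = proj₁ z-conv
      0≤C = proj₁ (proj₂ z-conv)
      K = proj₁ (archimedean C)

      -- Sampling z along K (i + 1) with K ≥ C makes the Cauchy sequence regular.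
      index : ℕ → ℕ
      index i = K ℕ.* suc i

      C*inv-index : ∀ i → C * inv (index i) ≤ inv i
      C*inv-index i = ≤-trans (*-monoʳ-≤₀ (inv (index i)) (0≤inv (index i)) (proj₂ (archimedean C))) (*-cancel-≤ i (begin
        ℕ→ℚ K * v * ℕ→ℚ (suc i) ≡⟨ solve 3 (λ k v s → k :* v :* s := v :* (k :* s)) refl (ℕ→ℚ K) v (ℕ→ℚ (suc i)) ⟩
        v * (ℕ→ℚ K * ℕ→ℚ (suc i)) ≡⟨ cong (v *_) (sym (ℕ→ℚ-* K (suc i))) ⟩
        v * ℕ→ℚ (index i) ≤⟨ *-monoˡ-≤₀ v (0≤inv (index i)) (ℕ→ℚ-mono (ℕP.n≤1+n (index i))) ⟩
        v * ℕ→ℚ (suc (index i)) ≡⟨ inv-* (index i) ⟩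
        1ℚ ≡⟨ sym (inv-* i) ⟩
        inv i * ℕ→ℚ (suc i) ∎))
        where
        open ≤-Reasoning
        v = inv (index i)

      ε-power : ∀ n → ε n * ℕ→ℚ (suc (suc n) ℕ.^ suc e) ≡ ℕ→ℚ (suc (suc n) ℕ.^ e)
      ε-power n = trans (cong (ε n *_) (ℕ→ℚ-* (suc (suc n)) (suc (suc n) ℕ.^ e)))
        (trans (sym (*-assoc (ε n) (ℕ→ℚ (suc (suc n))) (ℕ→ℚ (suc (suc n) ℕ.^ e))))
          (trans (cong (_* ℕ→ℚ (suc (suc n) ℕ.^ e)) (inv-* (suc n))) (*-identityˡ _)))

      ratio-bound : ∀ n i → ∣ z n - z (index i) ∣ ≤ C * inv n + inv i
      ratio-bound n i = begin
        ∣ z n - z (index i) ∣ ≤⟨ proj₂ (proj₂ z-conv) n (index i) ⟩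
        C * (inv n + inv (index i)) ≡⟨ *-distribˡ-+ C (inv n) (inv (index i)) ⟩
        C * inv n + C * inv (index i) ≤⟨ +-monoʳ-≤ (C * inv n) (C*inv-index i) ⟩
        C * inv n + inv i ∎
        where open ≤-Reasoning

    -- Reconciles the rate `1/(n + 1)` of `Conv` with the rate `1/(n + 2)` that belongs to objects
    -- of size `n + 2`.
    inv≤2ε : ∀ n → inv n ≤ (1ℚ + 1ℚ) * ε n
    inv≤2ε n = *-cancel-≤ n (*-cancel-≤ (suc n) (subst₂ _≤_ (sym lhs) (sym rhs) le))
      where
      a = ℕ→ℚ (suc n)
      b = ℕ→ℚ (suc (suc n))
      lhs : inv n * a * b ≡ b
      lhs = trans (cong (_* b) (inv-* n)) (*-identityˡ b)
      rhs : (1ℚ + 1ℚ) * ε n * a * b ≡ (1ℚ + 1ℚ) * a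
      rhs = trans (solve 4 (λ t e a b → t :* e :* a :* b := t :* a :* (e :* b)) refl (1ℚ + 1ℚ) (ε n) a b)
        (trans (cong ((1ℚ + 1ℚ) * a *_) (inv-* (suc n))) (*-identityʳ _))
      le : b ≤ (1ℚ + 1ℚ) * a
      le = ≤-trans (ℕ→ℚ-mono {suc (suc n)} {suc n ℕ.+ suc n} (ℕP.+-monoʳ-≤ 1 (ℕP.m≤n+m (suc n) n)))
        (≤-reflexive (trans (ℕ→ℚ-+ (suc n) (suc n)) (solve 1 (λ a → a :+ a := (con 1ℚ :+ con 1ℚ) :* a) refl a)))

    -- Replacing `z n` by a fixed sample costs `C * inv n + inv i`: the first part joins `D` in the
    -- error of lower order, the second is the tolerance for the approximated constant.
    leadingTerm : HasLeadingTerm f (suc e)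
    leadingTerm = (z ∘ index) , regular , D + C * (1ℚ + 1ℚ) , 2 , bound
      where
      regular : ∀ i j → ∣ z (index i) - z (index j) ∣ ≤ inv i + inv j
      regular i j = ≤-trans (ratio-bound (index i) j) (+-monoˡ-≤ (inv j) (C*inv-index i))
      bound : ∀ n → 2 ℕ.≤ n → ∀ i → ∣ f n - z (index i) * ℕ→ℚ (n ℕ.^ suc e) ∣ ≤
        (D + C * (1ℚ + 1ℚ)) * ℕ→ℚ (n ℕ.^ e) + ℕ→ℚ (n ℕ.^ suc e) * inv i
      bound (suc (suc n)) _ i = begin
        ∣ F - a * u ∣ ≡⟨ cong ∣_∣ (solve 4 (λ F a z u → F :- a :* u := (F :- z :* u) :+ (z :- a) :* u) refl F a (z n) u) ⟩
        ∣ (F - z n * u) + (z n - a) * u ∣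
          ≤⟨ ∣+∣≤ {F - z n * u} {(z n - a) * u} (close n) (∣*∣≤ {z n - a} {u}
               (≤-trans (ratio-bound n i) (+-monoˡ-≤ (inv i) (*-monoˡ-≤₀ C 0≤C (inv≤2ε n))))
               (≤-reflexive (0≤p⇒∣p∣≡p (0≤ℕ→ℚ (N ℕ.^ suc e))))) ⟩
        D * ε n * u + (C * ((1ℚ + 1ℚ) * ε n) + inv i) * u
          ≡⟨ solve 6 (λ D e u C t v → D :* e :* u :+ (C :* (t :* e) :+ v) :* u := (D :+ C :* t) :* (e :* u) :+ u :* v)
               refl D (ε n) u C (1ℚ + 1ℚ) (inv i) ⟩
        (D + C * (1ℚ + 1ℚ)) * (ε n * u) + u * inv i ≡⟨ cong (λ y → (D + C * (1ℚ + 1ℚ)) * y + u * inv i) (ε-power n) ⟩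
        (D + C * (1ℚ + 1ℚ)) * ℕ→ℚ (N ℕ.^ e) + u * inv i ∎
        where
        open ≤-Reasoning
        N = suc (suc n)
        u = ℕ→ℚ (N ℕ.^ suc e)
        F = f N
        a = z (index i)
      bound (suc zero) (ℕ.s≤s ()) i

  -- Moments of the size

  ε-* : ∀ n → ε n * ℕ→ℚ (suc (suc n)) ≡ 1ℚ
  ε-* n = inv-* (suc n)

  module Normalised (d : ℕ) (b : ℕ) (b≤d : b ℕ.≤ d) where

    open Statistics d
    open Concentration (topTilings d b)

    module _ {W φ φ̄ B} (lin : Linear W φ φ̄ B) (κ : ℕ → ℚ) (0≤κ : ∀ n → 0ℚ ≤ κ n) (σ : ℚ)
      (κB : ∀ n → κ n * B (suc (suc n)) ≤ σ * ε n) where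

      open Linear lin
      open Moments lin

      Bound : ℕ → Set
      Bound n = ∀ {cs} → cs ∈ tilings d n → ∣ W cs ∣ ≤ ℕ→ℚ n * B n

      bound-step : ∀ c n → c ℕ.≤ d → Bound n → Bound (suc n) → ∀ {cs} → cs ∈ topTilings d c n →
        ∣ W cs ∣ ≤ ℕ→ℚ (suc (suc n)) * B (suc (suc n))
      bound-step c n c≤d bd₀ bd₁ p with ∈-prepend⁻ c p
      ... | inj₁ (cs , cs∈ , refl) = subst (λ y → ∣ y ∣ ≤ ℕ→ℚ (suc (suc n)) * B (suc (suc n))) (sym (W-mono cs))
        (≤-trans (bd₁ cs∈) (*-mono-≤₀ (0≤ℕ→ℚ (suc (suc n))) (0≤B (suc n)) (ℕ→ℚ-mono (ℕP.n≤1+n (suc n))) (B-mono (suc n))))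
      ... | inj₂ (a , cs , _ , a≤c , cs∈ , refl) = begin
        ∣ W (a ∷ 0 ∷ cs) ∣ ≡⟨ cong ∣_∣ (W-dimer-on n a cs∈) ⟩
        ∣ W cs + φ n a ∣ ≤⟨ ∣+∣≤ {W cs} {φ n a} (bd₀ cs∈) (φ-bound n a (ℕP.≤-trans a≤c c≤d)) ⟩
        ℕ→ℚ n * B n + B n ≡⟨ solve 2 (λ n B → n :* B :+ B := (con 1ℚ :+ n) :* B) refl (ℕ→ℚ n) (B n) ⟩
        (1ℚ + ℕ→ℚ n) * B n ≡⟨ cong (_* B n) (sym (ℕ→ℚ-suc n)) ⟩
        ℕ→ℚ (suc n) * B n ≤⟨ *-mono-≤₀ (0≤ℕ→ℚ (suc (suc n))) (0≤B n) (ℕ→ℚ-mono (ℕP.n≤1+n (suc n))) (B-mono₂ n) ⟩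
        ℕ→ℚ (suc (suc n)) * B (suc (suc n)) ∎
        where open ≤-Reasoning

      bounded : ∀ n → Bound n
      bounded zero (here refl) = ≤-trans (≤-reflexive (cong ∣_∣ W-[])) (0≤* ≤-refl (0≤B 0))
      bounded (suc zero) (here refl) = ≤-trans (≤-reflexive (cong ∣_∣ (trans (W-mono []) W-[]))) (0≤* 0≤1 (0≤B 1))
      bounded (suc (suc n)) = bound-step d n ℕP.≤-refl (bounded n) (bounded (suc n))

      private
        τ = σ + (dq * σ + dq * σ)

      κ-spread : ∀ n → κ n * spread (suc (suc n)) ≤ τ * ε n
      κ-spread n = begin
        κ n * (B₂ + (dq * B₂ + dq * B₂)) ≡⟨ solve 3 (λ k b e → k :* (b :+ (e :* b :+ e :* b)) := k :* b :+ (e :* (k :* b) :+ e :* (k :* b))) refl (κ n) B₂ dq ⟩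
        κ n * B₂ + (dq * (κ n * B₂) + dq * (κ n * B₂)) ≤⟨ +-mono-≤ (κB n) (+-mono-≤ (*-monoˡ-≤₀ dq 0≤d (κB n)) (*-monoˡ-≤₀ dq 0≤d (κB n))) ⟩
        σ * ε n + (dq * (σ * ε n) + dq * (σ * ε n)) ≡⟨ solve 3 (λ s e v → s :* v :+ (e :* (s :* v) :+ e :* (s :* v)) := (s :+ (e :* s :+ e :* s)) :* v) refl σ dq (ε n) ⟩
        τ * ε n ∎
        where
        open ≤-Reasoning
        B₂ = B (suc (suc n))

      -- The scale `κ` is `ε` for bounded tile weights and `ε²` for S₁, whose weights grow linearly.
      -- In both cases `κB` makes a scaled tile `O(1/n)`, so that values are `O(1)`, the bias is
      -- `O(1/n)` and the variance is `n` times `O(1/n²)`.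
      concentrates : (z : ℕ → ℚ) (K : ℚ) → Conv z → (∀ n → ∣ mean φ̄ (suc (suc n)) * κ n - z n ∣ ≤ K * ε n) →
        Concentrates (λ n cs → W cs * κ n)
      concentrates z K z-conv near = concentrates-near (λ n → m (suc (suc n)) * κ n) z σ τ (τ * τ) K z-conv w-≤ bias var near
        where
        m = mean φ̄
        w-≤ : ∀ n {cs} → cs ∈ topTilings d b n → ∣ W cs * κ n ∣ ≤ σ
        w-≤ n {cs} p = begin
          ∣ W cs * κ n ∣ ≤⟨ ∣*∣≤ {W cs} {κ n} (bound-step b n b≤d (bounded n) (bounded (suc n)) p) (≤-reflexive (0≤p⇒∣p∣≡p (0≤κ n))) ⟩
          N * B (suc (suc n)) * κ n ≡⟨ solve 3 (λ N b k → N :* b :* k := N :* (k :* b)) refl N (B (suc (suc n))) (κ n) ⟩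
          N * (κ n * B (suc (suc n))) ≤⟨ *-monoˡ-≤₀ N (0≤ℕ→ℚ (suc (suc n))) (κB n) ⟩
          N * (σ * ε n) ≡⟨ solve 3 (λ N s e → N :* (s :* e) := s :* (e :* N)) refl N σ (ε n) ⟩
          σ * (ε n * N) ≡⟨ trans (cong (σ *_) (ε-* n)) (*-identityʳ σ) ⟩
          σ ∎
          where
          open ≤-Reasoning
          N = ℕ→ℚ (suc (suc n))
        bias : ∀ n → ∣ ΣL (λ cs → W cs * κ n - m (suc (suc n)) * κ n) (topTilings d b n) ∣ ≤ count (topTilings d b n) * (τ * ε n)
        bias n = begin
          ∣ ΣL (λ cs → W cs * κ n - μ * κ n) T ∣
            ≡⟨ cong ∣_∣ (trans (ΣL-cong T (λ {cs} _ → solve 3 (λ w m k → w :* k :- m :* k := k :* (w :- m)) refl (W cs) μ (κ n))) (ΣL-* (κ n) (λ cs → W cs - μ) T)) ⟩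
          ∣ κ n * ΣL (λ cs → W cs - μ) T ∣ ≤⟨ ∣*∣≤ {κ n} {ΣL (λ cs → W cs - μ) T} (≤-reflexive (0≤p⇒∣p∣≡p (0≤κ n))) (top-bias b n b≤d) ⟩
          κ n * (count T * S) ≡⟨ solve 3 (λ k c s → k :* (c :* s) := c :* (k :* s)) refl (κ n) (count T) S ⟩
          count T * (κ n * S) ≤⟨ *-monoˡ-≤₀ (count T) (0≤count T) (κ-spread n) ⟩
          count T * (τ * ε n) ∎
          where
          open ≤-Reasoning
          T = topTilings d b n
          μ = m (suc (suc n))
          S = spread (suc (suc n))
        var : ∀ n → ΣL (λ cs → (W cs * κ n - m (suc (suc n)) * κ n) * (W cs * κ n - m (suc (suc n)) * κ n)) (topTilings d b n)
          ≤ count (topTilings d b n) * (τ * τ * ε n)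
        var n = begin
          ΣL (λ cs → (W cs * κ n - μ * κ n) * (W cs * κ n - μ * κ n)) T
            ≡⟨ trans (ΣL-cong T (λ {cs} _ → solve 3 (λ w m k → (w :* k :- m :* k) :* (w :* k :- m :* k) := (k :* k) :* ((w :- m) :* (w :- m))) refl (W cs) μ (κ n)))
                 (ΣL-* (κ n * κ n) (centered² μ) T) ⟩
          κ n * κ n * ΣL (centered² μ) T ≤⟨ *-monoˡ-≤₀ (κ n * κ n) (0≤p² (κ n)) (top-variance b n b≤d) ⟩
          κ n * κ n * (count T * (N * (S * S))) ≡⟨ solve 4 (λ k c N s → k :* k :* (c :* (N :* (s :* s))) := c :* (N :* ((k :* s) :* (k :* s)))) refl (κ n) (count T) N S ⟩
          count T * (N * ((κ n * S) * (κ n * S))) ≤⟨ *-monoˡ-≤₀ (count T) (0≤count T) (*-monoˡ-≤₀ N (0≤ℕ→ℚ (suc (suc n)))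
               (*-mono-≤₀ (≤-trans 0≤κS (κ-spread n)) 0≤κS (κ-spread n) (κ-spread n))) ⟩
          count T * (N * ((τ * ε n) * (τ * ε n))) ≡⟨ solve 4 (λ c N t e → c :* (N :* ((t :* e) :* (t :* e))) := c :* (t :* t :* (e :* (e :* N)))) refl (count T) N τ (ε n) ⟩
          count T * (τ * τ * (ε n * (ε n * N))) ≡⟨ cong (λ y → count T * (τ * τ * y)) (trans (cong (ε n *_) (ε-* n)) (*-identityʳ (ε n))) ⟩
          count T * (τ * τ * ε n) ∎
          where
          open ≤-Reasoning
          T = topTilings d b n
          μ = m (suc (suc n))
          S = spread (suc (suc n))
          N = ℕ→ℚ (suc (suc n))
          0≤κS = 0≤* (0≤κ n) (0≤spread (suc (suc n)))

  triangular-mono : ∀ {m n} → m ℕ.≤ n → triangular m ℕ.≤ triangular n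
  triangular-mono z≤n = z≤n
  triangular-mono (s≤s m≤n) = ℕP.+-mono-≤ m≤n (triangular-mono m≤n)

  triangular-double : ∀ n → triangular n ℕ.+ triangular n ℕ.+ n ≡ n ℕ.* n
  triangular-double zero = refl
  triangular-double (suc n) = trans
    (S.solve 2 (λ n t → n S.:+ t S.:+ (n S.:+ t) S.:+ (S.con 1 S.:+ n) S.:= (t S.:+ t S.:+ n) S.:+ (n S.:+ (S.con 1 S.:+ n))) refl n (triangular n))
    (trans (cong (ℕ._+ (n ℕ.+ suc n)) (triangular-double n))
      (S.solve 1 (λ n → n S.:* n S.:+ (n S.:+ (S.con 1 S.:+ n)) S.:= (S.con 1 S.:+ n) S.:* (S.con 1 S.:+ n)) refl n))
    where module S = ℕSolver.+-*-Solver

  module SizeConcentration (d' b : ℕ) (b≤d : b ℕ.≤ suc d') where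

    d : ℕ
    d = suc d'

    open Statistics d
    open Concentration (topTilings d b)
    open Normalised d b b≤d

    average-of : (ℕ → ℚ) → ℚ
    average-of F = Σ< d F * inv d'

    d*average : ∀ F → dq * average-of F ≡ Σ< d F
    d*average F = trans (solve 3 (λ e s v → e :* (s :* v) := s :* (v :* e)) refl dq (Σ< d F) (inv d'))
      (trans (cong (Σ< d F *_) (inv-* d')) (*-identityʳ (Σ< d F)))

    meanBeads meanPairs : ℚ
    meanBeads = average-of (λ i → ℕ→ℚ (suc i))
    meanPairs = average-of (λ i → ℕ→ℚ (triangular (suc i)))

    private
      -- One bound for letters and for their mean; the second summand spares a proof that an average
      -- is at most the maximum.
      D = dq + ∣ meanBeads ∣

      0≤D : 0ℚ ≤ D
      0≤D = 0≤+ 0≤d (0≤∣p∣ meanBeads)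

      bound-ℕ : ∀ {a n} c → a ℕ.≤ n → ∣ ℕ→ℚ a ∣ ≤ ℕ→ℚ n + ∣ c ∣
      bound-ℕ {a} {n} c a≤n = ≤-trans (≤-reflexive (0≤p⇒∣p∣≡p (0≤ℕ→ℚ a)))
        (≤-trans (ℕ→ℚ-mono a≤n) (diff-≤ ∣ c ∣ (0≤∣p∣ c) refl))

      bound-mean : ∀ n c → ∣ c ∣ ≤ ℕ→ℚ n + ∣ c ∣
      bound-mean n c = diff-≤ (ℕ→ℚ n) (0≤ℕ→ℚ n) (+-comm (ℕ→ℚ n) ∣ c ∣)

    beads-linear : Linear (λ cs → ℕ→ℚ (sum cs)) (λ _ a → ℕ→ℚ a) (λ _ → meanBeads) (λ _ → D)
    beads-linear = record
      { W-[] = refl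
      ; W-mono = λ _ → refl
      ; W-dimer = λ a cs → trans (ℕ→ℚ-+ a (sum cs)) (+-comm (ℕ→ℚ a) (ℕ→ℚ (sum cs)))
      ; average = λ _ → d*average (λ i → ℕ→ℚ (suc i))
      ; B-mono = λ _ → ≤-refl
      ; φ-bound = λ _ a a≤d → bound-ℕ meanBeads a≤d
      ; φ̄-bound = λ _ → bound-mean d meanBeads
      }

    pairs-linear : Linear (λ cs → ℕ→ℚ (pairs cs)) (λ _ a → ℕ→ℚ (triangular a)) (λ _ → meanPairs)
      (λ _ → ℕ→ℚ (triangular d) + ∣ meanPairs ∣)
    pairs-linear = record
      { W-[] = refl
      ; W-mono = λ _ → refl
      ; W-dimer = λ a cs → trans (ℕ→ℚ-+ (triangular a) (pairs cs)) (+-comm (ℕ→ℚ (triangular a)) (ℕ→ℚ (pairs cs)))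
      ; average = λ _ → d*average (λ i → ℕ→ℚ (triangular (suc i)))
      ; B-mono = λ _ → ≤-refl
      ; φ-bound = λ _ a a≤d → bound-ℕ meanPairs (triangular-mono a≤d)
      ; φ̄-bound = λ _ → bound-mean (triangular d) meanPairs
      }

    moment₁-linear : Linear (λ cs → ℕ→ℚ (moment₁ cs)) (λ n a → ℕ→ℚ a * ℕ→ℚ (suc n)) (λ n → meanBeads * ℕ→ℚ (suc n))
      (λ n → D * ℕ→ℚ (suc n))
    moment₁-linear = record
      { W-[] = refl
      ; W-mono = λ _ → refl
      ; W-dimer = λ a cs → trans (ℕ→ℚ-+ (a ℕ.* suc (length cs)) (moment₁ cs))
          (trans (+-comm (ℕ→ℚ (a ℕ.* suc (length cs))) (ℕ→ℚ (moment₁ cs))) (cong (ℕ→ℚ (moment₁ cs) +_) (ℕ→ℚ-* a (suc (length cs)))))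
      ; average = λ n → begin
          dq * (meanBeads * ℕ→ℚ (suc n)) ≡⟨ solve 3 (λ e m s → e :* (m :* s) := s :* (e :* m)) refl dq meanBeads (ℕ→ℚ (suc n)) ⟩
          ℕ→ℚ (suc n) * (dq * meanBeads) ≡⟨ cong (ℕ→ℚ (suc n) *_) (d*average (λ i → ℕ→ℚ (suc i))) ⟩
          ℕ→ℚ (suc n) * Σ< d (λ i → ℕ→ℚ (suc i)) ≡⟨ sym (Σ<-* d (ℕ→ℚ (suc n)) (λ i → ℕ→ℚ (suc i))) ⟩
          Σ< d (λ i → ℕ→ℚ (suc n) * ℕ→ℚ (suc i)) ≡⟨ Σ<-cong d (λ i → *-comm (ℕ→ℚ (suc n)) (ℕ→ℚ (suc i))) ⟩
          Σ< d (λ i → ℕ→ℚ (suc i) * ℕ→ℚ (suc n)) ∎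
      ; B-mono = λ n → *-monoˡ-≤₀ D 0≤D (ℕ→ℚ-mono (ℕP.n≤1+n (suc n)))
      ; φ-bound = λ n a a≤d → ∣*∣≤ {ℕ→ℚ a} {ℕ→ℚ (suc n)} (bound-ℕ meanBeads a≤d) (∣N∣ n)
      ; φ̄-bound = λ n → ∣*∣≤ {meanBeads} {ℕ→ℚ (suc n)} (bound-mean d meanBeads) (∣N∣ n)
      }
      where
      open ≡-Reasoning
      ∣N∣ : ∀ n → ∣ ℕ→ℚ (suc n) ∣ ≤ ℕ→ℚ (suc n)
      ∣N∣ n = ≤-reflexive (0≤p⇒∣p∣≡p (0≤ℕ→ℚ (suc n)))

    private
      exact : ∀ n p → ∣ p - p ∣ ≤ 0ℚ * ε n
      exact n p = ≤-reflexive (trans (cong ∣_∣ (+-inverseʳ p)) (sym (*-zeroˡ (ε n))))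

    beads-concentrates : Concentrates (λ n cs → ℕ→ℚ (sum cs) * ε n)
    beads-concentrates = concentrates beads-linear ε 0≤ε D (λ n → ≤-reflexive (*-comm (ε n) D))
      (λ n → density (suc n)) 0ℚ (conv-suc density density-conv) (λ n → exact n (density (suc n)))
      where open ConstantMean meanBeads

    pairs-concentrates : Concentrates (λ n cs → ℕ→ℚ (pairs cs) * ε n)
    pairs-concentrates = concentrates pairs-linear ε 0≤ε (ℕ→ℚ (triangular d) + ∣ meanPairs ∣) (λ n → ≤-reflexive (*-comm (ε n) _))
      (λ n → density (suc n)) 0ℚ (conv-suc density density-conv) (λ n → exact n (density (suc n)))
      where open ConstantMean meanPairs

    -- By `linear-mean` twice the mean of S₁ is the length times the mean of S₃ up to `O(n)`; hence
    -- the centre is half the bead density and the error constant `½ * C`.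
    moment₁-concentrates : Concentrates (λ n cs → ℕ→ℚ (moment₁ cs) * (ε n * ε n))
    moment₁-concentrates = concentrates moment₁-linear (λ n → ε n * ε n) (λ n → 0≤* (0≤ε n) (0≤ε n)) (D * (1ℚ + 1ℚ)) κB
      (λ n → ½ * density (suc n)) (½ * C) (conv-* (λ _ → ½) (density ∘ suc) (conv-const ½) (conv-suc density density-conv)) near
      where
      open ConstantMean meanBeads
      C = proj₁ linear-mean
      -- The factor 2 bounds (n + 3) / (n + 2), as the weight bound at length `n + 2` is
      -- `D * (n + 3)`.
      κB : ∀ n → ε n * ε n * (D * ℕ→ℚ (suc (suc (suc n)))) ≤ D * (1ℚ + 1ℚ) * ε n
      κB n = begin
        ε n * ε n * (D * ℕ→ℚ (suc (suc (suc n)))) ≡⟨ cong (λ y → ε n * ε n * (D * y)) (ℕ→ℚ-suc (suc (suc n))) ⟩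
        ε n * ε n * (D * (1ℚ + ℕ→ℚ (suc (suc n)))) ≡⟨ solve 3 (λ e D N → e :* e :* (D :* (con 1ℚ :+ N)) := D :* (e :+ e :* N) :* e) refl (ε n) D (ℕ→ℚ (suc (suc n))) ⟩
        D * (ε n + ε n * ℕ→ℚ (suc (suc n))) * ε n ≡⟨ cong (λ y → D * (ε n + y) * ε n) (ε-* n) ⟩
        D * (ε n + 1ℚ) * ε n ≤⟨ *-monoʳ-≤₀ (ε n) (0≤ε n) (*-monoˡ-≤₀ D 0≤D (+-monoˡ-≤ 1ℚ (inv≤1 (suc n)))) ⟩
        D * (1ℚ + 1ℚ) * ε n ∎
        where open ≤-Reasoning
      near : ∀ n → ∣ mean (λ n → meanBeads * ℕ→ℚ (suc n)) (suc (suc n)) * (ε n * ε n) - ½ * density (suc n) ∣ ≤ ½ * C * ε n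
      near n = begin
        ∣ s * (e * e) - ½ * (m * e) ∣ ≡⟨ cong (λ y → ∣ s * (e * e) - ½ * (m * y) ∣) (sym (trans (cong (e *_) (ε-* n)) (*-identityʳ e))) ⟩
        ∣ s * (e * e) - ½ * (m * (e * (e * N))) ∣ ≡⟨ cong ∣_∣ (solve 4 (λ s m e N → s :* (e :* e) :- con ½ :* (m :* (e :* (e :* N))) :=
             (con ½ :* (e :* e)) :* (s :+ s :- N :* m)) refl s m e N) ⟩
        ∣ ½ * (e * e) * (s + s - N * m) ∣ ≤⟨ ∣*∣≤ {½ * (e * e)} {s + s - N * m}
             (≤-reflexive (0≤p⇒∣p∣≡p (0≤* {½} (nonNegative⁻¹ ½) (0≤* (0≤ε n) (0≤ε n))))) (proj₂ linear-mean (suc (suc n))) ⟩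
        ½ * (e * e) * (C * N) ≡⟨ solve 4 (λ h e C N → h :* (e :* e) :* (C :* N) := h :* C :* (e :* (e :* N))) refl ½ e C N ⟩
        ½ * C * (e * (e * N)) ≡⟨ cong (½ * C *_) (trans (cong (e *_) (ε-* n)) (*-identityʳ e)) ⟩
        ½ * C * e ∎
        where
        open ≤-Reasoning
        s = mean (λ n → meanBeads * ℕ→ℚ (suc n)) (suc (suc n))
        m = mean (λ _ → meanBeads) (suc (suc n))
        e = ε n
        N = ℕ→ℚ (suc (suc n))

    size-concentrates : Concentrates (λ n cs → ℕ→ℚ (size (partition n d cs)) * (ε n * ε n))
    -- The subtractions are written as multiples by negative constants, since the closure properties
    -- cover constants, sums and products.
    size-concentrates = concentrates-cong {λ n cs → w₁ n cs + w₂ n cs + (- ½) * (w₃ n cs * w₃ n cs + (- 1ℚ) * (ε n * w₃ n cs))} same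
      (concentrates-+ (concentrates-+ moment₁-concentrates pairs-concentrates)
        (concentrates-* (concentrates-const (- ½)) (concentrates-+ (concentrates-* beads-concentrates beads-concentrates)
          (concentrates-* (concentrates-const (- 1ℚ)) (concentrates-* concentrates-ε beads-concentrates)))))
      where
      w₁ w₂ w₃ : ℕ → List ℕ → ℚ
      w₁ n cs = ℕ→ℚ (moment₁ cs) * (ε n * ε n)
      w₂ n cs = ℕ→ℚ (pairs cs) * ε n
      w₃ n cs = ℕ→ℚ (sum cs) * ε n
      same : ∀ n {cs} → cs ∈ topTilings d b n →
        w₁ n cs + w₂ n cs + (- ½) * (w₃ n cs * w₃ n cs + (- 1ℚ) * (ε n * w₃ n cs)) ≡ ℕ→ℚ (size (partition n d cs)) * (ε n * ε n)
      same n {cs} p = sym (begin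
        X * (e * e) ≡⟨ cong (_* (e * e)) X≡ ⟩
        (S₁ + N * S₂ - t) * (e * e)
          ≡⟨ solve 5 (λ s₁ s₂ t e N → (s₁ :+ N :* s₂ :- t) :* (e :* e) := s₁ :* (e :* e) :+ s₂ :* (e :* (e :* N)) :+ (:- con ½) :* ((t :+ t) :* (e :* e)))
               refl S₁ S₂ t e N ⟩
        S₁ * (e * e) + S₂ * (e * (e * N)) + (- ½) * ((t + t) * (e * e))
          ≡⟨ cong₂ (λ y y' → S₁ * (e * e) + S₂ * y + (- ½) * (y' * (e * e))) (trans (cong (e *_) (ε-* n)) (*-identityʳ e)) 2t≡ ⟩
        S₁ * (e * e) + S₂ * e + (- ½) * ((S₃ * S₃ - S₃) * (e * e))
          ≡⟨ solve 4 (λ s₁ s₂ s₃ e → s₁ :* (e :* e) :+ s₂ :* e :+ (:- con ½) :* ((s₃ :* s₃ :- s₃) :* (e :* e)) :=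
               s₁ :* (e :* e) :+ s₂ :* e :+ (:- con ½) :* ((s₃ :* e) :* (s₃ :* e) :+ (:- con 1ℚ) :* (e :* (s₃ :* e)))) refl S₁ S₂ S₃ e ⟩
        w₁ n cs + w₂ n cs + (- ½) * (w₃ n cs * w₃ n cs + (- 1ℚ) * (e * w₃ n cs)) ∎)
        where
        open ≡-Reasoning
        e = ε n
        N = ℕ→ℚ (suc (suc n))
        X = ℕ→ℚ (size (partition n d cs))
        S₁ = ℕ→ℚ (moment₁ cs)
        S₂ = ℕ→ℚ (pairs cs)
        S₃ = ℕ→ℚ (sum cs)
        t = ℕ→ℚ (triangular (sum cs))
        member = ∈-topTilings⁻ d b n b≤d p
        X+t≡ : X + t ≡ S₁ + N * S₂
        X+t≡ = trans (sym (ℕ→ℚ-+ (size (partition n d cs)) (triangular (sum cs))))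
          (trans (cong ℕ→ℚ (size-partition {d} {n} {cs} (proj₁ member) (proj₁ (proj₂ member))))
            (trans (ℕ→ℚ-+ (moment₁ cs) (suc (suc n) ℕ.* pairs cs)) (cong (S₁ +_) (ℕ→ℚ-* (suc (suc n)) (pairs cs)))))
        X≡ : X ≡ S₁ + N * S₂ - t
        X≡ = trans (solve 2 (λ x t → x := x :+ t :- t) refl X t) (cong (_- t) X+t≡)
        2t≡ : t + t ≡ S₃ * S₃ - S₃
        2t≡ = trans (solve 2 (λ t s → t :+ t := t :+ t :+ s :- s) refl t S₃) (cong (_- S₃)
          (trans (cong (_+ S₃) (sym (ℕ→ℚ-+ (triangular (sum cs)) (triangular (sum cs)))))
            (trans (sym (ℕ→ℚ-+ (triangular (sum cs) ℕ.+ triangular (sum cs)) (sum cs)))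
              (trans (cong ℕ→ℚ (triangular-double (sum cs))) (ℕ→ℚ-* (sum cs) (sum cs))))))

  -- From tilings back to the enumerated cores

  moment-* : ∀ k L → moment k L * count L ≡ ℕ→ℚ (sum (map (λ λs → size λs ℕ.^ k) L))
  moment-* k [] = refl
  moment-* k L@(_ ∷ L') = /-*-cancel (sum (map (λ λs → size λs ℕ.^ k) L)) (length L')

  ℕ→ℚ-sum : ∀ {A : Set} (f : A → ℕ) xs → ℕ→ℚ (sum (map f xs)) ≡ ΣL (λ x → ℕ→ℚ (f x)) xs
  ℕ→ℚ-sum f [] = refl
  ℕ→ℚ-sum f (x ∷ xs) = trans (ℕ→ℚ-+ (f x) (sum (map f xs))) (cong (ℕ→ℚ (f x) +_) (ℕ→ℚ-sum f xs))

  ∈⇒suc-length : ∀ {A : Set} {x : A} {xs} → x ∈ xs → ∃ λ l → length xs ≡ suc l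
  ∈⇒suc-length {xs = _ ∷ xs} _ = length xs , refl

  module _ (d' k' b : ℕ) (b≤d : b ℕ.≤ suc d') (t : ℕ → ℕ) (fam : ∀ n → Family (suc d') n b (t (suc (suc n))))
    (enum : ℕ → List (List ℕ)) (enumerates : Enumerates (λ n → n) t enum) where

    open SizeConcentration d' b b≤d
    open Concentration (topTilings d b)

    private
      k = suc k'
      T = topTilings d b

      1≤d : 1 ℕ.≤ d
      1≤d = s≤s z≤n

      2≤ : ∀ n → 2 ℕ.≤ suc (suc n)
      2≤ n = s≤s (s≤s z≤n)

      -- The given enumeration is known only as a duplicate-free list with prescribed members, hence
      -- only up to order; this suffices for lengths and sums.
      enum↭ : ∀ n → enum (suc (suc n)) ↭ map (partition n d) (T n)
      enum↭ n = ∼bag⇒↭ (unique∧set⇒bag (proj₁ (enumerates (suc (suc n)) (2≤ n)))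
        (unique-map (partition n d) (partition-injective 1≤d (fam n)) (topTilings-unique d b n))
        (λ {λs} → mk⇔
          (λ p → core-partition 1≤d (fam n) (Equivalence.to (proj₂ (enumerates (suc (suc n)) (2≤ n)) λs) p))
          (λ p → Equivalence.from (proj₂ (enumerates (suc (suc n)) (2≤ n)) λs) (from p))))
        where
        from : ∀ {λs} → λs ∈ map (partition n d) (T n) → DistinctCore (suc (suc n)) (t (suc (suc n))) λs
        from p with ∈-map⁻ (partition n d) p
        ... | cs , cs∈ , refl = partition-core 1≤d (fam n) cs∈

      count-enum : ∀ n → count (enum (suc (suc n))) ≡ count (T n)
      count-enum n = cong ℕ→ℚ (trans (↭-length (enum↭ n)) (length-map (partition n d) (T n)))

      scale : ℕ → ℚ
      scale n = ℕ→ℚ (suc (suc n) ℕ.^ (2 ℕ.* k))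

      Y : ℕ → List ℕ → ℚ
      Y n cs = ℕ→ℚ (size (partition n d cs)) * (ε n * ε n)

      power-size : ∀ n s j → ℕ→ℚ (s ℕ.^ j) ≡ ℕ→ℚ (suc (suc n) ℕ.^ (2 ℕ.* j)) * power (ℕ→ℚ s * (ε n * ε n)) j
      power-size n s j = trans (go j) (cong (λ e → ℕ→ℚ e * power (ℕ→ℚ s * (ε n * ε n)) j) (ℕP.^-*-assoc N 2 j))
        where
        N = suc (suc n)
        go : ∀ j → ℕ→ℚ (s ℕ.^ j) ≡ ℕ→ℚ ((N ℕ.^ 2) ℕ.^ j) * power (ℕ→ℚ s * (ε n * ε n)) j
        go zero = refl
        go (suc j) = begin
          ℕ→ℚ (s ℕ.* s ℕ.^ j) ≡⟨ ℕ→ℚ-* s (s ℕ.^ j) ⟩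
          ℕ→ℚ s * ℕ→ℚ (s ℕ.^ j) ≡⟨ cong₂ _*_ unscale (go j) ⟩
          ℕ→ℚ (N ℕ.^ 2) * (ℕ→ℚ s * (ε n * ε n)) * (u * p) ≡⟨ solve 4 (λ a b u p → a :* b :* (u :* p) := a :* u :* (b :* p)) refl (ℕ→ℚ (N ℕ.^ 2)) (ℕ→ℚ s * (ε n * ε n)) u p ⟩
          ℕ→ℚ (N ℕ.^ 2) * u * (ℕ→ℚ s * (ε n * ε n) * p) ≡⟨ cong (_* (ℕ→ℚ s * (ε n * ε n) * p)) (sym (ℕ→ℚ-* (N ℕ.^ 2) ((N ℕ.^ 2) ℕ.^ j))) ⟩
          ℕ→ℚ ((N ℕ.^ 2) ℕ.^ suc j) * power (ℕ→ℚ s * (ε n * ε n)) (suc j) ∎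
          where
          open ≡-Reasoning
          u = ℕ→ℚ ((N ℕ.^ 2) ℕ.^ j)
          p = power (ℕ→ℚ s * (ε n * ε n)) j
          unscale : ℕ→ℚ s ≡ ℕ→ℚ (N ℕ.^ 2) * (ℕ→ℚ s * (ε n * ε n))
          unscale = sym (begin
            ℕ→ℚ (N ℕ.* (N ℕ.* 1)) * (ℕ→ℚ s * (ε n * ε n)) ≡⟨ cong (λ y → ℕ→ℚ (N ℕ.* y) * (ℕ→ℚ s * (ε n * ε n))) (ℕP.*-identityʳ N) ⟩
            ℕ→ℚ (N ℕ.* N) * (ℕ→ℚ s * (ε n * ε n)) ≡⟨ cong (_* (ℕ→ℚ s * (ε n * ε n))) (ℕ→ℚ-* N N) ⟩
            ℕ→ℚ N * ℕ→ℚ N * (ℕ→ℚ s * (ε n * ε n)) ≡⟨ solve 3 (λ N s e → N :* N :* (s :* (e :* e)) := s :* ((e :* N) :* (e :* N))) refl (ℕ→ℚ N) (ℕ→ℚ s) (ε n) ⟩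
            ℕ→ℚ s * ((ε n * ℕ→ℚ N) * (ε n * ℕ→ℚ N)) ≡⟨ cong (λ y → ℕ→ℚ s * (y * y)) (ε-* n) ⟩
            ℕ→ℚ s * (1ℚ * 1ℚ) ≡⟨ *-identityʳ (ℕ→ℚ s) ⟩
            ℕ→ℚ s ∎)

      moment-sum : ∀ n → moment k (enum (suc (suc n))) * count (T n) ≡ scale n * ΣL (λ cs → power (Y n cs) k) (T n)
      moment-sum n = begin
        moment k (enum N) * count (T n) ≡⟨ cong (moment k (enum N) *_) (sym (count-enum n)) ⟩
        moment k (enum N) * count (enum N) ≡⟨ moment-* k (enum N) ⟩
        ℕ→ℚ (sum (map f (enum N))) ≡⟨ cong ℕ→ℚ (sum-↭ (map⁺ f (enum↭ n))) ⟩
        ℕ→ℚ (sum (map f (map (partition n d) (T n)))) ≡⟨ ℕ→ℚ-sum f (map (partition n d) (T n)) ⟩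
        ΣL (λ λs → ℕ→ℚ (f λs)) (map (partition n d) (T n)) ≡⟨ ΣL-map (partition n d) (λ λs → ℕ→ℚ (f λs)) (T n) ⟩
        ΣL (λ cs → ℕ→ℚ (f (partition n d cs))) (T n) ≡⟨ ΣL-cong (T n) (λ {cs} _ → power-size n (size (partition n d cs)) k) ⟩
        ΣL (λ cs → scale n * power (Y n cs) k) (T n) ≡⟨ ΣL-* (scale n) (λ cs → power (Y n cs) k) (T n) ⟩
        scale n * ΣL (λ cs → power (Y n cs) k) (T n) ∎
        where
        open ≡-Reasoning
        N = suc (suc n)
        f : List ℕ → ℕ
        f λs = size λs ℕ.^ k

      open Concentrates (concentrates-^ size-concentrates k)

      -- The word of zeros, which encodes the empty partition, is always present; this permits
      -- cancelling the count in `close`.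
      top-nonempty : ∀ n → ∃ λ l → length (T n) ≡ suc l
      top-nonempty n = ∈⇒suc-length (∈-topTilings⁺ d b n {λ _ → 0}
        (record { zeroth = refl ; isolated = λ _ → inj₁ refl ; bounded = λ _ → z≤n }) z≤n)

      close : ∀ n → ∣ moment k (enum (suc (suc n))) - z n * scale n ∣ ≤ Cb * ε n * scale n
      close n = *-cancel-≤ (proj₁ (top-nonempty n)) (subst (λ c → ∣ M - z n * u ∣ * c ≤ Cb * ε n * u * c)
        (cong ℕ→ℚ (proj₂ (top-nonempty n))) (begin
          ∣ M - z n * u ∣ * c ≡⟨ cong (∣ M - z n * u ∣ *_) (sym (0≤p⇒∣p∣≡p (0≤count (T n)))) ⟩
          ∣ M - z n * u ∣ * ∣ c ∣ ≡⟨ sym (∣p*q∣≡∣p∣*∣q∣ (M - z n * u) c) ⟩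
          ∣ (M - z n * u) * c ∣ ≡⟨ cong ∣_∣ (trans (solve 4 (λ M z u c → (M :- z :* u) :* c := M :* c :- u :* (c :* z)) refl M (z n) u c)
               (trans (cong (_- u * (c * z n)) (moment-sum n)) (solve 3 (λ u s t → u :* s :- u :* t := u :* (s :- t)) refl u S (c * z n)))) ⟩
          ∣ u * (S - c * z n) ∣ ≤⟨ ∣*∣≤ {u} {S - c * z n} (≤-reflexive (0≤p⇒∣p∣≡p (0≤ℕ→ℚ (suc (suc n) ℕ.^ (2 ℕ.* k)))))
               (subst (λ y → ∣ y ∣ ≤ c * (Cb * ε n)) (ΣL-center (λ cs → power (Y n cs) k) (z n) (T n)) (bias n)) ⟩
          u * (c * (Cb * ε n)) ≡⟨ solve 4 (λ u c b e → u :* (c :* (b :* e)) := b :* e :* u :* c) refl u c Cb (ε n) ⟩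
          Cb * ε n * u * c ∎))
        where
        open ≤-Reasoning
        M = moment k (enum (suc (suc n)))
        u = scale n
        c = count (T n)
        S = ΣL (λ cs → power (Y n cs) k) (T n)

    moments-leadingTerm : HasLeadingTerm (λ n → moment k (enum n)) (2 ℕ.* k)
    -- The exponent passed here is the predecessor of `2 * suc k'` as that product computes.
    moments-leadingTerm = leadingTerm {λ n → moment k (enum n)} (k' ℕ.+ (suc k' ℕ.+ 0)) {z} z-conv Cb close

open import Data.Nat using (ℕ; suc; _+_; _*_; _∸_; _≤_)
open import Data.Nat.Properties using (≤-refl; n≤1+n)
open import Data.List using (List)
open import Data.Product using (_×_; _,_)
open import Relation.Binary.PropositionalEquality using (refl)
open Cores using (plus; minus)
open Asymptotics using (moments-leadingTerm)

theorem1p7 : (d k : ℕ) → 1 ≤ d → 1 ≤ k →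
    (enum⁺ enum⁻ : ℕ → List (List ℕ)) →
    Enumerates (λ n → n) (λ n → d * n + 1) enum⁺ →
    Enumerates (λ n → n) (λ n → d * n ∸ 1) enum⁻ →
    HasLeadingTerm (λ n → moment k (enum⁺ n)) (2 * k) ×
    HasLeadingTerm (λ n → moment k (enum⁻ n)) (2 * k)
theorem1p7 (suc d) (suc k) _ _ enum⁺ enum⁻ enumerates⁺ enumerates⁻ =
    moments-leadingTerm d k (suc d) ≤-refl (λ n → suc d * n + 1) (λ _ → plus) enum⁺ enumerates⁺
  -- At lengths `suc (suc _)` the product computes to a successor, so the subtraction of 1 does not
  -- truncate and `suc t ≡ d * n` holds by `refl`.
  , moments-leadingTerm d k d (n≤1+n d) (λ n → suc d * n ∸ 1) (λ _ → minus refl refl) enum⁻ enumerates⁻
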